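{- For every integer $k\ge 2$ there exist constants $c_1,c_2>0$ (depending only on $k$) such that the following holds for all integers $n\ge 2$ and $N\ge 1$. If $G$ is an $N$-vertex graph with no independent set of size $n$ and $N\ge c_1\, n^{k-1}/(\log n)^{k-2}$, then $G$ contains at least $$c_2\binom{N}{k}\Big(\frac{\log n}{n}\Big)^{\binom{k}{2}}\cdot\frac{1}{\log n}$$ cliques of size $k$.
   Context: Graphs are finite and simple. A clique of size $k$ is a set of $k$ pairwise adjacent vertices (cliques are counted as unlabeled vertex sets). $\log$ is the natural logarithm. -}

module Defs where

open import Data.Nat.Base as ℕ using (ℕ; zero; suc)
import Data.Nat.Properties as ℕₚ
open import Data.Nat.Solver using () renaming (module +-*-Solver to ℕ-Solver)
open import Data.Integer.Base as ℤ using (ℤ; +_; +[1+_]; -[1+_])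
import Data.Integer.Properties as ℤₚ
import Data.Rational.Unnormalised.Base as ℚᵘ
import Data.Rational.Unnormalised.Properties as ℚᵘₚ
open import Data.Rational.Base as ℚ
  using (ℚ; mkℚ; 0ℚ; 1ℚ; ½; _/_; 1/_; _+_; _*_; _-_; -_; ∣_∣; _<_; _≤_; *<*)
open import Data.Rational.Properties as ℚₚ using (_≟_)
open import Data.Rational.Solver using () renaming (module +-*-Solver to ℚ-Solver)
open import Data.Fin.Base using (Fin)
import Data.Fin.Properties as Finₚ
open import Data.Fin.Subset as Sub using (Subset; _∈_; inside; outside)
open import Data.Fin.Subset.Properties using (_∈?_)
open import Data.List.Base using (List; [_]; _++_; map; filter; length)
import Data.Vec.Base as Vec
open import Data.Product.Base using (∃; _×_; _,_)
open import Data.Sum.Base using (inj₁; inj₂)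
open import Relation.Nullary using (¬_; Dec; yes; no; contradiction)
open import Relation.Nullary.Decidable using (_→-dec_; _×-dec_; ¬?)
open import Relation.Binary.Definitions using (Symmetric; Irreflexive; Decidable)
open import Relation.Binary.PropositionalEquality
  using (_≡_; _≢_; refl; sym; trans; cong; cong₂; subst)

record Graph (N : ℕ) : Set₁ where
  field
    _~_      : Fin N → Fin N → Set
    _~?_     : Decidable _~_
    ~-sym    : Symmetric _~_
    ~-irrefl : Irreflexive _≡_ _~_

module _ {N : ℕ} (G : Graph N) where
  open Graph G

  IsClique : Subset N → Set
  IsClique S = ∀ i j → i ∈ S → j ∈ S → i ≢ j → i ~ j

  IsIndependent : Subset N → Set
  IsIndependent S = ∀ i j → i ∈ S → j ∈ S → ¬ (i ~ j)

  HasIndependentSet : ℕ → Set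
  HasIndependentSet n = ∃ λ S → IsIndependent S × Sub.∣ S ∣ ≡ n

  isClique? : ∀ S → Dec (IsClique S)
  isClique? S = Finₚ.all? λ i → Finₚ.all? λ j →
    (i ∈? S) →-dec ((j ∈? S) →-dec (¬? (i Finₚ.≟ j) →-dec (i ~? j)))

-- Every subset occurs exactly once.
allSubsets : ∀ N → List (Subset N)
allSubsets zero    = [ Vec.[] ]
allSubsets (suc N) = map (inside Vec.∷_) (allSubsets N) ++ map (outside Vec.∷_) (allSubsets N)

numCliques : ∀ {N} → Graph N → ℕ → ℕ
numCliques {N} G k =
  length (filter (λ S → isClique? G S ×-dec (Sub.∣ S ∣ ℕₚ.≟ k)) (allSubsets N))

record ℝ : Set where
  field
    seq    : ℕ → ℚ
    cauchy : ∀ ε → 0ℚ < ε →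
             ∃ λ M → ∀ m n → M ℕ.≤ m → M ℕ.≤ n → ∣ seq m - seq n ∣ < ε

open ℝ public

infix 4 _≤ℝ_ _<ℝ_

_≤ℝ_ : ℝ → ℝ → Set
x ≤ℝ y = ∀ ε → 0ℚ < ε → ∃ λ M → ∀ m → M ℕ.≤ m → seq x m ≤ seq y m + ε

_<ℝ_ : ℝ → ℝ → Set
x <ℝ y = ∃ λ ε → 0ℚ < ε × (∃ λ M → ∀ m → M ℕ.≤ m → seq x m + ε ≤ seq y m)

fromℚ : ℚ → ℝ
fromℚ q .seq    _   = q
fromℚ q .cauchy ε p = 0 , λ _ _ _ _ →
  subst (λ z → ∣ z ∣ < ε) (sym (ℚₚ.+-inverseʳ q)) p

fromℕ : ℕ → ℝ
fromℕ n = fromℚ (+ n / 1)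

0ℝ 1ℝ : ℝ
0ℝ = fromℕ 0
1ℝ = fromℕ 1

private
  0<1 : 0ℚ < 1ℚ
  0<1 = *<* (ℤ.+<+ (ℕ.s≤s ℕ.z≤n))

  pos* : ∀ {p q} → 0ℚ < p → 0ℚ < q → 0ℚ < p * q
  pos* {p} {q} 0<p 0<q = ℚₚ.positive⁻¹ (p * q)
    {{ℚₚ.pos*pos⇒pos p {{ℚ.positive 0<p}} q {{ℚ.positive 0<q}}}}

  pos-1/ : ∀ {p} (0<p : 0ℚ < p) → 0ℚ < (1/ p) {{ℚ.>-nonZero 0<p}}
  pos-1/ {p} 0<p = ℚₚ.positive⁻¹ _ {{ℚₚ.1/pos⇒pos p {{ℚ.positive 0<p}}}}

  *-mono-≤ : ∀ {p q r s} → 0ℚ ≤ p → 0ℚ ≤ s → p ≤ q → r ≤ s → p * r ≤ q * s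
  *-mono-≤ {p} {q} {r} {s} 0≤p 0≤s p≤q r≤s = ℚₚ.≤-trans
    (ℚₚ.*-monoˡ-≤-nonNeg p {{ℚ.nonNegative 0≤p}} r≤s)
    (ℚₚ.*-monoʳ-≤-nonNeg s {{ℚ.nonNegative 0≤s}} p≤q)

  module Ring where
    open ℚ-Solver
    cancel-mid : ∀ a b → a ≡ (a - b) + b
    cancel-mid = solve 2 (λ a b → a := (a :- b) :+ b) refl
    cancelʳ : ∀ a b → a + b - b ≡ a
    cancelʳ = solve 2 (λ a b → a :+ b :- b := a) refl
    cancelˡ : ∀ a b → b + a - b ≡ a
    cancelˡ = solve 2 (λ a b → b :+ a :- b := a) refl
    neg-sub : ∀ p q → - (p - q) ≡ q - p
    neg-sub = solve 2 (λ p q → :- (p :- q) := q :- p) refl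
    product-diff : ∀ a b c d → a * b - c * d ≡ a * (b - d) + d * (a - c)
    product-diff = solve 4 (λ a b c d → a :* b :- c :* d := a :* (b :- d) :+ d :* (a :- c)) refl
    recip-diff : ∀ a b u v → b * v * u - a * u * v ≡ (u * v) * (b - a)
    recip-diff = solve 4 (λ a b u v → b :* v :* u :- a :* u :* v := (u :* v) :* (b :- a)) refl
    swapʳ : ∀ a b c → a * b * c ≡ a * c * b
    swapʳ = solve 3 (λ a b c → a :* b :* c := a :* c :* b) refl
    regroup : ∀ r e h → (r * r) * (e * (h * h)) ≡ (h * r) * ((h * r) * e)
    regroup = solve 3 (λ r e h → (r :* r) :* (e :* (h :* h)) := (h :* r) :* ((h :* r) :* e)) refl

  bounded : (x : ℝ) → ∃ λ B → 0ℚ < B × (∃ λ M → ∀ m → M ℕ.≤ m → ∣ seq x m ∣ ≤ B)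
  bounded x with cauchy x 1ℚ 0<1
  ... | M , c = 1ℚ + ∣ seq x M ∣
              , ℚₚ.+-mono-<-≤ 0<1 (ℚₚ.0≤∣p∣ (seq x M))
              , M , bound
    where
    open ℚₚ.≤-Reasoning
    bound : ∀ m → M ℕ.≤ m → ∣ seq x m ∣ ≤ 1ℚ + ∣ seq x M ∣
    bound m M≤m = begin
      ∣ seq x m ∣
        ≡⟨ cong ∣_∣ (Ring.cancel-mid (seq x m) (seq x M)) ⟩
      ∣ (seq x m - seq x M) + seq x M ∣
        ≤⟨ ℚₚ.∣p+q∣≤∣p∣+∣q∣ (seq x m - seq x M) (seq x M) ⟩
      ∣ seq x m - seq x M ∣ + ∣ seq x M ∣
        ≤⟨ ℚₚ.+-monoˡ-≤ ∣ seq x M ∣ (ℚₚ.<⇒≤ (c m M M≤m ℕₚ.≤-refl)) ⟩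
      1ℚ + ∣ seq x M ∣ ∎

  mul-close : ∀ {A B δ a b a′ b′} → 0ℚ < A → 0ℚ < B →
              ∣ a ∣ ≤ A → ∣ b′ ∣ ≤ B → ∣ a - a′ ∣ < δ → ∣ b - b′ ∣ < δ →
              ∣ a * b - a′ * b′ ∣ < (A + B) * δ
  mul-close {A} {B} {δ} {a} {b} {a′} {b′} 0<A 0<B a≤A b′≤B da db = begin-strict
    ∣ a * b - a′ * b′ ∣
      ≡⟨ cong ∣_∣ (Ring.product-diff a b a′ b′) ⟩
    ∣ a * (b - b′) + b′ * (a - a′) ∣
      ≤⟨ ℚₚ.∣p+q∣≤∣p∣+∣q∣ (a * (b - b′)) (b′ * (a - a′)) ⟩
    ∣ a * (b - b′) ∣ + ∣ b′ * (a - a′) ∣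
      ≡⟨ cong₂ _+_ (ℚₚ.∣p*q∣≡∣p∣*∣q∣ a (b - b′)) (ℚₚ.∣p*q∣≡∣p∣*∣q∣ b′ (a - a′)) ⟩
    ∣ a ∣ * ∣ b - b′ ∣ + ∣ b′ ∣ * ∣ a - a′ ∣
      ≤⟨ ℚₚ.+-mono-≤
           (ℚₚ.*-monoʳ-≤-nonNeg ∣ b - b′ ∣ {{ℚₚ.∣-∣-nonNeg (b - b′)}} a≤A)
           (ℚₚ.*-monoʳ-≤-nonNeg ∣ a - a′ ∣ {{ℚₚ.∣-∣-nonNeg (a - a′)}} b′≤B) ⟩
    A * ∣ b - b′ ∣ + B * ∣ a - a′ ∣
      <⟨ ℚₚ.+-mono-<
           (ℚₚ.*-monoʳ-<-pos A {{ℚ.positive 0<A}} db)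
           (ℚₚ.*-monoʳ-<-pos B {{ℚ.positive 0<B}} da) ⟩
    A * δ + B * δ
      ≡⟨ sym (ℚₚ.*-distribʳ-+ δ A B) ⟩
    (A + B) * δ ∎
    where open ℚₚ.≤-Reasoning

  quotient : ∀ {C ε} → 0ℚ < C → 0ℚ < ε → ∃ λ δ → 0ℚ < δ × C * δ ≡ ε
  quotient {C} {ε} 0<C 0<ε = C⁻¹ * ε , pos* (pos-1/ 0<C) 0<ε ,
    trans (sym (ℚₚ.*-assoc C C⁻¹ ε))
      (trans (cong (_* ε) (ℚₚ.*-inverseʳ C {{ℚ.>-nonZero 0<C}})) (ℚₚ.*-identityˡ ε))
    where C⁻¹ = (1/ C) {{ℚ.>-nonZero 0<C}}

  mul-cauchy : (x y : ℝ) → ∀ ε → 0ℚ < ε → ∃ λ M → ∀ m n → M ℕ.≤ m → M ℕ.≤ n →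
               ∣ seq x m * seq y m - seq x n * seq y n ∣ < ε
  mul-cauchy x y ε 0<ε =
    let A , 0<A , Ma , ba = bounded x
        B , 0<B , Mb , bb = bounded y
        δ , 0<δ , eq      = quotient (ℚₚ.+-mono-< 0<A 0<B) 0<ε
        Mx , cx           = cauchy x δ 0<δ
        My , cy           = cauchy y δ 0<δ
        P = Ma ℕ.⊔ Mb
        Q = Mx ℕ.⊔ My
    in P ℕ.⊔ Q , λ m n M≤m M≤n →
      let P≤m = ℕₚ.m⊔n≤o⇒m≤o P Q M≤m
          P≤n = ℕₚ.m⊔n≤o⇒m≤o P Q M≤n
          Q≤m = ℕₚ.m⊔n≤o⇒n≤o P Q M≤m
          Q≤n = ℕₚ.m⊔n≤o⇒n≤o P Q M≤n
      in subst (∣ seq x m * seq y m - seq x n * seq y n ∣ <_) eq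
           (mul-close 0<A 0<B
             (ba m (ℕₚ.m⊔n≤o⇒m≤o Ma Mb P≤m))
             (bb n (ℕₚ.m⊔n≤o⇒n≤o Ma Mb P≤n))
             (cx m n (ℕₚ.m⊔n≤o⇒m≤o Mx My Q≤m) (ℕₚ.m⊔n≤o⇒m≤o Mx My Q≤n))
             (cy m n (ℕₚ.m⊔n≤o⇒n≤o Mx My Q≤m) (ℕₚ.m⊔n≤o⇒n≤o Mx My Q≤n)))

infixl 7 _*ℝ_

_*ℝ_ : ℝ → ℝ → ℝ
(x *ℝ y) .seq m  = seq x m * seq y m
(x *ℝ y) .cauchy = mul-cauchy x y

infixr 8 _^ℝ_

_^ℝ_ : ℝ → ℕ → ℝ
x ^ℝ zero  = 1ℝ
x ^ℝ suc n = x *ℝ (x ^ℝ n)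

-- Reciprocal with the junk value 0 at 0. It is applied termwise to sequences
-- with positive limit, where only finitely many terms can be 0.
recip : ℚ → ℚ
recip q with q ≟ 0ℚ
... | yes _  = 0ℚ
... | no q≢0 = (1/ q) {{ℚ.≢-nonZero q≢0}}

recip-inverse : ∀ {q} → 0ℚ < q → q * recip q ≡ 1ℚ
recip-inverse {q} 0<q with q ≟ 0ℚ
... | yes q≡0 = contradiction (sym q≡0) (ℚₚ.<⇒≢ 0<q)
... | no q≢0  = ℚₚ.*-inverseʳ q {{ℚ.≢-nonZero q≢0}}

recip-pos : ∀ {q} → 0ℚ < q → 0ℚ < recip q
recip-pos {q} 0<q with q ≟ 0ℚ
... | yes q≡0 = contradiction (sym q≡0) (ℚₚ.<⇒≢ 0<q)
... | no q≢0  = ℚₚ.positive⁻¹ _ {{ℚₚ.1/pos⇒pos q {{ℚ.positive 0<q}}}}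

recip-anti : ∀ {p q} → 0ℚ < p → p ≤ q → recip q ≤ recip p
recip-anti {p} {q} 0<p p≤q = begin
  recip q
    ≡⟨ sym (ℚₚ.*-identityˡ (recip q)) ⟩
  1ℚ * recip q
    ≡⟨ cong (_* recip q) (sym (recip-inverse 0<p)) ⟩
  p * recip p * recip q
    ≤⟨ ℚₚ.*-monoʳ-≤-nonNeg (recip q) {{ℚ.nonNegative (ℚₚ.<⇒≤ (recip-pos 0<q))}}
         (ℚₚ.*-monoʳ-≤-nonNeg (recip p) {{ℚ.nonNegative (ℚₚ.<⇒≤ (recip-pos 0<p))}} p≤q) ⟩
  q * recip p * recip q
    ≡⟨ Ring.swapʳ q (recip p) (recip q) ⟩
  q * recip q * recip p
    ≡⟨ cong (_* recip p) (recip-inverse 0<q) ⟩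
  1ℚ * recip p
    ≡⟨ ℚₚ.*-identityˡ (recip p) ⟩
  recip p ∎
  where
  open ℚₚ.≤-Reasoning
  0<q : 0ℚ < q
  0<q = ℚₚ.<-≤-trans 0<p p≤q

private
  recip-close : ∀ {η ε a b} → 0ℚ < η → η ≤ a → η ≤ b →
                ∣ b - a ∣ < ε * (η * η) → ∣ recip a - recip b ∣ < ε
  recip-close {η} {ε} {a} {b} 0<η η≤a η≤b d = begin-strict
    ∣ u - v ∣
      ≡⟨ cong ∣_∣ (cong₂ _-_ (sym (ℚₚ.*-identityˡ u)) (sym (ℚₚ.*-identityˡ v))) ⟩
    ∣ 1ℚ * u - 1ℚ * v ∣
      ≡⟨ cong ∣_∣ (cong₂ (λ s t → s * u - t * v)
           (sym (recip-inverse 0<b)) (sym (recip-inverse 0<a))) ⟩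
    ∣ b * v * u - a * u * v ∣
      ≡⟨ cong ∣_∣ (Ring.recip-diff a b u v) ⟩
    ∣ (u * v) * (b - a) ∣
      ≡⟨ ℚₚ.∣p*q∣≡∣p∣*∣q∣ (u * v) (b - a) ⟩
    ∣ u * v ∣ * ∣ b - a ∣
      ≡⟨ cong (_* ∣ b - a ∣) (ℚₚ.0≤p⇒∣p∣≡p (ℚₚ.<⇒≤ (pos* 0<u 0<v))) ⟩
    (u * v) * ∣ b - a ∣
      ≤⟨ ℚₚ.*-monoʳ-≤-nonNeg ∣ b - a ∣ {{ℚₚ.∣-∣-nonNeg (b - a)}}
           (*-mono-≤ (ℚₚ.<⇒≤ 0<u) (ℚₚ.<⇒≤ 0<r) (recip-anti 0<η η≤a) (recip-anti 0<η η≤b)) ⟩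
    (r * r) * ∣ b - a ∣
      <⟨ ℚₚ.*-monoʳ-<-pos (r * r) {{ℚ.positive (pos* 0<r 0<r)}} d ⟩
    (r * r) * (ε * (η * η))
      ≡⟨ Ring.regroup r ε η ⟩
    (η * r) * ((η * r) * ε)
      ≡⟨ cong (λ z → z * (z * ε)) (recip-inverse 0<η) ⟩
    1ℚ * (1ℚ * ε)
      ≡⟨ trans (ℚₚ.*-identityˡ _) (ℚₚ.*-identityˡ ε) ⟩
    ε ∎
    where
    open ℚₚ.≤-Reasoning
    u = recip a
    v = recip b
    r = recip η
    0<a = ℚₚ.<-≤-trans 0<η η≤a
    0<b = ℚₚ.<-≤-trans 0<η η≤b
    0<u = recip-pos 0<a
    0<v = recip-pos 0<b
    0<r = recip-pos 0<η

  inverse-cauchy : (x : ℝ) → 0ℝ <ℝ x → ∀ ε → 0ℚ < ε →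
    ∃ λ M → ∀ m n → M ℕ.≤ m → M ℕ.≤ n → ∣ recip (seq x m) - recip (seq x n) ∣ < ε
  inverse-cauchy x (η , 0<η , K , lb) ε 0<ε =
    let M , c = cauchy x (ε * (η * η)) (pos* 0<ε (pos* 0<η 0<η))
    in K ℕ.⊔ M , λ m n h g → recip-close 0<η
      (subst (_≤ seq x m) (ℚₚ.+-identityˡ η) (lb m (ℕₚ.m⊔n≤o⇒m≤o K M h)))
      (subst (_≤ seq x n) (ℚₚ.+-identityˡ η) (lb n (ℕₚ.m⊔n≤o⇒m≤o K M g)))
      (c n m (ℕₚ.m⊔n≤o⇒n≤o K M g) (ℕₚ.m⊔n≤o⇒n≤o K M h))

inverse : (x : ℝ) → 0ℝ <ℝ x → ℝ
inverse x _   .seq m  = recip (seq x m)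
inverse x 0<x .cauchy = inverse-cauchy x 0<x

infixl 7 _÷ℝ_[_]

_÷ℝ_[_] : (x y : ℝ) → 0ℝ <ℝ y → ℝ
x ÷ℝ y [ y>0 ] = x *ℝ inverse y y>0

1ℝ-pos : 0ℝ <ℝ 1ℝ
1ℝ-pos = 1ℚ , 0<1 , 0 , λ _ _ → ℚₚ.≤-refl

*ℝ-pos : ∀ x y → 0ℝ <ℝ x → 0ℝ <ℝ y → 0ℝ <ℝ x *ℝ y
*ℝ-pos x y (δ , 0<δ , M , f) (ε , 0<ε , K , g) =
  δ * ε , pos* 0<δ 0<ε , M ℕ.⊔ K , λ m h →
    let δ≤ = subst (_≤ seq x m) (ℚₚ.+-identityˡ δ) (f m (ℕₚ.m⊔n≤o⇒m≤o M K h))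
        ε≤ = subst (_≤ seq y m) (ℚₚ.+-identityˡ ε) (g m (ℕₚ.m⊔n≤o⇒n≤o M K h))
    in subst (_≤ seq x m * seq y m) (sym (ℚₚ.+-identityˡ (δ * ε)))
         (*-mono-≤ (ℚₚ.<⇒≤ 0<δ) (ℚₚ.≤-trans (ℚₚ.<⇒≤ 0<ε) ε≤) δ≤ ε≤)

^ℝ-pos : ∀ x n → 0ℝ <ℝ x → 0ℝ <ℝ x ^ℝ n
^ℝ-pos x zero    _ = 1ℝ-pos
^ℝ-pos x (suc n) p = *ℝ-pos x (x ^ℝ n) p (^ℝ-pos x n p)

-- recipSum a l = 1/(a+1) + 1/(a+2) + ⋯ + 1/(a+l)
recipSum : ℕ → ℕ → ℚ
recipSum a zero    = 0ℚ
recipSum a (suc l) = + 1 / suc a + recipSum (suc a) l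

-- The right-endpoint Riemann sum of ∫₁ⁿ dt/t on intervals of length 1/m, where
-- m = i + 1: the sum of (1/m) · 1/(1 + r/m) = 1/(m + r) over 1 ≤ r ≤ (n-1)m.
logSum : ℕ → ℕ → ℚ
logSum n i = recipSum (suc i) ((n ℕ.∸ 1) ℕ.* suc i)

/-≤ : ∀ a b c d → a ℕ.* suc d ℕ.≤ c ℕ.* suc b → + a / suc b ≤ + c / suc d
/-≤ a b c d h = ℚₚ.toℚᵘ-cancel-≤ (ℚᵘₚ.≤-respʳ-≃ (ℚᵘₚ.≃-sym (ℚₚ.toℚᵘ-fromℚᵘ (ℚᵘ.mkℚᵘ (+ c) d)))
  (ℚᵘₚ.≤-respˡ-≃ (ℚᵘₚ.≃-sym (ℚₚ.toℚᵘ-fromℚᵘ (ℚᵘ.mkℚᵘ (+ a) b)))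
    (ℚᵘ.*≤* (subst (λ z → z ℤ.≤ + c ℤ.* + suc b) (ℤₚ.pos-* a (suc d))
      (subst (λ z → + (a ℕ.* suc d) ℤ.≤ z) (ℤₚ.pos-* c (suc b)) (ℤ.+≤+ h))))))

/-suc : ∀ l b → + suc l / suc b ≡ + 1 / suc b + + l / suc b
/-suc l b = ℚₚ.toℚᵘ-injective (begin
  ℚ.toℚᵘ (+ suc l / suc b)
    ≈⟨ ℚₚ.toℚᵘ-fromℚᵘ (ℚᵘ.mkℚᵘ (+ suc l) b) ⟩
  ℚᵘ.mkℚᵘ (+ suc l) b
    ≈⟨ ℚᵘ.*≡* (cong +_ (solve 2
         (λ l b → (con 1 :+ l) :* ((con 1 :+ b) :* (con 1 :+ b))
               := (con 1 :* (con 1 :+ b) :+ l :* (con 1 :+ b)) :* (con 1 :+ b)) refl l b) ⟨≡⟩ fix) ⟩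
  ℚᵘ.mkℚᵘ (+ 1) b ℚᵘ.+ ℚᵘ.mkℚᵘ (+ l) b
    ≈⟨ ℚᵘₚ.≃-sym (ℚᵘₚ.+-cong (ℚₚ.toℚᵘ-fromℚᵘ (ℚᵘ.mkℚᵘ (+ 1) b)) (ℚₚ.toℚᵘ-fromℚᵘ (ℚᵘ.mkℚᵘ (+ l) b))) ⟩
  ℚ.toℚᵘ (+ 1 / suc b) ℚᵘ.+ ℚ.toℚᵘ (+ l / suc b)
    ≈⟨ ℚᵘₚ.≃-sym (ℚₚ.toℚᵘ-homo-+ (+ 1 / suc b) (+ l / suc b)) ⟩
  ℚ.toℚᵘ (+ 1 / suc b + + l / suc b) ∎)
  where
  open ℚᵘₚ.≃-Reasoning
  open ℕ-Solver using (solve; _:=_; _:+_; _:*_; con)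
  infixl 1 _⟨≡⟩_
  _⟨≡⟩_ : ∀ {x y z : ℤ} → x ≡ y → y ≡ z → x ≡ z
  _⟨≡⟩_ = trans
  fix : + ((1 ℕ.* suc b ℕ.+ l ℕ.* suc b) ℕ.* suc b)
      ≡ (+ 1 ℤ.* + suc b ℤ.+ + l ℤ.* + suc b) ℤ.* + suc b
  fix = trans (ℤₚ.pos-* (1 ℕ.* suc b ℕ.+ l ℕ.* suc b) (suc b))
    (cong (ℤ._* + suc b) (trans (ℤₚ.pos-+ (1 ℕ.* suc b) (l ℕ.* suc b))
      (cong₂ ℤ._+_ (ℤₚ.pos-* 1 (suc b)) (ℤₚ.pos-* l (suc b)))))

recipSum-++ : ∀ a k l → recipSum a (k ℕ.+ l) ≡ recipSum a k + recipSum (a ℕ.+ k) l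
recipSum-++ a zero l = trans (cong (λ z → recipSum z l) (sym (ℕₚ.+-identityʳ a)))
                             (sym (ℚₚ.+-identityˡ _))
recipSum-++ a (suc k) l = trans
  (cong (_+_ (+ 1 / suc a)) (trans (recipSum-++ (suc a) k l)
    (cong (λ z → recipSum (suc a) k + recipSum z l) (sym (ℕₚ.+-suc a k)))))
  (sym (ℚₚ.+-assoc (+ 1 / suc a) (recipSum (suc a) k) _))

0/ : ∀ b → + 0 / suc b ≡ 0ℚ
0/ b = ℚₚ.≤-antisym (/-≤ 0 b 0 0 ℕ.z≤n) (/-≤ 0 0 0 b ℕ.z≤n)

recipSum-lower : ∀ a l b → a ℕ.+ l ℕ.≤ suc b → + l / suc b ≤ recipSum a l
recipSum-lower a zero    b _ = ℚₚ.≤-reflexive (0/ b)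
recipSum-lower a (suc l) b h = subst (_≤ recipSum a (suc l)) (sym (/-suc l b))
  (ℚₚ.+-mono-≤
    (/-≤ 1 b 1 a (ℕₚ.*-monoʳ-≤ 1 (ℕₚ.≤-trans (ℕ.s≤s (ℕₚ.m≤m+n a l)) h′)))
    (recipSum-lower (suc a) l b h′))
  where h′ = subst (ℕ._≤ suc b) (ℕₚ.+-suc a l) h

recipSum-upper : ∀ a l b → b ℕ.≤ a → recipSum a l ≤ + l / suc b
recipSum-upper a zero    b _ = ℚₚ.≤-reflexive (sym (0/ b))
recipSum-upper a (suc l) b h = subst (recipSum a (suc l) ≤_) (sym (/-suc l b))
  (ℚₚ.+-mono-≤ (/-≤ 1 a 1 b (ℕₚ.*-monoʳ-≤ 1 (ℕ.s≤s h)))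
               (recipSum-upper (suc a) l b (ℕₚ.m≤n⇒m≤1+n h)))

recipSum-nonNeg : ∀ a l → 0ℚ ≤ recipSum a l
recipSum-nonNeg a l = subst (_≤ recipSum a l) (0/ (a ℕ.+ l))
  (ℚₚ.≤-trans (/-≤ 0 (a ℕ.+ l) l (a ℕ.+ l) ℕ.z≤n)
    (recipSum-lower a l (a ℕ.+ l) (ℕₚ.n≤1+n _)))

module Step (n i : ℕ) where
  m = suc i
  tail = recipSum (m ℕ.+ n ℕ.* m) (suc n)

  step : + 1 / suc m + logSum (suc n) (suc i) ≡ logSum (suc n) i + tail
  step = trans (cong (recipSum m) (solve 2
                 (λ n m → con 1 :+ n :* (con 1 :+ m) := n :* m :+ (con 1 :+ n)) refl n m))
               (recipSum-++ m (n ℕ.* m) (suc n))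
    where open ℕ-Solver using (solve; _:=_; _:+_; _:*_; con)

  tail-lower : + 1 / suc m ≤ tail
  tail-lower = ℚₚ.≤-trans
    (/-≤ 1 m (suc n) (m ℕ.+ n ℕ.* suc m)
      (ℕₚ.≤-reflexive (solve 2 (λ n m → con 1 :* (con 1 :+ (m :+ n :* (con 1 :+ m)))
                                := (con 1 :+ n) :* (con 1 :+ m)) refl n m)))
    (recipSum-lower (m ℕ.+ n ℕ.* m) (suc n) (m ℕ.+ n ℕ.* suc m)
      (ℕₚ.≤-reflexive (solve 2 (λ n m → m :+ n :* m :+ (con 1 :+ n)
                                := con 1 :+ (m :+ n :* (con 1 :+ m))) refl n m)))
    where open ℕ-Solver using (solve; _:=_; _:+_; _:*_; con)

  tail-upper : tail ≤ + 1 / m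
  tail-upper = ℚₚ.≤-trans
    (recipSum-upper (m ℕ.+ n ℕ.* m) (suc n) (i ℕ.+ n ℕ.* m) (ℕₚ.+-monoˡ-≤ (n ℕ.* m) (ℕₚ.n≤1+n i)))
    (/-≤ (suc n) (i ℕ.+ n ℕ.* m) 1 i (ℕₚ.≤-reflexive (sym (ℕₚ.*-identityˡ (suc n ℕ.* m)))))

  increasing : logSum (suc n) i ≤ logSum (suc n) (suc i)
  increasing = subst (logSum (suc n) i ≤_) eq
      (subst (_≤ logSum (suc n) i + tail - + 1 / suc m)
        (Ring.cancelʳ (logSum (suc n) i) (+ 1 / suc m))
        (ℚₚ.+-monoˡ-≤ (- (+ 1 / suc m)) (ℚₚ.+-monoʳ-≤ (logSum (suc n) i) tail-lower)))
    where
    eq : logSum (suc n) i + tail - + 1 / suc m ≡ logSum (suc n) (suc i)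
    eq = trans (cong (_- + 1 / suc m) (sym step))
      (Ring.cancelˡ (logSum (suc n) (suc i)) (+ 1 / suc m))

  decreasing : + 1 / suc m + logSum (suc n) (suc i) ≤ + 1 / m + logSum (suc n) i
  decreasing = subst (_≤ + 1 / m + logSum (suc n) i) (sym step)
    (subst (logSum (suc n) i + tail ≤_) (ℚₚ.+-comm (logSum (suc n) i) (+ 1 / m))
      (ℚₚ.+-monoʳ-≤ (logSum (suc n) i) tail-upper))

logSum-mono : ∀ n {i j} → i ℕ.≤′ j → logSum (suc n) i ≤ logSum (suc n) j
logSum-mono n ℕ.≤′-refl     = ℚₚ.≤-refl
logSum-mono n (ℕ.≤′-step p) = ℚₚ.≤-trans (logSum-mono n p) (Step.increasing n _)

logSum-anti : ∀ n {i j} → i ℕ.≤′ j →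
  + 1 / suc j + logSum (suc n) j ≤ + 1 / suc i + logSum (suc n) i
logSum-anti n ℕ.≤′-refl         = ℚₚ.≤-refl
logSum-anti n (ℕ.≤′-step {j} p) = ℚₚ.≤-trans (Step.decreasing n j) (logSum-anti n p)

logSum-bound : ∀ n {i j} → i ℕ.≤ j → logSum (suc n) j ≤ + 1 / suc i + logSum (suc n) i
logSum-bound n {i} {j} i≤j = ℚₚ.≤-trans
  (subst (_≤ + 1 / suc j + logSum (suc n) j) (ℚₚ.+-identityˡ _)
    (ℚₚ.+-monoˡ-≤ (logSum (suc n) j) (/-≤ 0 0 1 j ℕ.z≤n)))
  (logSum-anti n {i} {j} (ℕₚ.≤⇒≤′ i≤j))

sub-bound : ∀ {p q a b} → p ≤ b + a → a ≤ q → p - q ≤ b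
sub-bound {p} {q} {a} {b} h g = subst (p - q ≤_) (Ring.cancelʳ b a)
  (ℚₚ.+-mono-≤ h (ℚₚ.neg-antimono-≤ g))

∣-∣-bound : ∀ {p q a b} → a ≤ p → p ≤ b + a → a ≤ q → q ≤ b + a → ∣ p - q ∣ ≤ b
∣-∣-bound {p} {q} {a} {b} a≤p p≤ a≤q q≤ with ℚₚ.∣p∣≡p∨∣p∣≡-p (p - q)
... | inj₁ eq = subst (_≤ b) (sym eq) (sub-bound p≤ a≤q)
... | inj₂ eq = subst (_≤ b) (sym (trans eq (Ring.neg-sub p q))) (sub-bound q≤ a≤p)

archimedean : ∀ ε → 0ℚ < ε → ∃ λ M → + 1 / suc M < ε
archimedean (mkℚ (+ zero) d _)  (*<* (ℤ.+<+ ()))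
archimedean (mkℚ -[1+ _ ] d _)  (*<* ())
archimedean ε@(mkℚ +[1+ a ] d _) _ = suc d ,
  ℚₚ.toℚᵘ-cancel-< (ℚᵘₚ.<-respˡ-≃ (ℚᵘₚ.≃-sym (ℚₚ.toℚᵘ-fromℚᵘ (ℚᵘ.mkℚᵘ (+ 1) (suc d))))
    (ℚᵘ.*<* (ℤ.+<+ (ℕ.s≤s (ℕₚ.≤-trans
      (ℕₚ.≤-reflexive (cong suc (ℕₚ.+-identityʳ d))) (ℕₚ.m≤m+n (suc d) _))))))

-- The natural logarithm ∫₁ⁿ dt/t; the value at n = 0 is the junk value 0.
log : ℕ → ℝ
log n .seq = logSum n
log zero .cauchy ε 0<ε = 0 , λ _ _ _ _ → 0<ε
log (suc n) .cauchy ε 0<ε with archimedean ε 0<ε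
... | M , 1/M<ε = M , λ p q M≤p M≤q → ℚₚ.≤-<-trans
  (∣-∣-bound (logSum-mono n (ℕₚ.≤⇒≤′ M≤p)) (logSum-bound n M≤p)
             (logSum-mono n (ℕₚ.≤⇒≤′ M≤q)) (logSum-bound n M≤q)) 1/M<ε

log-pos : ∀ {n} → 2 ℕ.≤ n → 0ℝ <ℝ log n
log-pos {suc zero} (ℕ.s≤s ())
log-pos {suc (suc n)} _ = ½ , *<* (ℤ.+<+ (ℕ.s≤s ℕ.z≤n)) , 0 , λ m _ → begin
  0ℚ + ½                       ≡⟨ ℚₚ.+-comm 0ℚ ½ ⟩
  ½ + 0ℚ                       ≤⟨ ℚₚ.+-monoʳ-≤ ½ (recipSum-nonNeg 2 (n ℕ.* 1)) ⟩
  ½ + recipSum 2 (n ℕ.* 1)     ≡⟨⟩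
  logSum (suc (suc n)) 0       ≤⟨ logSum-mono (suc n) {0} {m} (ℕₚ.≤⇒≤′ ℕ.z≤n) ⟩
  logSum (suc (suc n)) m       ∎
  where open ℚₚ.≤-Reasoning

fromℕ-pos : ∀ {n} → 1 ℕ.≤ n → 0ℝ <ℝ fromℕ n
fromℕ-pos {n} 1≤n = 1ℚ , 0<1 , 0 , λ _ _ → subst (_≤ + n / 1) (sym (ℚₚ.+-identityˡ 1ℚ))
  (/-≤ 1 0 n 0 (ℕₚ.*-monoˡ-≤ 1 1≤n))

{-# OPTIONS --safe #-}

-- Let L be the integer part of log₂ n. The induction on k counts k-cliques through vertex neighbourhoods.
-- If half of the vertices have degree at least N L / (κ n), the bound for k - 1 inside their
-- neighbourhoods suffices. Otherwise restrict to the vertices of degree at most Δ = N L / (κ n).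
-- A random independent set from the hard-core model with fugacity 1/t contains a vertex v or some of
-- its neighbours with a weighted frequency of order L, provided that few edges lie inside the
-- neighbourhood of v; averaging over v, the independent set would have more than n elements. Hence for
-- many v the neighbourhood spans at least Δ² n^(-ε) edges, and the bound for k - 2 inside the common
-- neighbourhoods of such edges even leaves a power of n to spare.
module Submission where

open import Defs
open import Data.Nat.Base
open import Data.Nat.Properties
open import Data.Nat.Combinatorics using (_C_; nCk+nC[k+1]≡[n+1]C[k+1]; nC1≡n)
open import Data.Nat.DivMod using (_/_; m≡m%n+[m/n]*n; m%n<n; m/n*n≤m; m*n/n≡m; /-monoˡ-≤)
open import Data.Nat.Tactic.RingSolver using (solve-∀)
open import Data.Bool.Base using (Bool; true; false; _∧_; _∨_; not)
import Data.Bool.Properties as Bool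
open import Data.Bool.Properties using (∧-identityʳ; ∧-zeroʳ)
open import Data.Fin.Base using (Fin; zero; suc)
import Data.Fin.Properties as Fin
open import Data.Fin.Subset as Sub using (Subset; inside; outside; ∣_∣) renaming (_∈_ to _∈ₛ_)
open import Data.Fin.Subset.Properties using (_∈?_; ∣⊥∣≡0; ∉⊥)
import Data.Integer.Base as ℤ
open import Data.List.Base using (List; []; _∷_; allFin; _++_; length; filter; map)
open import Data.List.Membership.Propositional using (_∈_)
open import Data.List.Membership.Propositional.Properties using (∈-allFin)
open import Data.List.Properties using (length-++; filter-++)
open import Data.List.Relation.Unary.Any using (here; there)
open import Data.Product.Base using (∃; ∃₂; _×_; _,_; proj₁; proj₂)
open import Data.Rational.Base as ℚ using (ℚ; 0ℚ; 1ℚ; *<*)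
import Data.Rational.Properties as ℚ
open import Data.Rational.Solver using () renaming (module +-*-Solver to ℚ-Solver)
open import Data.Sum.Base using (_⊎_; inj₁; inj₂)
open import Data.Vec.Base using ([]; _∷_; lookup; _[_]≔_)
open import Data.Vec.Properties using (lookup∘update′; []=⇒lookup; lookup⇒[]=)
open import Function.Base using (_∘_)
open import Relation.Binary.PropositionalEquality
open import Relation.Nullary using (¬_; Dec; yes; no; does; contradiction)
open import Relation.Nullary.Decidable using (_×-dec_; _→-dec_)
open import Relation.Unary using (Decidable)
open import Algebra.Properties.Semiring.Sum +-*-semiring
  using (sum; sum-cong-≗; ∑-distrib-+; ∑-comm; *-distribˡ-sum)

-- The Turán bound yields only degrees of order `N / n`, a factor `L` short of what the recursion
-- needs. This loss is affordable once, at `k = 2`, and is the origin of the factor `1 / log n` in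
-- the conclusion. For larger `k` the missing factor comes from conditioning the random independent
-- set on its part outside the closed neighbourhood of `v`. Let `X` be the neighbours of `v` still
-- available. If `X` is large, its sparsity forces a mean of at least `2 b` chosen points into it,
-- where `b` is a small fraction of `L`. If `X` is small, its partition function is at most
-- `2 ^ (8 * b)` times that of the empty set, so `v` itself is chosen with probability at least
-- `1 / (t * 2 ^ (8 * b) + 1)`, and a weight `a` equal to `b` times the inverse of this number
-- compensates. In the average a vertex is charged `a` for itself and at most `Δ` through its
-- neighbours, so `a` must stay below `Δ`. This dictates a `t` near `Δ / r` with `r` a small power
-- of `n`, and is why `r` is lost in the dense case. Probabilities appear as inequalities between
-- integers, multiplied by `t * Z`.

Mask : ℕ → Set
Mask N = Fin N → Bool

-- Sums guarded by Boolean masks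

infixr 6 _▹_
_▹_ : Bool → ℕ → ℕ
true  ▹ x = x
false ▹ x = 0

infix 7 _==_
_==_ : ∀ {N} → Fin N → Fin N → Bool
u == v = does (u Fin.≟ v)

==-refl : ∀ {N} (u : Fin N) → u == u ≡ true
==-refl u with u Fin.≟ u
... | yes _ = refl
... | no u≢u = contradiction refl u≢u

==⇒≡ : ∀ {N} {u v : Fin N} → u == v ≡ true → u ≡ v
==⇒≡ {u = u} {v} eq with u Fin.≟ v
... | yes p = p

==-sym : ∀ {N} (u v : Fin N) → u == v ≡ v == u
==-sym u v with u Fin.≟ v | v Fin.≟ u
... | yes _   | yes _   = refl
... | no _    | no _    = refl
... | yes u≡v | no v≢u  = contradiction (sym u≡v) v≢u
... | no u≢v  | yes v≡u = contradiction (sym v≡u) u≢v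

∧-true : ∀ {a b} → a ∧ b ≡ true → a ≡ true × b ≡ true
∧-true {true} {true} _ = refl , refl

∧-intro : ∀ {a b} → a ≡ true → b ≡ true → a ∧ b ≡ true
∧-intro refl refl = refl

not-true : ∀ {a} → not a ≡ true → a ≡ false
not-true {false} _ = refl

∧-swapʳ : ∀ a b c → (a ∧ b) ∧ c ≡ (a ∧ c) ∧ b
∧-swapʳ true  true  true  = refl
∧-swapʳ true  true  false = refl
∧-swapʳ true  false true  = refl
∧-swapʳ true  false false = refl
∧-swapʳ false b     c     = refl

▹-mono : ∀ a {x y} → x ≤ y → a ▹ x ≤ a ▹ y
▹-mono true  x≤y = x≤y
▹-mono false _   = z≤n

▹-≤ : ∀ a x → a ▹ x ≤ x
▹-≤ true  x = ≤-refl
▹-≤ false x = z≤n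

▹-* : ∀ c a x → c * (a ▹ x) ≡ a ▹ (c * x)
▹-* c true  x = refl
▹-* c false x = *-zeroʳ c

▹-+ : ∀ a x y → a ▹ (x + y) ≡ (a ▹ x) + (a ▹ y)
▹-+ true  x y = refl
▹-+ false x y = refl

sum-mono : ∀ {N} {f g : Fin N → ℕ} → (∀ u → f u ≤ g u) → sum f ≤ sum g
sum-mono {zero}  f≤g = z≤n
sum-mono {suc N} f≤g = +-mono-≤ (f≤g zero) (sum-mono (f≤g ∘ suc))

sum-zero : ∀ {N} {f : Fin N → ℕ} → (∀ u → f u ≡ 0) → sum f ≡ 0
sum-zero {zero}  f≡0 = refl
sum-zero {suc N} f≡0 = cong₂ _+_ (f≡0 zero) (sum-zero (f≡0 ∘ suc))

sum-remove-point : ∀ {N} (f : Fin N → ℕ) w → sum f ≡ f w + sum (λ u → not (w == u) ▹ f u)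
sum-remove-point f zero    = refl
sum-remove-point f (suc w) = trans
  (cong (f zero +_) (sum-remove-point (f ∘ suc) w))
  (shuffle (f zero) (f (suc w)) _)
  where
  shuffle : ∀ a b c → a + (b + c) ≡ b + (a + c)
  shuffle = solve-∀

Σ∈ : ∀ {N} → Mask N → (Fin N → ℕ) → ℕ
Σ∈ D g = sum (λ u → D u ▹ g u)

card : ∀ {N} → Mask N → ℕ
card D = Σ∈ D (λ _ → 1)

infix 4 _⊆_
_⊆_ : ∀ {N} → Mask N → Mask N → Set
P ⊆ Q = ∀ u → P u ≡ true → Q u ≡ true

infixl 8 _∩_
_∩_ : ∀ {N} → Mask N → Mask N → Mask N
(P ∩ Q) u = P u ∧ Q u

∩-⊆ˡ : ∀ {N} (P Q : Mask N) → P ∩ Q ⊆ P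
∩-⊆ˡ P Q u = proj₁ ∘ ∧-true

⊆-trans : ∀ {N} {P Q R : Mask N} → P ⊆ Q → Q ⊆ R → P ⊆ R
⊆-trans P⊆Q Q⊆R u = Q⊆R u ∘ P⊆Q u

▹-⊆ : ∀ {a b} x → (a ≡ true → b ≡ true) → a ▹ x ≤ b ▹ x
▹-⊆ {false} x h = z≤n
▹-⊆ {true}  x h rewrite h refl = ≤-refl

▹-cond-mono : ∀ a {x y} → (a ≡ true → x ≤ y) → a ▹ x ≤ a ▹ y
▹-cond-mono false h = z≤n
▹-cond-mono true  h = h refl

Σ∈-mono : ∀ {N} (D : Mask N) {f g : Fin N → ℕ} → (∀ u → D u ≡ true → f u ≤ g u) → Σ∈ D f ≤ Σ∈ D g
Σ∈-mono D f≤g = sum-mono λ u → ▹-cond-mono (D u) (f≤g u)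

Σ∈-cong : ∀ {N} {D E : Mask N} {f g : Fin N → ℕ} → (∀ u → D u ≡ E u) → (∀ u → f u ≡ g u) → Σ∈ D f ≡ Σ∈ E g
Σ∈-cong D≗E f≗g = sum-cong-≗ λ u → cong₂ _▹_ (D≗E u) (f≗g u)

Σ∈-⊆ : ∀ {N} {D E : Mask N} (f : Fin N → ℕ) → D ⊆ E → Σ∈ D f ≤ Σ∈ E f
Σ∈-⊆ f D⊆E = sum-mono λ u → ▹-⊆ (f u) (D⊆E u)

Σ∈-* : ∀ {N} c (D : Mask N) f → c * Σ∈ D f ≡ Σ∈ D (λ u → c * f u)
Σ∈-* c D f = trans (*-distribˡ-sum c (λ u → D u ▹ f u)) (sum-cong-≗ λ u → ▹-* c (D u) (f u))

Σ∈-+ : ∀ {N} (D : Mask N) f g → Σ∈ D (λ u → f u + g u) ≡ Σ∈ D f + Σ∈ D g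
Σ∈-+ D f g = trans (sum-cong-≗ λ u → ▹-+ (D u) (f u) (g u)) (∑-distrib-+ (λ u → D u ▹ f u) (λ u → D u ▹ g u))

Σ∈-const : ∀ {N} (D : Mask N) c → Σ∈ D (λ _ → c) ≡ c * card D
Σ∈-const D c = trans (Σ∈-cong {D = D} (λ _ → refl) (λ _ → sym (*-identityʳ c))) (sym (Σ∈-* c D (λ _ → 1)))

▹-sum : ∀ {N} a (f : Fin N → ℕ) → a ▹ sum f ≡ sum (λ u → a ▹ f u)
▹-sum true  f = refl
▹-sum {N} false f = sym (sum-zero {N} λ _ → refl)

card-⊆ : ∀ {N} {D E : Mask N} → D ⊆ E → card D ≤ card E
card-⊆ {D = D} = Σ∈-⊆ {D = D} (λ _ → 1)

infixl 8 _-_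
_-_ : ∀ {N} → Mask N → Fin N → Mask N
(P - v) u = P u ∧ not (v == u)

Σ∈-remove : ∀ {N} {D : Mask N} f w → D w ≡ true → Σ∈ D f ≡ f w + Σ∈ (D - w) f
Σ∈-remove {D = D} f w Dw = trans (sum-remove-point (λ u → D u ▹ f u) w)
  (cong₂ _+_ (cong (_▹ f w) Dw) (sum-cong-≗ λ u → lemma (D u) (not (w == u)) (f u)))
  where
  lemma : ∀ a b x → b ▹ a ▹ x ≡ (a ∧ b) ▹ x
  lemma true  true  x = refl
  lemma true  false x = refl
  lemma false true  x = refl
  lemma false false x = refl

-- The hard-core partition function

Adj : ℕ → Set
Adj N = Fin N → Fin N → Bool

module Nbhd {N} (adj : Adj N) where
  near : Adj N
  near v u = v == u ∨ adj v u

  infixl 8 _∖_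
  _∖_ : Mask N → Fin N → Mask N
  (P ∖ v) u = P u ∧ not (near v u)

-- The hard-core partition function Σ_W t^(N-|W|), over the independent sets W ⊆ P.
-- Vertices outside P contribute the factor t, so all masks are normalised alike.
Z : ℕ → ∀ {N} → Adj N → Mask N → ℕ
Z t {zero}  adj P = 1
Z t {suc N} adj P =
  t * Z t (λ u v → adj (suc u) (suc v)) (P ∘ suc)
  + (P zero ▹ Z t (λ u v → adj (suc u) (suc v)) (λ u → P (suc u) ∧ not (adj zero (suc u))))

Z-mono : ∀ t {N} (adj : Adj N) {P Q} → P ⊆ Q → Z t adj P ≤ Z t adj Q
Z-mono t {zero}  adj P⊆Q = ≤-refl
Z-mono t {suc N} adj {P} {Q} P⊆Q = +-mono-≤ (*-monoʳ-≤ t (Z-mono t _ (λ u → P⊆Q (suc u))))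
  (≤-trans (▹-mono (P zero) (Z-mono t _ λ u h → let p , q = ∧-true h in ∧-intro (P⊆Q (suc u) p) q))
           (▹-⊆ {P zero} _ (P⊆Q zero)))

Z-cong : ∀ t {N} (adj : Adj N) {P Q} → (∀ u → P u ≡ Q u) → Z t adj P ≡ Z t adj Q
Z-cong t adj P≗Q = ≤-antisym (Z-mono t adj λ u p → trans (sym (P≗Q u)) p) (Z-mono t adj λ u p → trans (P≗Q u) p)

-- `Z` branches on the vertices in a fixed order. Branching on an arbitrary `v` first gives the same
-- value because branches on distinct vertices commute. The factor `t` replaces a division: a chosen
-- vertex costs one power of `t`.
Z-delete : ∀ t {N} (adj : Adj N) → (∀ u v → adj u v ≡ adj v u) → ∀ P v → P v ≡ true →
  t * Z t adj P ≡ t * Z t adj (P - v) + Z t adj (Nbhd._∖_ adj P v)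
Z-delete t {suc N} adj adj-sym P zero Pv rewrite Pv =
  trans (shuffle t _ _) (cong (λ z → t * (t * z + 0) + (t * Z₂ + 0))
    (Z-cong t _ (λ u → sym (∧-identityʳ (P (suc u))))))
  where
  Z₂ = Z t (λ u v → adj (suc u) (suc v)) (λ u → P (suc u) ∧ not (adj zero (suc u)))
  shuffle : ∀ t a b → t * (t * a + b) ≡ t * (t * a + 0) + (t * b + 0)
  shuffle = solve-∀
Z-delete t {suc N} adj adj-sym P (suc w) Pv =
  step (P zero) _ _ _ _ _ _ IH₁ snd
  where
  adj′ = λ u v → adj (suc u) (suc v)
  adj′-sym = λ u v → adj-sym (suc u) (suc v)
  P′ = P ∘ suc
  P″ : Mask N
  P″ u = P (suc u) ∧ not (adj zero (suc u))
  open Nbhd adj′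
  IH₁ = Z-delete t adj′ adj′-sym P′ w Pv
  snd : t * Z t adj′ P″ ≡ t * Z t adj′ (λ u → (P′ - w) u ∧ not (adj zero (suc u)))
                        + (not (adj (suc w) zero) ▹ Z t adj′ (λ u → (P′ ∖ w) u ∧ not (adj zero (suc u))))
  snd with adj (suc w) zero in eq
  -- If `w` is adjacent to `zero`, choosing `zero` has already excluded `w`: its deletion changes
  -- nothing and the branch choosing both vanishes.
  ... | true = trans (cong (t *_) (Z-cong t adj′ same)) (sym (+-identityʳ _))
    where
    same : ∀ u → P″ u ≡ (P′ - w) u ∧ not (adj zero (suc u))
    same u with w Fin.≟ u
    ... | no _  = cong (_∧ _) (sym (∧-identityʳ (P′ u)))
    ... | yes refl rewrite trans (adj-sym zero (suc w)) eq = trans (∧-zeroʳ (P′ w)) (sym (∧-zeroʳ _))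
  ... | false = trans (Z-delete t adj′ adj′-sym P″ w
      (∧-intro Pv (cong not (trans (adj-sym zero (suc w)) eq))))
      (cong₂ (λ x y → t * x + y) (Z-cong t adj′ λ u → ∧-swapʳ (P′ u) _ _) (Z-cong t adj′ λ u → ∧-swapʳ (P′ u) _ _))
  step : ∀ p {q} a a₁ a₂ b b₁ b₂ → t * a ≡ t * a₁ + a₂ → t * b ≡ t * b₁ + (q ▹ b₂) →
    t * (t * a + (p ▹ b)) ≡ t * (t * a₁ + ((p ∧ true) ▹ b₁)) + (t * a₂ + ((p ∧ q) ▹ b₂))
  step false a a₁ a₂ b b₁ b₂ e f rewrite e = lem t a₁ a₂
    where
    lem : ∀ t a₁ a₂ → t * (t * a₁ + a₂ + 0) ≡ t * (t * a₁ + 0) + (t * a₂ + 0)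
    lem = solve-∀
  step true {q} a a₁ a₂ b b₁ b₂ e f rewrite e | *-distribˡ-+ t (t * a₁ + a₂) b | f = lem t a₁ a₂ b₁ (q ▹ b₂)
    where
    lem : ∀ t a₁ a₂ b₁ x → t * (t * a₁ + a₂) + (t * b₁ + x) ≡ t * (t * a₁ + b₁) + (t * a₂ + x)
    lem = solve-∀

Z-empty : ∀ t {N} (adj : Adj N) {P} → (∀ u → P u ≡ false) → Z t adj P ≡ t ^ N
Z-empty t {zero}  adj e = refl
Z-empty t {suc N} adj {P} e rewrite e zero = trans (+-identityʳ _) (cong (t *_) (Z-empty t _ (e ∘ suc)))

-- The hard-core model

Indep : ∀ {N} → Adj N → Mask N → Set
Indep adj W = ∀ u v → W u ≡ true → W v ≡ true → adj u v ≡ false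

-- Bernoulli's inequality `(1 - 1/(t+1))^s ≥ 1 - s/(t+1)`, multiplied by `(t+1)^(s+1)` and
-- rearranged to avoid subtraction.
bernoulli-upper : ∀ t s → suc t ^ s * suc t ≤ t ^ s * suc t + suc t ^ s * s
bernoulli-upper t zero    = ≤-reflexive (lem t)
  where
  lem : ∀ t → 1 * suc t ≡ 1 * suc t + 1 * 0
  lem = solve-∀
bernoulli-upper t (suc s) = begin
  suc t * suc t ^ s * suc t                                   ≡⟨ e₁ t (suc t ^ s) ⟩
  t * (suc t ^ s * suc t) + suc t ^ s * suc t                 ≤⟨ +-monoˡ-≤ _ (*-monoʳ-≤ t (bernoulli-upper t s)) ⟩
  t * (t ^ s * suc t + suc t ^ s * s) + suc t ^ s * suc t     ≤⟨ m≤m+n _ (suc t ^ s * s) ⟩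
  t * (t ^ s * suc t + suc t ^ s * s) + suc t ^ s * suc t + suc t ^ s * s ≡⟨ e₂ t s (t ^ s) (suc t ^ s) ⟩
  t * t ^ s * suc t + suc t * suc t ^ s * suc s               ∎
  where
  open ≤-Reasoning
  e₁ : ∀ t a → suc t * a * suc t ≡ t * (a * suc t) + a * suc t
  e₁ = solve-∀
  e₂ : ∀ t s a b → t * (a * suc t + b * s) + b * suc t + b * s ≡ t * a * suc t + suc t * b * suc s
  e₂ = solve-∀

-- With `s = (t+1)/2`, Bernoulli's lower bound is exactly 1/2. So `s` vertices, each worth a factor
-- `1 + 1/t`, at most double a partition function.
pow-suc-≤ : ∀ t s → suc t ≡ 2 * s → suc t ^ s ≤ 2 * t ^ s
pow-suc-≤ t s e = *-cancelʳ-≤ _ _ (suc t) (+-cancelʳ-≤ (suc t ^ s * (2 * s)) _ _ (begin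
  suc t ^ s * suc t + suc t ^ s * (2 * s)                ≡⟨ cong (λ z → suc t ^ s * suc t + suc t ^ s * z) (sym e) ⟩
  suc t ^ s * suc t + suc t ^ s * suc t                  ≤⟨ +-mono-≤ (bernoulli-upper t s) (bernoulli-upper t s) ⟩
  (t ^ s * suc t + suc t ^ s * s) + (t ^ s * suc t + suc t ^ s * s) ≡⟨ lem (t ^ s) (suc t) (suc t ^ s) s ⟩
  2 * t ^ s * suc t + suc t ^ s * (2 * s)                ∎))
  where
  open ≤-Reasoning
  lem : ∀ a b c s → (a * b + c * s) + (a * b + c * s) ≡ 2 * a * b + c * (2 * s)
  lem = solve-∀

module HardCore {N} (adj : Adj N) (adj-sym : ∀ u v → adj u v ≡ adj v u) (adj-irrefl : ∀ u → adj u u ≡ false)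
  (t : ℕ) .{{_ : NonZero t}} where

  open Nbhd adj public

  Zₜ : Mask N → ℕ
  Zₜ = Z t adj

  Z-del : ∀ {P v} → P v ≡ true → t * Zₜ P ≡ t * Zₜ (P - v) + Zₜ (P ∖ v)
  Z-del {P} {v} = Z-delete t adj adj-sym P v

  near-sym : ∀ u v → near u v ≡ near v u
  near-sym u v = cong₂ _∨_ (==-sym u v) (adj-sym u v)

  -‿⊆ : ∀ {P : Mask N} {v} → P - v ⊆ P
  -‿⊆ u = proj₁ ∘ ∧-true

  ∖-⊆ : ∀ {P : Mask N} {v} → P ∖ v ⊆ P
  ∖-⊆ u = proj₁ ∘ ∧-true

  ∖-mono : ∀ {P Q : Mask N} v → P ⊆ Q → P ∖ v ⊆ Q ∖ v
  ∖-mono v P⊆Q u h = let p , q = ∧-true h in ∧-intro (P⊆Q u p) q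

  -- Induction along the deletion recursion of Z, deleting only vertices outside K.
  mask-induction : (K : Mask N) (Φ : Mask N → Set) →
    (∀ D → D ⊆ K → Φ D) →
    (∀ D w → D w ≡ true → K w ≡ false → Φ (D - w) → Φ (D ∖ w) → Φ D) →
    ∀ D → Φ D
  mask-induction K Φ base step D = go (allFin N) D (λ u _ _ → ∈-allFin u)
    where
    absent : ∀ {D : Mask N} {w l} → (∀ u → D u ≡ true → K u ≡ false → u ∈ w ∷ l) →
      ∀ u → D u ≡ true → K u ≡ false → w == u ≡ false → u ∈ l
    absent {w = w} h u Du Ku w≠u with h u Du Ku
    ... | here refl = contradiction (trans (sym (==-refl w)) w≠u) (λ ())
    ... | there u∈l = u∈l
    near-false : ∀ {w u} → near w u ≡ false → w == u ≡ false
    near-false {w} {u} e with w == u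
    ... | false = refl
    go : ∀ l D → (∀ u → D u ≡ true → K u ≡ false → u ∈ l) → Φ D
    go [] D h = base D λ u Du → in-K u Du
      where
      in-K : ∀ u → D u ≡ true → K u ≡ true
      in-K u Du with K u in eq
      ... | true  = refl
      ... | false = contradiction (h u Du eq) λ ()
    go (w ∷ l) D h with D w in Dw | K w in Kw
    ... | true  | false = step D w Dw Kw
      (go l (D - w) λ u Du Ku → let p , q = ∧-true Du in absent h u p Ku (not-true q))
      (go l (D ∖ w) λ u Du Ku → let p , q = ∧-true Du in absent h u p Ku (near-false (not-true q)))
    ... | false | _ = go l D λ u Du Ku → skip u Du Ku (h u Du Ku)
      where
      skip : ∀ u → D u ≡ true → K u ≡ false → u ∈ w ∷ l → u ∈ l
      skip u Du Ku (here refl)  = contradiction (trans (sym Du) Dw) λ ()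
      skip u Du Ku (there u∈l) = u∈l
    ... | true  | true = go l D λ u Du Ku → skip u Du Ku (h u Du Ku)
      where
      skip : ∀ u → D u ≡ true → K u ≡ false → u ∈ w ∷ l → u ∈ l
      skip u Du Ku (here refl)  = contradiction (trans (sym Kw) Ku) λ ()
      skip u Du Ku (there u∈l) = u∈l

  -- Z (D ∖ u) is t Z D times the probability that the random set contains u; this is its deletion recursion.
  Z-del-other : ∀ {D w u} → D w ≡ true → w == u ≡ false →
    t * Zₜ (D ∖ u) ≡ t * Zₜ ((D - w) ∖ u) + (not (near w u) ▹ Zₜ ((D ∖ w) ∖ u))
  Z-del-other {D} {w} {u} Dw w≠u with near w u in eq
  ... | false = trans (Z-del (∧-intro Dw (cong not (trans (near-sym u w) eq))))
      (cong₂ (λ x y → t * x + y) (Z-cong t adj λ x → ∧-swapʳ (D x) _ _) (Z-cong t adj λ x → ∧-swapʳ (D x) _ _))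
  ... | true = trans (cong (t *_) (Z-cong t adj same)) (sym (+-identityʳ _))
    where
    same : ∀ x → (D ∖ u) x ≡ ((D - w) ∖ u) x
    same x with w Fin.≟ x
    ... | no _ = cong (_∧ _) (sym (∧-identityʳ (D x)))
    ... | yes refl rewrite trans (near-sym u w) eq = trans (∧-zeroʳ (D w)) (sym (∧-zeroʳ _))

  -- A vertex is chosen with probability at most `1/(t+1)`, the value for an isolated vertex.
  Z∖-≤ : ∀ {D u} → D u ≡ true → suc t * Zₜ (D ∖ u) ≤ t * Zₜ D
  Z∖-≤ {D} {u} Du = begin
    Zₜ (D ∖ u) + t * Zₜ (D ∖ u)   ≤⟨ +-monoʳ-≤ (Zₜ (D ∖ u)) (*-monoʳ-≤ t (Z-mono t adj sub)) ⟩
    Zₜ (D ∖ u) + t * Zₜ (D - u)   ≡⟨ +-comm (Zₜ (D ∖ u)) _ ⟩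
    t * Zₜ (D - u) + Zₜ (D ∖ u)   ≡⟨ sym (Z-del Du) ⟩
    t * Zₜ D                      ∎
    where
    open ≤-Reasoning
    sub : D ∖ u ⊆ D - u
    sub x h = let p , q = ∧-true h in ∧-intro p (lem (u == x) q)
      where
      lem : ∀ a {b} → not (a ∨ b) ≡ true → not a ≡ true
      lem false _ = refl

  -- The union bound: an independent set either misses `S` or contains one of its vertices. The
  -- vertices of `S` are deleted one by one, hence the induction with the complement of `S` kept.
  cover : ∀ S D → t * Zₜ D ≤ t * Zₜ (λ u → D u ∧ not (S u)) + Σ∈ (D ∩ S) (λ u → Zₜ (D ∖ u))
  cover S = mask-induction (λ u → not (S u)) Φ base step
    where
    open ≤-Reasoning
    Φ : Mask N → Set
    Φ D = t * Zₜ D ≤ t * Zₜ (λ u → D u ∧ not (S u)) + Σ∈ (D ∩ S) (λ u → Zₜ (D ∖ u))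
    base : ∀ D → D ⊆ (λ u → not (S u)) → Φ D
    base D h = ≤-trans (*-monoʳ-≤ t (Z-mono t adj λ u Du → ∧-intro Du (h u Du))) (m≤m+n _ _)
    step : ∀ D w → D w ≡ true → not (S w) ≡ false → Φ (D - w) → Φ (D ∖ w) → Φ D
    step D w Dw Sw IH _ = begin
      t * Zₜ D
        ≡⟨ Z-del Dw ⟩
      t * Zₜ (D - w) + Zₜ (D ∖ w)
        ≤⟨ +-monoˡ-≤ _ IH ⟩
      t * Zₜ (λ u → (D - w) u ∧ not (S u)) + Σ∈ ((D - w) ∩ S) (λ u → Zₜ ((D - w) ∖ u)) + Zₜ (D ∖ w)
        ≡⟨ +-assoc (t * Zₜ (λ u → (D - w) u ∧ not (S u))) _ _ ⟩
      t * Zₜ (λ u → (D - w) u ∧ not (S u)) + (Σ∈ ((D - w) ∩ S) (λ u → Zₜ ((D - w) ∖ u)) + Zₜ (D ∖ w))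
        ≤⟨ +-mono-≤ (*-monoʳ-≤ t (Z-mono t adj λ u h → let p , q = ∧-true h in ∧-intro (-‿⊆ {D} {w} u p) q)) (begin
             Σ∈ ((D - w) ∩ S) (λ u → Zₜ ((D - w) ∖ u)) + Zₜ (D ∖ w)
               ≡⟨ +-comm _ (Zₜ (D ∖ w)) ⟩
             Zₜ (D ∖ w) + Σ∈ ((D - w) ∩ S) (λ u → Zₜ ((D - w) ∖ u))
               ≡⟨ cong (Zₜ (D ∖ w) +_) (Σ∈-cong {E = (D ∩ S) - w} (λ u → ∧-swapʳ (D u) _ _) (λ _ → refl)) ⟩
             Zₜ (D ∖ w) + Σ∈ ((D ∩ S) - w) (λ u → Zₜ ((D - w) ∖ u))
               ≤⟨ +-monoʳ-≤ (Zₜ (D ∖ w)) (Σ∈-mono ((D ∩ S) - w) λ u _ →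
                    Z-mono t adj (∖-mono {D - w} {D} u (-‿⊆ {D} {w}))) ⟩
             Zₜ (D ∖ w) + Σ∈ ((D ∩ S) - w) (λ u → Zₜ (D ∖ u))
               ≡⟨ sym (Σ∈-remove {D = D ∩ S} _ w (∧-intro Dw (not-false Sw))) ⟩
             Σ∈ (D ∩ S) (λ u → Zₜ (D ∖ u)) ∎) ⟩
      t * Zₜ (λ u → D u ∧ not (S u)) + Σ∈ (D ∩ S) (λ u → Zₜ (D ∖ u)) ∎
      where
      not-false : ∀ {a} → not a ≡ false → a ≡ true
      not-false {true} _ = refl

  -- This is `cover` for the closed neighbourhood of `u`. The independent sets that miss it are in
  -- bijection with those that contain `u`, by adding `u` at the cost of a factor `t`, so both kinds
  -- together account for `suc t` times `Z` of what remains.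
  toggle : ∀ {D u} → D u ≡ true → t * Zₜ D ≤ suc t * Zₜ (D ∖ u) + Σ∈ (D ∩ adj u) (λ v → Zₜ (D ∖ v))
  toggle {D} {u} Du = begin
    t * Zₜ D
      ≤⟨ cover (near u) D ⟩
    t * Zₜ (D ∖ u) + Σ∈ (D ∩ near u) (λ v → Zₜ (D ∖ v))
      ≡⟨ cong (t * Zₜ (D ∖ u) +_) (Σ∈-remove {D = D ∩ near u} _ u (∧-intro Du (cong (_∨ adj u u) (==-refl u)))) ⟩
    t * Zₜ (D ∖ u) + (Zₜ (D ∖ u) + Σ∈ ((D ∩ near u) - u) (λ v → Zₜ (D ∖ v)))
      ≤⟨ +-monoʳ-≤ (t * Zₜ (D ∖ u)) (+-monoʳ-≤ (Zₜ (D ∖ u)) (Σ∈-⊆ {D = (D ∩ near u) - u} _ sub)) ⟩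
    t * Zₜ (D ∖ u) + (Zₜ (D ∖ u) + Σ∈ (D ∩ adj u) (λ v → Zₜ (D ∖ v)))
      ≡⟨ lem t (Zₜ (D ∖ u)) _ ⟩
    suc t * Zₜ (D ∖ u) + Σ∈ (D ∩ adj u) (λ v → Zₜ (D ∖ v)) ∎
    where
    open ≤-Reasoning
    lem : ∀ t a b → t * a + (a + b) ≡ suc t * a + b
    lem = solve-∀
    bool : ∀ d e a → (d ∧ (e ∨ a)) ∧ not e ≡ true → d ∧ a ≡ true
    bool true false a h = trans (sym (∧-identityʳ a)) h
    bool true true true ()
    sub : (D ∩ near u) - u ⊆ D ∩ adj u
    sub v = bool (D v) (u == v) (adj u v)

  t^N≤Z : ∀ D → t ^ N ≤ Zₜ D
  t^N≤Z D = subst (_≤ Zₜ D) (Z-empty t adj {λ _ → false} (λ _ → refl)) (Z-mono t adj λ _ ())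

  occupancy : Mask N → ℕ
  occupancy D = Σ∈ D (λ u → Zₜ (D ∖ u))

  add : Fin N → Mask N → Mask N
  add w W u = w == u ∨ W u

  -- The mean size `occupancy D / (t * Z D)` of the random set is a weighted average of the mean for
  -- `D - w` and of one plus the mean for `D ∖ w`. The larger of the two recursive witnesses, with
  -- `w` added to the second, therefore reaches the mean.
  large-independent : ∀ D → ∃ λ W → W ⊆ D × Indep adj W × occupancy D ≤ card W * (t * Zₜ D)
  large-independent = mask-induction (λ _ → false) Φ base step
    where
    open ≤-Reasoning
    Φ : Mask N → Set
    Φ D = ∃ λ W → W ⊆ D × Indep adj W × occupancy D ≤ card W * (t * Zₜ D)
    base : ∀ D → D ⊆ (λ _ → false) → Φ D
    base D h = (λ _ → false) , (λ _ ()) , (λ _ _ ()) , ≤-trans (≤-reflexive (sum-zero λ u → lem u (D u) refl)) z≤n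
      where
      lem : ∀ u b → D u ≡ b → b ▹ Zₜ (D ∖ u) ≡ 0
      lem u false _ = refl
      lem u true  e = contradiction (h u e) λ ()
    -- The three terms are the contribution of `w` itself, of the sets without `w`, and of the other
    -- members of the sets with `w`.
    occ : ∀ D w → D w ≡ true → t * occupancy D ≡ t * Zₜ (D ∖ w) + (t * occupancy (D - w) + occupancy (D ∖ w))
    occ D w Dw = begin-equality
      t * occupancy D
        ≡⟨ cong (t *_) (Σ∈-remove {D = D} _ w Dw) ⟩
      t * (Zₜ (D ∖ w) + Σ∈ (D - w) (λ u → Zₜ (D ∖ u)))
        ≡⟨ *-distribˡ-+ t (Zₜ (D ∖ w)) _ ⟩
      t * Zₜ (D ∖ w) + t * Σ∈ (D - w) (λ u → Zₜ (D ∖ u))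
        ≡⟨ cong (t * Zₜ (D ∖ w) +_) (begin-equality
             t * Σ∈ (D - w) (λ u → Zₜ (D ∖ u))
               ≡⟨ *-distribˡ-sum t (λ u → (D - w) u ▹ Zₜ (D ∖ u)) ⟩
             sum (λ u → t * ((D - w) u ▹ Zₜ (D ∖ u)))
               ≡⟨ sum-cong-≗ pointwise ⟩
             sum (λ u → t * ((D - w) u ▹ Zₜ ((D - w) ∖ u)) + ((D ∖ w) u ▹ Zₜ ((D ∖ w) ∖ u)))
               ≡⟨ ∑-distrib-+ (λ u → t * ((D - w) u ▹ Zₜ ((D - w) ∖ u))) _ ⟩
             sum (λ u → t * ((D - w) u ▹ Zₜ ((D - w) ∖ u))) + occupancy (D ∖ w)
               ≡⟨ cong (_+ occupancy (D ∖ w)) (sym (*-distribˡ-sum t (λ u → (D - w) u ▹ Zₜ ((D - w) ∖ u)))) ⟩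
             t * occupancy (D - w) + occupancy (D ∖ w) ∎) ⟩
      t * Zₜ (D ∖ w) + (t * occupancy (D - w) + occupancy (D ∖ w)) ∎
      where
      pointwise : ∀ u → t * ((D - w) u ▹ Zₜ (D ∖ u))
        ≡ t * ((D - w) u ▹ Zₜ ((D - w) ∖ u)) + ((D ∖ w) u ▹ Zₜ ((D ∖ w) ∖ u))
      pointwise u = by-cases (D u) (w == u) refl
        where
        by-cases : ∀ d e → w == u ≡ e → t * ((d ∧ not e) ▹ Zₜ (D ∖ u))
          ≡ t * ((d ∧ not e) ▹ Zₜ ((D - w) ∖ u)) + ((d ∧ not (e ∨ adj w u)) ▹ Zₜ ((D ∖ w) ∖ u))
        by-cases false e     _ rewrite *-zeroʳ t = refl
        by-cases true  true  _ rewrite *-zeroʳ t = refl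
        by-cases true  false e = trans (Z-del-other Dw e)
          (cong (λ z → t * Zₜ ((D - w) ∖ u) + (not (z ∨ adj w u) ▹ Zₜ ((D ∖ w) ∖ u))) e)
    step : ∀ D w → D w ≡ true → false ≡ false → Φ (D - w) → Φ (D ∖ w) → Φ D
    step D w Dw _ (W₁ , ⊆₁ , ind₁ , le₁) (W₂ , ⊆₂ , ind₂ , le₂) = choose (≤-total (suc (card W₂)) (card W₁))
      where
      bound : ∀ c → card W₁ ≤ c → suc (card W₂) ≤ c → occupancy D ≤ c * (t * Zₜ D)
      bound c h₁ h₂ = *-cancelˡ-≤ t (begin
        t * occupancy D
          ≡⟨ occ D w Dw ⟩
        t * Zₜ (D ∖ w) + (t * occupancy (D - w) + occupancy (D ∖ w))
          ≤⟨ +-monoʳ-≤ (t * Zₜ (D ∖ w)) (+-mono-≤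
               (*-monoʳ-≤ t (≤-trans le₁ (*-monoˡ-≤ (t * Zₜ (D - w)) h₁))) le₂) ⟩
        t * Zₜ (D ∖ w) + (t * (c * (t * Zₜ (D - w))) + card W₂ * (t * Zₜ (D ∖ w)))
          ≡⟨ lem₁ t c (Zₜ (D - w)) (Zₜ (D ∖ w)) (card W₂) ⟩
        t * (c * (t * Zₜ (D - w))) + suc (card W₂) * (t * Zₜ (D ∖ w))
          ≤⟨ +-monoʳ-≤ (t * (c * (t * Zₜ (D - w)))) (*-monoˡ-≤ (t * Zₜ (D ∖ w)) h₂) ⟩
        t * (c * (t * Zₜ (D - w))) + c * (t * Zₜ (D ∖ w))
          ≡⟨ lem₂ t c (Zₜ (D - w)) (Zₜ (D ∖ w)) ⟩
        t * (c * (t * Zₜ (D - w) + Zₜ (D ∖ w)))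
          ≡⟨ cong (λ z → t * (c * z)) (sym (Z-del Dw)) ⟩
        t * (c * (t * Zₜ D)) ∎)
        where
        lem₁ : ∀ t c a b d → t * b + (t * (c * (t * a)) + d * (t * b)) ≡ t * (c * (t * a)) + suc d * (t * b)
        lem₁ = solve-∀
        lem₂ : ∀ t c a b → t * (c * (t * a)) + c * (t * b) ≡ t * (c * (t * a + b))
        lem₂ = solve-∀
      card-add : card (add w W₂) ≡ suc (card W₂)
      card-add = trans (Σ∈-remove {D = add w W₂} (λ _ → 1) w (cong (_∨ W₂ w) (==-refl w)))
        (cong suc (Σ∈-cong same (λ _ → refl)))
        where
        same : ∀ u → (add w W₂ - w) u ≡ W₂ u
        same u with w == u in e
        ... | false = ∧-identityʳ (W₂ u)
        ... | true with W₂ u in f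
        ... | false = refl
        ... | true with not-true (proj₂ (∧-true {D u} (⊆₂ u f)))
        ... | g rewrite e = contradiction g λ ()
      separate : ∀ {u} → W₂ u ≡ true → adj w u ≡ false
      separate {u} h with w == u | not-true (proj₂ (∧-true {D u} (⊆₂ u h)))
      ... | false | g = g
      add-indep : Indep adj (add w W₂)
      add-indep u v hu hv with w == u in e | w == v in f
      ... | true  | true  rewrite sym (==⇒≡ {u = w} {u} e) | sym (==⇒≡ {u = w} {v} f) = adj-irrefl w
      ... | true  | false rewrite sym (==⇒≡ {u = w} {u} e) = separate hv
      ... | false | true  rewrite sym (==⇒≡ {u = w} {v} f) = trans (adj-sym u w) (separate hu)
      ... | false | false = ind₂ u v hu hv
      add-⊆ : add w W₂ ⊆ D
      add-⊆ u h with w == u in e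
      ... | true rewrite sym (==⇒≡ {u = w} {u} e) = Dw
      ... | false = ∖-⊆ {D} {w} u (⊆₂ u h)
      choose : suc (card W₂) ≤ card W₁ ⊎ card W₁ ≤ suc (card W₂) → Φ D
      choose (inj₁ h) = W₁ , (λ u → -‿⊆ {D} {w} u ∘ ⊆₁ u) , ind₁ , bound _ ≤-refl h
      choose (inj₂ h) = add w W₂ , add-⊆ , add-indep
        , subst (λ c → occupancy D ≤ c * (t * Zₜ D)) (sym card-add) (bound _ h ≤-refl)

-- Independent sets from bounded degrees and sparse neighbourhoods

Σ∈-comm-adj : ∀ {N} (adj : Adj N) → (∀ u v → adj u v ≡ adj v u) → ∀ U (g : Fin N → ℕ) →
  Σ∈ U (λ v → Σ∈ (U ∩ adj v) g) ≡ Σ∈ U (λ u → card (U ∩ adj u) * g u)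
Σ∈-comm-adj adj adj-sym U g = begin
  sum (λ v → U v ▹ sum (λ u → (U u ∧ adj v u) ▹ g u))
    ≡⟨ sum-cong-≗ (λ v → ▹-sum (U v) (λ u → (U u ∧ adj v u) ▹ g u)) ⟩
  sum (λ v → sum (λ u → U v ▹ (U u ∧ adj v u) ▹ g u))
    ≡⟨ ∑-comm (λ v u → U v ▹ (U u ∧ adj v u) ▹ g u) ⟩
  sum (λ u → sum (λ v → U v ▹ (U u ∧ adj v u) ▹ g u))
    ≡⟨ sum-cong-≗ (λ u → trans (sum-cong-≗ λ v → trans
         (cong (λ a → U v ▹ (U u ∧ a) ▹ g u) (adj-sym v u))
         (bool (U v) (U u) (adj u v) (g u)))
         (trans (sym (▹-sum (U u) (λ v → g u * ((U v ∧ adj u v) ▹ 1))))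
           (cong (U u ▹_) (trans (sym (*-distribˡ-sum (g u) (λ v → (U v ∧ adj u v) ▹ 1))) (*-comm (g u) _))))) ⟩
  sum (λ u → U u ▹ card (U ∩ adj u) * g u) ∎
  where
  open ≡-Reasoning
  bool : ∀ a b c x → a ▹ (b ∧ c) ▹ x ≡ b ▹ x * ((a ∧ c) ▹ 1)
  bool true  true  true  x = sym (*-identityʳ x)
  bool true  true  false x = sym (*-zeroʳ x)
  bool true  false c     x = refl
  bool false true  c     x = sym (*-zeroʳ x)
  bool false false c     x = refl

pow-*-distrib : ∀ a b m → (a * b) ^ m ≡ a ^ m * b ^ m
pow-*-distrib a b zero    = refl
pow-*-distrib a b (suc m) = trans (cong (a * b *_) (pow-*-distrib a b m)) (lem a b (a ^ m) (b ^ m))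
  where
  lem : ∀ a b c d → a * b * (c * d) ≡ a * c * (b * d)
  lem = solve-∀

module Graphs {N} (adj : Adj N) (adj-sym : ∀ u v → adj u v ≡ adj v u) (adj-irrefl : ∀ u → adj u u ≡ false) where

  deg : Mask N → Fin N → ℕ
  deg D u = card (D ∩ adj u)

  module Occupancy (t : ℕ) .{{_ : NonZero t}} where
    open HardCore adj adj-sym adj-irrefl t public

    -- The sum of `toggle` over all vertices; exchanging the order of summation over adjacent pairs
    -- counts each `u` once per neighbour.
    card-≤-occupancy : ∀ U → card U * (t * Zₜ U) ≤ suc t * occupancy U + Σ∈ U (λ u → deg U u * Zₜ (U ∖ u))
    card-≤-occupancy U = begin
      card U * (t * Zₜ U)
        ≡⟨ trans (*-comm (card U) _) (sym (Σ∈-const U (t * Zₜ U))) ⟩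
      Σ∈ U (λ _ → t * Zₜ U)
        ≤⟨ Σ∈-mono U (λ u Uu → toggle {U} {u} Uu) ⟩
      Σ∈ U (λ u → suc t * Zₜ (U ∖ u) + Σ∈ (U ∩ adj u) (λ v → Zₜ (U ∖ v)))
        ≡⟨ Σ∈-+ U (λ u → suc t * Zₜ (U ∖ u)) _ ⟩
      Σ∈ U (λ u → suc t * Zₜ (U ∖ u)) + Σ∈ U (λ u → Σ∈ (U ∩ adj u) (λ v → Zₜ (U ∖ v)))
        ≡⟨ cong₂ _+_ (sym (Σ∈-* (suc t) U _)) (Σ∈-comm-adj adj adj-sym U (λ v → Zₜ (U ∖ v))) ⟩
      suc t * occupancy U + Σ∈ U (λ u → deg U u * Zₜ (U ∖ u)) ∎
      where open ≤-Reasoning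

    -- Deleting a vertex lowers `Z` by a factor of at most `1 + 1/t`, with equality in the absence
    -- of edges.
    Z-≤-card : ∀ D m → card D ≤ m → t ^ m * Zₜ D ≤ suc t ^ m * t ^ N
    Z-≤-card = mask-induction (λ _ → false) Φ base step
      where
      open ≤-Reasoning
      Φ : Mask N → Set
      Φ D = ∀ m → card D ≤ m → t ^ m * Zₜ D ≤ suc t ^ m * t ^ N
      base : ∀ D → D ⊆ (λ _ → false) → Φ D
      base D h m _ = *-mono-≤ (^-monoˡ-≤ m (n≤1+n t)) (≤-reflexive (Z-empty t adj empty))
        where
        empty : ∀ u → D u ≡ false
        empty u with D u in e
        ... | false = refl
        ... | true  = sym (h u e)
      step : ∀ D w → D w ≡ true → false ≡ false → Φ (D - w) → Φ (D ∖ w) → Φ D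
      step D w Dw _ IH _ m h with subst (_≤ m) (Σ∈-remove {D = D} (λ _ → 1) w Dw) h
      step D w Dw _ IH _ (suc m) h | s≤s h′ = begin
        t * t ^ m * Zₜ D
          ≡⟨ lem₁ t (t ^ m) (Zₜ D) ⟩
        t ^ m * (t * Zₜ D)
          ≡⟨ cong (t ^ m *_) (Z-del Dw) ⟩
        t ^ m * (t * Zₜ (D - w) + Zₜ (D ∖ w))
          ≤⟨ *-monoʳ-≤ (t ^ m) (+-monoʳ-≤ (t * Zₜ (D - w)) (Z-mono t adj sub)) ⟩
        t ^ m * (t * Zₜ (D - w) + Zₜ (D - w))
          ≡⟨ lem₂ t (t ^ m) (Zₜ (D - w)) ⟩
        suc t * (t ^ m * Zₜ (D - w))
          ≤⟨ *-monoʳ-≤ (suc t) (IH m h′) ⟩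
        suc t * (suc t ^ m * t ^ N)
          ≡⟨ sym (*-assoc (suc t) (suc t ^ m) (t ^ N)) ⟩
        suc t * suc t ^ m * t ^ N ∎
        where
        lem₁ : ∀ a b c → a * b * c ≡ b * (a * c)
        lem₁ = solve-∀
        lem₂ : ∀ t b c → b * (t * c + c) ≡ suc t * (b * c)
        lem₂ = solve-∀
        sub : D ∖ w ⊆ D - w
        sub x h = let p , q = ∧-true h in ∧-intro p (bool (w == x) q)
          where
          bool : ∀ a {b} → not (a ∨ b) ≡ true → not a ≡ true
          bool false _ = refl

  -- At fugacity 1 each chosen vertex is charged 2 for itself and at most `Δ` through its
  -- neighbours. The constant is one worse than for the greedy algorithm, which only affects
  -- constants later.
  turan : ∀ U Δ → (∀ u → U u ≡ true → deg U u ≤ Δ) → ∃ λ W → W ⊆ U × Indep adj W × card U ≤ (2 + Δ) * card W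
  turan U Δ h = let W , W⊆U , ind , le = large-independent U in W , W⊆U , ind ,
    *-cancelʳ-≤ (card U) ((2 + Δ) * card W) (1 * Zₜ U)
      {{>-nonZero (≤-trans (m^n>0 1 N) (≤-trans (t^N≤Z U) (≤-reflexive (sym (*-identityˡ (Zₜ U))))))}} (begin
      card U * (1 * Zₜ U)
        ≤⟨ card-≤-occupancy U ⟩
      2 * occupancy U + Σ∈ U (λ u → deg U u * Zₜ (U ∖ u))
        ≤⟨ +-monoʳ-≤ (2 * occupancy U) (Σ∈-mono U λ u Uu → *-monoˡ-≤ (Zₜ (U ∖ u)) (h u Uu)) ⟩
      2 * occupancy U + Σ∈ U (λ u → Δ * Zₜ (U ∖ u))
        ≡⟨ cong (2 * occupancy U +_) (sym (Σ∈-* Δ U _)) ⟩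
      2 * occupancy U + Δ * occupancy U
        ≡⟨ sym (*-distribʳ-+ (occupancy U) 2 Δ) ⟩
      (2 + Δ) * occupancy U
        ≤⟨ *-monoʳ-≤ (2 + Δ) le ⟩
      (2 + Δ) * (card W * (1 * Zₜ U))
        ≡⟨ sym (*-assoc (2 + Δ) (card W) _) ⟩
      (2 + Δ) * card W * (1 * Zₜ U) ∎)
    where
    open Occupancy 1
    open ≤-Reasoning

  module LocallySparse (t s b : ℕ) .{{_ : NonZero t}} (1+t≡2s : suc t ≡ 2 * s) where
    open Occupancy t
    open ≤-Reasoning

    -- The weight of `v` is `b` over a lower bound for the probability that `v` is chosen when few
    -- neighbours are available.
    a : ℕ
    a = b * (t * 2 ^ (8 * b) + 1)

    -- In `card-≤-occupancy` the edges account for at most the degree sum over `t + 1`, by `Z∖-≤`.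
    -- That is `2 * b * suc t`, half of the assumed size, so `suc t` times the mean supplies the
    -- other half.
    occupancy-large : ∀ X → 4 * b * suc t ≤ card X → Σ∈ X (deg X) ≤ 2 * b * (suc t * suc t) →
      2 * b * (t * Zₜ X) ≤ occupancy X
    occupancy-large X large sparse =
      +-cancelʳ-≤ (2 * b * (t * Zₜ X)) _ _ (*-cancelˡ-≤ (suc t) (*-cancelˡ-≤ (suc t) (begin
      suc t * (suc t * (2 * b * (t * Zₜ X) + 2 * b * (t * Zₜ X)))
        ≡⟨ e₁ b (suc t) (t * Zₜ X) ⟩
      suc t * (4 * b * suc t * (t * Zₜ X))
        ≤⟨ *-monoʳ-≤ (suc t) (*-monoˡ-≤ (t * Zₜ X) large) ⟩
      suc t * (card X * (t * Zₜ X))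
        ≤⟨ *-monoʳ-≤ (suc t) (card-≤-occupancy X) ⟩
      suc t * (suc t * occupancy X + Σ∈ X (λ u → deg X u * Zₜ (X ∖ u)))
        ≡⟨ *-distribˡ-+ (suc t) (suc t * occupancy X) _ ⟩
      suc t * (suc t * occupancy X) + suc t * Σ∈ X (λ u → deg X u * Zₜ (X ∖ u))
        ≤⟨ +-monoʳ-≤ (suc t * (suc t * occupancy X)) (begin
             suc t * Σ∈ X (λ u → deg X u * Zₜ (X ∖ u))
               ≡⟨ Σ∈-* (suc t) X _ ⟩
             Σ∈ X (λ u → suc t * (deg X u * Zₜ (X ∖ u)))
               ≤⟨ Σ∈-mono X (λ u Xu → ≤-trans (≤-reflexive (e₂ (suc t) (deg X u) (Zₜ (X ∖ u))))
                    (*-monoˡ-≤ (deg X u) (Z∖-≤ {X} {u} Xu))) ⟩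
             Σ∈ X (λ u → t * Zₜ X * deg X u)
               ≡⟨ sym (Σ∈-* (t * Zₜ X) X (deg X)) ⟩
             t * Zₜ X * Σ∈ X (deg X)
               ≤⟨ *-monoʳ-≤ (t * Zₜ X) sparse ⟩
             t * Zₜ X * (2 * b * (suc t * suc t)) ∎) ⟩
      suc t * (suc t * occupancy X) + t * Zₜ X * (2 * b * (suc t * suc t))
        ≡⟨ e₃ b (suc t) (t * Zₜ X) (occupancy X) ⟩
      suc t * (suc t * (occupancy X + 2 * b * (t * Zₜ X))) ∎)))
      where
      e₁ : ∀ b t z → t * (t * (2 * b * z + 2 * b * z)) ≡ t * (4 * b * t * z)
      e₁ = solve-∀
      e₂ : ∀ t d z → t * (d * z) ≡ t * z * d
      e₂ = solve-∀
      e₃ : ∀ b t z o → t * (t * o) + z * (2 * b * (t * t)) ≡ t * (t * (o + 2 * b * z))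
      e₃ = solve-∀

    -- Here `4 * b * suc t` equals `8 * b * s`, which is `8 * b` groups of `s` vertices, and each
    -- group at most doubles `Z`.
    Z-small : ∀ X → card X ≤ 4 * b * suc t → Zₜ X ≤ 2 ^ (8 * b) * t ^ N
    Z-small X small = *-cancelˡ-≤ (t ^ m) {{m^n≢0 t m}} (begin
      t ^ m * Zₜ X
        ≤⟨ Z-≤-card X m (≤-trans small (≤-reflexive (trans (cong (4 * b *_) 1+t≡2s) (e₁ b s)))) ⟩
      suc t ^ m * t ^ N
        ≤⟨ *-monoˡ-≤ (t ^ N) (begin
             suc t ^ m              ≡⟨ sym (^-*-assoc (suc t) s (8 * b)) ⟩
             (suc t ^ s) ^ (8 * b)  ≤⟨ ^-monoˡ-≤ (8 * b) (pow-suc-≤ t s 1+t≡2s) ⟩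
             (2 * t ^ s) ^ (8 * b)  ≡⟨ pow-*-distrib 2 (t ^ s) (8 * b) ⟩
             2 ^ (8 * b) * (t ^ s) ^ (8 * b) ≡⟨ cong (2 ^ (8 * b) *_) (^-*-assoc t s (8 * b)) ⟩
             2 ^ (8 * b) * t ^ m    ∎) ⟩
      2 ^ (8 * b) * t ^ m * t ^ N
        ≡⟨ e₂ (2 ^ (8 * b)) (t ^ m) (t ^ N) ⟩
      t ^ m * (2 ^ (8 * b) * t ^ N) ∎)
      where
      m = s * (8 * b)
      e₁ : ∀ b s → 4 * b * (2 * s) ≡ s * (8 * b)
      e₁ = solve-∀
      e₂ : ∀ p q r → p * q * r ≡ q * (p * r)
      e₂ = solve-∀

    -- `X` plays the available neighbours of `v`, and the summand `t ^ N` on the left is the event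
    -- that `v` is chosen. For large `X` the mean `2 * b` instead of `b` also pays for that event,
    -- since `t ^ N ≤ Z X`; for small `X` the weight `a` pays alone.
    local-base : ∀ X → Σ∈ X (deg X) ≤ 2 * b * (suc t * suc t) →
      b * (t * Zₜ X + t ^ N) ≤ a * t ^ N + occupancy X
    local-base X sparse with ≤-total (4 * b * suc t) (card X)
    ... | inj₁ large = begin
      b * (t * Zₜ X + t ^ N)
        ≤⟨ *-monoʳ-≤ b (+-monoʳ-≤ (t * Zₜ X) (≤-trans (t^N≤Z X) (m≤n*m (Zₜ X) t))) ⟩
      b * (t * Zₜ X + t * Zₜ X)
        ≡⟨ e b (t * Zₜ X) ⟩
      2 * b * (t * Zₜ X)
        ≤⟨ occupancy-large X large sparse ⟩
      occupancy X
        ≤⟨ m≤n+m _ (a * t ^ N) ⟩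
      a * t ^ N + occupancy X ∎
      where
      e : ∀ b z → b * (z + z) ≡ 2 * b * z
      e = solve-∀
    ... | inj₂ small = begin
      b * (t * Zₜ X + t ^ N)
        ≤⟨ *-monoʳ-≤ b (+-monoˡ-≤ (t ^ N) (*-monoʳ-≤ t (Z-small X small))) ⟩
      b * (t * (2 ^ (8 * b) * t ^ N) + t ^ N)
        ≡⟨ e b t (2 ^ (8 * b)) (t ^ N) ⟩
      a * t ^ N
        ≤⟨ m≤m+n _ _ ⟩
      a * t ^ N + occupancy X ∎
      where
      e : ∀ b t p n → b * (t * (p * n) + n) ≡ b * (t * p + 1) * n
      e = solve-∀

    nbr-occupancy : Mask N → Fin N → ℕ
    nbr-occupancy D v = Σ∈ (D ∩ adj v) (λ u → Zₜ (D ∖ u))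

    -- Deleting vertices outside the closed neighbourhood of `v` conditions on the random set there.
    -- All terms of the inequality obey the same linear recursion, so it suffices to treat `D`
    -- inside `near v`, where `D ∖ v` is empty and `local-base` applies.
    local : ∀ U v → Σ∈ (U ∩ adj v) (deg (U ∩ adj v)) ≤ 2 * b * (suc t * suc t) →
      ∀ D → D ⊆ U → D v ≡ true → b * (t * Zₜ D) ≤ a * Zₜ (D ∖ v) + nbr-occupancy D v
    local U v sparse = mask-induction (near v) Φ base step
      where
      Φ : Mask N → Set
      Φ D = D ⊆ U → D v ≡ true → b * (t * Zₜ D) ≤ a * Zₜ (D ∖ v) + nbr-occupancy D v
      base : ∀ D → D ⊆ near v → Φ D
      base D D⊆near D⊆U Dv = begin
        b * (t * Zₜ D)
          ≡⟨ cong (b *_) (Z-del Dv) ⟩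
        b * (t * Zₜ (D - v) + Zₜ (D ∖ v))
          ≡⟨ cong (λ z → b * (t * Zₜ (D - v) + z)) D∖v ⟩
        b * (t * Zₜ (D - v) + t ^ N)
          ≤⟨ local-base (D - v) (≤-trans (≤-trans
               (Σ∈-mono (D - v) λ u _ → card-⊆ {D = (D - v) ∩ adj u} λ x h →
                 let p , q = ∧-true h in ∧-intro (X⊆ x p) q)
               (Σ∈-⊆ {D = D - v} _ X⊆)) sparse) ⟩
        a * t ^ N + occupancy (D - v)
          ≤⟨ +-monoʳ-≤ (a * t ^ N) (≤-trans
               (Σ∈-⊆ {D = D - v} {E = D ∩ adj v} _ λ x h → ∧-intro (proj₁ (∧-true h)) (X-adj x h))
               (Σ∈-mono (D ∩ adj v) λ u _ → Z-mono t adj (∖-mono {D - v} {D} u (-‿⊆ {D} {v})))) ⟩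
        a * t ^ N + nbr-occupancy D v
          ≡⟨ cong (λ z → a * z + nbr-occupancy D v) (sym D∖v) ⟩
        a * Zₜ (D ∖ v) + nbr-occupancy D v ∎
        where
        bool : ∀ {a b} → a ∨ b ≡ true → not a ≡ true → b ≡ true
        bool {false} h _ = h
        X-adj : ∀ x → (D - v) x ≡ true → adj v x ≡ true
        X-adj x h = let p , q = ∧-true h in bool (D⊆near x p) q
        X⊆ : D - v ⊆ U ∩ adj v
        X⊆ x h = ∧-intro (D⊆U x (proj₁ (∧-true h))) (X-adj x h)
        empty : ∀ u → (D ∖ v) u ≡ false
        empty u with D u in e
        ... | false = refl
        ... | true  = cong not (D⊆near u e)
        D∖v : Zₜ (D ∖ v) ≡ t ^ N
        D∖v = Z-empty t adj empty
      step : ∀ D w → D w ≡ true → near v w ≡ false → Φ (D - w) → Φ (D ∖ w) → Φ D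
      step D w Dw w∉ IH₁ IH₂ D⊆U Dv = *-cancelˡ-≤ t (begin
        t * (b * (t * Zₜ D))
          ≡⟨ cong (λ z → t * (b * z)) (Z-del Dw) ⟩
        t * (b * (t * Zₜ (D - w) + Zₜ (D ∖ w)))
          ≡⟨ e₁ t b (Zₜ (D - w)) (Zₜ (D ∖ w)) ⟩
        t * (b * (t * Zₜ (D - w))) + b * (t * Zₜ (D ∖ w))
          ≤⟨ +-mono-≤ (*-monoʳ-≤ t (IH₁ (⊆-trans {P = D - w} (-‿⊆ {D} {w}) D⊆U) (∧-intro Dv (cong not w≠v))))
                      (IH₂ (⊆-trans {P = D ∖ w} (∖-⊆ {D} {w}) D⊆U) (∧-intro Dv (cong not w≁v))) ⟩
        t * (a * Zₜ ((D - w) ∖ v) + nbr-occupancy (D - w) v) + (a * Zₜ ((D ∖ w) ∖ v) + nbr-occupancy (D ∖ w) v)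
          ≡⟨ e₂ t a (Zₜ ((D - w) ∖ v)) (nbr-occupancy (D - w) v) (Zₜ ((D ∖ w) ∖ v)) (nbr-occupancy (D ∖ w) v) ⟩
        a * (t * Zₜ ((D - w) ∖ v) + Zₜ ((D ∖ w) ∖ v)) + (t * nbr-occupancy (D - w) v + nbr-occupancy (D ∖ w) v)
          ≡⟨ cong₂ (λ x y → a * x + y)
               (sym (trans (Z-del-other Dw w≠v) (cong (λ z → t * Zₜ ((D - w) ∖ v) + (not z ▹ Zₜ ((D ∖ w) ∖ v))) w≁v)))
               (sym nbr-step) ⟩
        a * (t * Zₜ (D ∖ v)) + t * nbr-occupancy D v
          ≡⟨ e₃ t a (Zₜ (D ∖ v)) (nbr-occupancy D v) ⟩
        t * (a * Zₜ (D ∖ v) + nbr-occupancy D v) ∎)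
        where
        e₁ : ∀ t b x y → t * (b * (t * x + y)) ≡ t * (b * (t * x)) + b * (t * y)
        e₁ = solve-∀
        e₂ : ∀ t a x y z w → t * (a * x + y) + (a * z + w) ≡ a * (t * x + z) + (t * y + w)
        e₂ = solve-∀
        e₃ : ∀ t a x y → a * (t * x) + t * y ≡ t * (a * x + y)
        e₃ = solve-∀
        bool₁ : ∀ {a b} → a ∨ b ≡ false → a ≡ false
        bool₁ {false} _ = refl
        w≁v : near w v ≡ false
        w≁v = trans (near-sym w v) w∉
        w≠v : w == v ≡ false
        w≠v = bool₁ w≁v
        nbr-step : t * nbr-occupancy D v ≡ t * nbr-occupancy (D - w) v + nbr-occupancy (D ∖ w) v
        nbr-step = begin-equality
          t * nbr-occupancy D v
            ≡⟨ *-distribˡ-sum t (λ u → (D ∩ adj v) u ▹ Zₜ (D ∖ u)) ⟩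
          sum (λ u → t * ((D ∩ adj v) u ▹ Zₜ (D ∖ u)))
            ≡⟨ sum-cong-≗ (λ u → by-cases u (D u) (w == u) (adj v u) refl refl) ⟩
          sum (λ u → t * (((D - w) ∩ adj v) u ▹ Zₜ ((D - w) ∖ u)) + (((D ∖ w) ∩ adj v) u ▹ Zₜ ((D ∖ w) ∖ u)))
            ≡⟨ ∑-distrib-+ (λ u → t * (((D - w) ∩ adj v) u ▹ Zₜ ((D - w) ∖ u))) _ ⟩
          sum (λ u → t * (((D - w) ∩ adj v) u ▹ Zₜ ((D - w) ∖ u))) + nbr-occupancy (D ∖ w) v
            ≡⟨ cong (_+ nbr-occupancy (D ∖ w) v)
                 (sym (*-distribˡ-sum t (λ u → ((D - w) ∩ adj v) u ▹ Zₜ ((D - w) ∖ u)))) ⟩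
          t * nbr-occupancy (D - w) v + nbr-occupancy (D ∖ w) v ∎
          where
          bool₂ : ∀ a {b} → a ∨ b ≡ false → b ≡ false
          bool₂ false h = h
          by-cases : ∀ u d e c → w == u ≡ e → adj v u ≡ c → t * ((d ∧ c) ▹ Zₜ (D ∖ u))
            ≡ t * (((d ∧ not e) ∧ c) ▹ Zₜ ((D - w) ∖ u)) + (((d ∧ not (e ∨ adj w u)) ∧ c) ▹ Zₜ ((D ∖ w) ∖ u))
          by-cases u false e c     _ _ rewrite *-zeroʳ t = refl
          -- Here `u` is the deleted vertex `w`, which is not adjacent to `v`, so `c` is false.
          by-cases u true true c e′ c′ rewrite trans (sym c′)
            (trans (cong (adj v) (sym (==⇒≡ {u = w} {u} e′))) (bool₂ (v == w) w∉))
            | *-zeroʳ t = refl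
          by-cases u true false true e′ c′ = trans (Z-del-other Dw e′)
            (cong (λ z → t * Zₜ ((D - w) ∖ u) + (z ▹ Zₜ ((D ∖ w) ∖ u)))
              (trans (cong (λ z → not (z ∨ adj w u)) e′) (sym (∧-identityʳ (not (adj w u))))))
          by-cases u true false false e′ c′ rewrite ∧-zeroʳ (not (adj w u)) | *-zeroʳ t = refl

    -- The average of `local` over `v`. As long as `a ≤ Δ`, this improves on `turan` by a factor of
    -- order `b`.
    locally-sparse : ∀ U Δ → (∀ v → U v ≡ true → deg U v ≤ Δ) →
      (∀ v → U v ≡ true → Σ∈ (U ∩ adj v) (deg (U ∩ adj v)) ≤ 2 * b * (suc t * suc t)) →
      ∃ λ W → W ⊆ U × Indep adj W × b * card U ≤ (a + Δ) * card W
    locally-sparse U Δ h sparse = let W , W⊆U , ind , le = large-independent U in W , W⊆U , ind ,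
      *-cancelʳ-≤ (b * card U) ((a + Δ) * card W) (t * Zₜ U)
        {{m*n≢0 t (Zₜ U) {{it}} {{>-nonZero (≤-trans (m^n>0 t N) (t^N≤Z U))}}}} (begin
        b * card U * (t * Zₜ U)
          ≡⟨ trans (e b (card U) (t * Zₜ U)) (sym (Σ∈-const U (b * (t * Zₜ U)))) ⟩
        Σ∈ U (λ _ → b * (t * Zₜ U))
          ≤⟨ Σ∈-mono U (λ v Uv → local U v (sparse v Uv) U (λ _ p → p) Uv) ⟩
        Σ∈ U (λ v → a * Zₜ (U ∖ v) + nbr-occupancy U v)
          ≡⟨ Σ∈-+ U (λ v → a * Zₜ (U ∖ v)) _ ⟩
        Σ∈ U (λ v → a * Zₜ (U ∖ v)) + Σ∈ U (nbr-occupancy U)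
          ≡⟨ cong₂ _+_ (sym (Σ∈-* a U _)) (Σ∈-comm-adj adj adj-sym U (λ u → Zₜ (U ∖ u))) ⟩
        a * occupancy U + Σ∈ U (λ u → deg U u * Zₜ (U ∖ u))
          ≤⟨ +-monoʳ-≤ (a * occupancy U) (Σ∈-mono U λ u Uu → *-monoˡ-≤ (Zₜ (U ∖ u)) (h u Uu)) ⟩
        a * occupancy U + Σ∈ U (λ u → Δ * Zₜ (U ∖ u))
          ≡⟨ cong (a * occupancy U +_) (sym (Σ∈-* Δ U _)) ⟩
        a * occupancy U + Δ * occupancy U
          ≡⟨ sym (*-distribʳ-+ (occupancy U) a Δ) ⟩
        (a + Δ) * occupancy U
          ≤⟨ *-monoʳ-≤ (a + Δ) le ⟩
        (a + Δ) * (card W * (t * Zₜ U))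
          ≡⟨ sym (*-assoc (a + Δ) (card W) _) ⟩
        (a + Δ) * card W * (t * Zₜ U) ∎)
      where
      it : NonZero t
      it = >-nonZero (>-nonZero⁻¹ t)
      e : ∀ b c z → b * c * z ≡ b * z * c
      e = solve-∀

-- Constants and scales

-- With b = L / q, the scale r = 2^(16 b) satisfies r¹⁶ ≤ 2^L.
abstract
  q : ℕ
  q = 256

  1≤q : 1 ≤ q
  1≤q = s≤s z≤n

  q≡256 : q ≡ 256
  q≡256 = refl

-- The factor 16 makes `8 * L < 16 * q * b` equal to `κ * b`, the contradiction when a quarter of
-- the vertices are low and sparse.
κ : ℕ
κ = 16 * q

1≤κ : 1 ≤ κ
1≤κ = *-mono-≤ {1} {16} (s≤s z≤n) 1≤q

instance
  κ≢0 : NonZero κ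
  κ≢0 = >-nonZero 1≤κ

-- The number of edges of a clique on `suc j` vertices; the recursion is the one that the passage to
-- a neighbourhood needs.
c : ℕ → ℕ
c zero    = 0
c (suc j) = c j + suc j

-- `A₀` dominates what the Turán bound, the scales and the two induction hypotheses require. `B₀`
-- adds the costs of the two cases: the factor 2 stands for half of the vertices, the factor 4 for a
-- quarter.
A₀ B₀ : ℕ → ℕ
A₀ zero          = 0
A₀ (suc zero)    = 16
A₀ (suc (suc j)) = 16 * κ * (1 + A₀ j + A₀ (suc j))
B₀ zero          = 1
B₀ (suc zero)    = 16
B₀ (suc (suc j)) = 2 * κ ^ suc (suc j) * B₀ (suc j) + 4 * (16 * κ) ^ suc (suc j) * B₀ j

m<1+m/n*n : ∀ m n .{{_ : NonZero n}} → m < suc (m / n) * n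
m<1+m/n*n m n = subst (_< suc (m / n) * n) (sym (m≡m%n+[m/n]*n m n)) (+-monoˡ-< (m / n * n) (m%n<n m n))

m*n≤o⇒m≤o/n : ∀ m n o .{{_ : NonZero n}} → m * n ≤ o → m ≤ o / n
m*n≤o⇒m≤o/n m n o h = subst (_≤ o / n) (m*n/n≡m m n) (/-monoˡ-≤ n h)

n<2^n : ∀ n → n < 2 ^ n
n<2^n zero    = s≤s z≤n
n<2^n (suc n) = ≤-trans (+-mono-≤ (m^n>0 2 n) (n<2^n n)) (≤-reflexive (cong (2 ^ n +_) (sym (+-identityʳ _))))

-- `L < 2 * q * b` keeps `b` of order `L`, `b * 2 ^ (8 * b) ≤ r` will give `a ≤ Δ`, and
-- `L * r ^ 4 ≤ n` pays for the powers of `r` lost in the dense case. The last one holds because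
-- `L ≤ r`, as `2 * q` is `2 ^ 9`, and `r ^ 5` is `2 ^ (80 * b)`, below `2 ^ (q * b)`.
scale : ∀ L n → 2 ^ L ≤ n → q ≤ L →
  ∃₂ λ b r → 1 ≤ b × 1 ≤ r × L < 2 * q * b × L * r ^ 4 ≤ n × b * 2 ^ (8 * b) ≤ r
scale L n 2^L≤n q≤L = b , r , 1≤b , m^n>0 2 (16 * b) , L<2qb , Lr⁴≤n , b2^8b≤r
  where
  open ≤-Reasoning
  instance
    q≢0 : NonZero q
    q≢0 = >-nonZero 1≤q
  b = L / q
  r = 2 ^ (16 * b)
  1≤b : 1 ≤ b
  1≤b = m*n≤o⇒m≤o/n 1 q L (subst (_≤ L) (sym (*-identityˡ q)) q≤L)
  L<2qb : L < 2 * q * b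
  L<2qb = begin-strict
    L              <⟨ m<1+m/n*n L q ⟩
    q + b * q      ≤⟨ +-monoˡ-≤ (b * q) (m≤n*m q b {{>-nonZero 1≤b}}) ⟩
    b * q + b * q  ≡⟨ e b q ⟩
    2 * q * b      ∎
    where
    e : ∀ b q → b * q + b * q ≡ 2 * q * b
    e = solve-∀
  L≤r : L ≤ r
  L≤r = begin
    L              ≤⟨ <⇒≤ L<2qb ⟩
    2 * q * b      ≤⟨ *-mono-≤ (≤-reflexive (trans (cong (2 *_) q≡256) p)) (<⇒≤ (n<2^n b)) ⟩
    2 ^ 9 * 2 ^ b  ≡⟨ sym (^-distribˡ-+-* 2 9 b) ⟩
    2 ^ (9 + b)    ≤⟨ ^-monoʳ-≤ 2 (begin
      9 + b          ≤⟨ +-monoˡ-≤ b (*-monoʳ-≤ 9 1≤b) ⟩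
      9 * b + b      ≡⟨ e b ⟩
      10 * b         ≤⟨ *-monoˡ-≤ b (m≤m+n 10 6) ⟩
      16 * b         ∎) ⟩
    r              ∎
    where
    p : 2 * 256 ≡ 2 ^ 9
    p = refl
    e : ∀ b → 9 * b + b ≡ 10 * b
    e = solve-∀
  Lr⁴≤n : L * r ^ 4 ≤ n
  Lr⁴≤n = begin
    L * r ^ 4           ≤⟨ *-monoˡ-≤ (r ^ 4) L≤r ⟩
    r ^ 5               ≡⟨ ^-*-assoc 2 (16 * b) 5 ⟩
    2 ^ (16 * b * 5)    ≤⟨ ^-monoʳ-≤ 2 (begin
      16 * b * 5          ≤⟨ *-monoʳ-≤ (16 * b) (m≤m+n 5 11) ⟩
      16 * b * 16         ≡⟨ trans (*-comm (16 * b) 16) (sym (*-assoc 16 16 b)) ⟩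
      256 * b             ≡⟨ trans (*-comm 256 b) (cong (b *_) (sym q≡256)) ⟩
      b * q               ≤⟨ m/n*n≤m L q ⟩
      L                   ∎) ⟩
    2 ^ L               ≤⟨ 2^L≤n ⟩
    n                   ∎
  b2^8b≤r : b * 2 ^ (8 * b) ≤ r
  b2^8b≤r = begin
    b * 2 ^ (8 * b)            ≤⟨ *-monoˡ-≤ (2 ^ (8 * b)) (≤-trans (<⇒≤ (n<2^n b)) (^-monoʳ-≤ 2 (m≤n*m b 8))) ⟩
    2 ^ (8 * b) * 2 ^ (8 * b)  ≡⟨ sym (^-distribˡ-+-* 2 (8 * b) (8 * b)) ⟩
    2 ^ (8 * b + 8 * b)        ≡⟨ cong (2 ^_) (sym (*-distribʳ-+ b 8 8)) ⟩
    r                          ∎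

complement : ∀ {N} → Mask N → Mask N
complement P u = not (P u)

card-split : ∀ {N} (D P : Mask N) → card D ≡ card (D ∩ P) + card (D ∩ complement P)
card-split D P = trans (sum-cong-≗ λ u → bool (D u) (P u)) (∑-distrib-+ (λ u → (D ∩ P) u ▹ 1) _)
  where
  bool : ∀ a b → (a ▹ 1) ≡ ((a ∧ b) ▹ 1) + ((a ∧ not b) ▹ 1)
  bool true  true  = refl
  bool true  false = refl
  bool false b     = refl

double : ∀ x → x + x ≡ 2 * x
double = solve-∀

halve : ∀ {N} (D P : Mask N) → card D ≤ 2 * card (D ∩ P) ⊎ card D ≤ 2 * card (D ∩ complement P)
halve D P with ≤-total (card (D ∩ P)) (card (D ∩ complement P))
... | inj₁ h =
  inj₂ (subst₂ _≤_ (sym (card-split D P)) (double (card (D ∩ complement P))) (+-monoˡ-≤ (card (D ∩ complement P)) h))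
... | inj₂ h =
  inj₁ (subst₂ _≤_ (sym (card-split D P)) (double (card (D ∩ P))) (+-monoʳ-≤ (card (D ∩ P)) h))

does-true : ∀ {a} {X : Set a} (X? : Dec X) → does X? ≡ true → X
does-true (yes x) _ = x

does-false : ∀ {a} {X : Set a} (X? : Dec X) → does X? ≡ false → ¬ X
does-false (no ¬x) _ = ¬x

-- Supersaturation of cliques

module Cliques {N} (adj : Adj N) where

  -- T k D counts the k-cliques inside D with an ordering of their vertices.
  T : ℕ → Mask N → ℕ
  T zero    D = 1
  T (suc k) D = Σ∈ D (λ v → T k (D ∩ adj v))

  T-lower : ∀ k {D U} X M → U ⊆ D → (∀ v → U v ≡ true → X ≤ M * T k (D ∩ adj v)) →
    card U * X ≤ M * T (suc k) D
  T-lower k {D} {U} X M U⊆D h = begin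
    card U * X                              ≡⟨ trans (*-comm (card U) X) (sym (Σ∈-const U X)) ⟩
    Σ∈ U (λ _ → X)                          ≤⟨ Σ∈-mono U h ⟩
    Σ∈ U (λ v → M * T k (D ∩ adj v))        ≤⟨ Σ∈-⊆ {D = U} _ U⊆D ⟩
    Σ∈ D (λ v → M * T k (D ∩ adj v))        ≡⟨ sym (Σ∈-* M D _) ⟩
    M * T (suc k) D                         ∎
    where open ≤-Reasoning

module Supersaturation {N} (adj : Adj N) (adj-sym : ∀ u v → adj u v ≡ adj v u)
  (adj-irrefl : ∀ u → adj u u ≡ false) (n L : ℕ) (1≤L : 1 ≤ L) (2^L≤n : 2 ^ L ≤ n) (α≤n : ∀ W → Indep adj W → card W ≤ n) where

  open Graphs adj adj-sym adj-irrefl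
  open Cliques adj
  open ≤-Reasoning

  L≤n : L ≤ n
  L≤n = ≤-trans (<⇒≤ (n<2^n L)) 2^L≤n

  1≤n : 1 ≤ n
  1≤n = ≤-trans 1≤L L≤n

  instance
    L≢0 : NonZero L
    L≢0 = >-nonZero 1≤L
    n≢0 : NonZero n
    n≢0 = >-nonZero 1≤n

  -- `turan` gives `x ≤ 4 n + 2 Δ n`. The first summand is at most `x / 4` by `16 * n ≤ x`, the
  -- second at most `2 x ℓ / K ≤ x / 4`.
  not-all-low : ∀ U ℓ K Δ x → (∀ v → U v ≡ true → deg U v ≤ Δ) → K * n * Δ ≤ x * ℓ → 8 * ℓ ≤ K →
    x ≤ 2 * card U → 16 * n ≤ x → 1 ≤ K → ¬ (1 ≤ x)
  not-all-low U ℓ K Δ x low KnΔ 8ℓ≤K x≤2U 16n≤x 1≤K 1≤x = <-irrefl refl (begin-strict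
    2 * (K * x)
      <⟨ *-monoˡ-< (K * x) {{>-nonZero (*-mono-≤ 1≤K 1≤x)}} (m≤m+n 3 1) ⟩
    4 * (K * x)
      ≤⟨ *-monoʳ-≤ 4 (*-monoʳ-≤ K (≤-trans x≤2U (*-monoʳ-≤ 2 U≤))) ⟩
    4 * (K * (2 * ((2 + Δ) * n)))
      ≡⟨ e₁ K n Δ ⟩
    K * (16 * n) + 8 * (K * n * Δ)
      ≤⟨ +-mono-≤ (*-monoʳ-≤ K 16n≤x)
           (≤-trans (*-monoʳ-≤ 8 KnΔ) (≤-trans (≤-reflexive (e₂ x ℓ)) (*-monoʳ-≤ x 8ℓ≤K))) ⟩
    K * x + x * K
      ≡⟨ e₃ K x ⟩
    2 * (K * x) ∎)
    where
    U≤ : card U ≤ (2 + Δ) * n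
    U≤ = let W , _ , ind , le = turan U Δ low in ≤-trans le (*-monoʳ-≤ (2 + Δ) (α≤n W ind))
    e₁ : ∀ K n Δ → 4 * (K * (2 * ((2 + Δ) * n))) ≡ K * (16 * n) + 8 * (K * n * Δ)
    e₁ = solve-∀
    e₂ : ∀ x ℓ → 8 * (x * ℓ) ≡ x * (8 * ℓ)
    e₂ = solve-∀
    e₃ : ∀ K x → K * x + x * K ≡ 2 * (K * x)
    e₃ = solve-∀

  deg-⊆ : ∀ {D E} v → D ⊆ E → deg D v ≤ deg E v
  deg-⊆ {D} v D⊆E = card-⊆ {D = D ∩ adj v} λ u h → let p , r = ∧-true h in ∧-intro (D⊆E u p) r

  -- A dichotomy on the threshold x ℓ ≤ K n (deg v), with Δ the largest degree below it.
  module Threshold (D : Mask N) (ℓ K : ℕ) .{{_ : NonZero K}} where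
    x = card D
    instance
      Kn≢0 : NonZero (K * n)
      Kn≢0 = m*n≢0 K n
    Δ = x * ℓ / (K * n)
    high : Mask N
    high v = does (x * ℓ ≤? K * n * deg D v)

    KnΔ≤ : K * n * Δ ≤ x * ℓ
    KnΔ≤ = subst (_≤ x * ℓ) (*-comm Δ (K * n)) (m/n*n≤m (x * ℓ) (K * n))

    <KnΔ : x * ℓ < K * n * suc Δ
    <KnΔ = subst (x * ℓ <_) (*-comm (suc Δ) (K * n)) (m<1+m/n*n (x * ℓ) (K * n))

    high-deg : ∀ v → (D ∩ high) v ≡ true → x * ℓ ≤ K * n * deg D v
    high-deg v h = does-true (x * ℓ ≤? K * n * deg D v) (proj₂ (∧-true {D v} h))

    low-deg : ∀ v → (D ∩ complement high) v ≡ true → deg D v ≤ Δ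
    low-deg v h = m*n≤o⇒m≤o/n (deg D v) (K * n) (x * ℓ) (subst (_≤ x * ℓ) (*-comm (K * n) _)
      (<⇒≤ (≰⇒> (does-false (x * ℓ ≤? K * n * deg D v) (not-true (proj₂ (∧-true {D v} h)))))))

    few-low : 8 * ℓ ≤ K → 16 * n ≤ x → ¬ (card D ≤ 2 * card (D ∩ complement high))
    few-low 8ℓ≤K 16n≤x h = not-all-low (D ∩ complement high) ℓ K Δ x
      (λ v p → ≤-trans (deg-⊆ v (∩-⊆ˡ D (complement high))) (low-deg v p))
      KnΔ≤ 8ℓ≤K h 16n≤x (>-nonZero⁻¹ K) (≤-trans (≤-trans 1≤n (m≤n*m n 16)) 16n≤x)

  -- In the hypothesis the factor `L` on the left avoids the exponent `j - 1`; in the conclusion it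
  -- is the loss of one logarithm. The bound `n` on independent sets holds in every `D`, so the
  -- claim can be applied inside neighbourhoods.
  Claim : ℕ → Set
  Claim j = ∀ D → A₀ j * n ^ j * L ≤ card D * L ^ j →
    card D ^ suc j * L ^ c j ≤ B₀ j * T (suc j) D * n ^ c j * L

  claim₀ : Claim 0
  claim₀ D _ = ≤-trans (≤-reflexive (e (card D))) (m≤m*n _ L)
    where
    e : ∀ x → x * 1 * 1 ≡ 1 * x * 1
    e = solve-∀

  -- `L` cancels from both sides: with `x` only of order `n` the Turán bound is all there is, and
  -- the logarithm lost here is carried through the induction.
  claim₁ : Claim 1
  claim₁ D hyp = by-cases (halve D high)
    where
    open Threshold D 1 8
    16n≤x : 16 * n ≤ x
    16n≤x = *-cancelʳ-≤ (16 * n) x L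
      (subst₂ _≤_ (cong (λ z → 16 * z * L) (*-identityʳ n)) (cong (x *_) (*-identityʳ L)) hyp)
    by-cases : card D ≤ 2 * card (D ∩ high) ⊎ card D ≤ 2 * card (D ∩ complement high) →
      x ^ 2 * L ^ 1 ≤ 16 * T 2 D * n ^ 1 * L
    by-cases (inj₂ h) = contradiction h (few-low ≤-refl 16n≤x)
    by-cases (inj₁ h) = begin
      x ^ 2 * L ^ 1                      ≡⟨ e₁ x L ⟩
      x * (x * 1) * L                    ≤⟨ *-monoˡ-≤ L (*-monoˡ-≤ (x * 1) h) ⟩
      2 * card (D ∩ high) * (x * 1) * L  ≡⟨ cong (_* L) (*-assoc 2 (card (D ∩ high)) (x * 1)) ⟩
      2 * (card (D ∩ high) * (x * 1)) * L
        ≤⟨ *-monoˡ-≤ L (*-monoʳ-≤ 2 (T-lower 1 (x * 1) (8 * n) (∩-⊆ˡ D high) high-deg)) ⟩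
      2 * (8 * n * T 2 D) * L            ≡⟨ e₂ n (T 2 D) L ⟩
      16 * T 2 D * n ^ 1 * L             ∎
      where
      e₁ : ∀ x L → x * (x * 1) * (L * 1) ≡ x * (x * 1) * L
      e₁ = solve-∀
      e₂ : ∀ n T L → 2 * (8 * n * T) * L ≡ 16 * T * (n * 1) * L
      e₂ = solve-∀

  module InductionStep (j : ℕ) (IH₀ : Claim j) (IH₁ : Claim (suc j)) (D : Mask N)
    (hyp : A₀ (2 + j) * n ^ (2 + j) * L ≤ card D * L ^ (2 + j)) where

    open Threshold D L κ

    A A₁ A₂ B₁ B₂ : ℕ
    A  = A₀ (2 + j)
    A₁ = A₀ j
    A₂ = A₀ (suc j)
    B₁ = B₀ j
    B₂ = B₀ (suc j)

    1≤16κ : 1 ≤ 16 * κ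
    1≤16κ = ≤-trans 1≤κ (m≤n*m κ 16)

    A≥16 : 16 ≤ A
    A≥16 = ≤-trans (m≤m*n 16 κ) (m≤m*n (16 * κ) (1 + A₁ + A₂))

    A≥2κ : 2 * κ ≤ A
    A≥2κ = ≤-trans (*-monoˡ-≤ κ (m≤m+n 2 14)) (m≤m*n (16 * κ) (1 + A₁ + A₂))

    A≥16κA₁ : 16 * κ * A₁ ≤ A
    A≥16κA₁ = *-monoʳ-≤ (16 * κ) (≤-trans (n≤1+n A₁) (m≤m+n (1 + A₁) A₂))

    A≥κA₂ : κ * A₂ ≤ A
    A≥κA₂ = *-mono-≤ (m≤n*m κ 16) (m≤n+m A₂ (1 + A₁))

    hyp′ : A * n ^ (2 + j) ≤ x * L * L ^ j
    hyp′ = *-cancelʳ-≤ _ _ L (≤-trans hyp (≤-reflexive (e x L (L ^ j))))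
      where
      e : ∀ x L l → x * (L * (L * l)) ≡ x * L * l * L
      e = solve-∀

    An²≤xL : A * (n * n) ≤ x * L
    An²≤xL = *-cancelʳ-≤ _ _ (n ^ j) {{m^n≢0 n j}} (begin
      A * (n * n) * n ^ j   ≡⟨ e A n (n ^ j) ⟩
      A * n ^ (2 + j)       ≤⟨ hyp′ ⟩
      x * L * L ^ j         ≤⟨ *-monoʳ-≤ (x * L) (^-monoˡ-≤ j L≤n) ⟩
      x * L * n ^ j         ∎)
      where
      e : ∀ A n m → A * (n * n) * m ≡ A * (n * (n * m))
      e = solve-∀

    16n≤x : 16 * n ≤ x
    16n≤x = *-cancelʳ-≤ _ _ n (begin
      16 * n * n    ≡⟨ *-assoc 16 n n ⟩
      16 * (n * n)  ≤⟨ *-monoˡ-≤ (n * n) A≥16 ⟩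
      A * (n * n)   ≤⟨ An²≤xL ⟩
      x * L         ≤⟨ *-monoʳ-≤ x L≤n ⟩
      x * n         ∎)

    Goal : Set
    Goal = x ^ (3 + j) * L ^ c (2 + j) ≤ B₀ (2 + j) * T (3 + j) D * n ^ c (2 + j) * L

    -- The exponents fit exactly: each of the `2 + j` clique vertices chosen inside the
    -- neighbourhood pays one factor `L / n` for adjacency to the first, and `c (2 + j)` is
    -- `c (suc j) + (2 + j)`.
    many-high : x ≤ 2 * card (D ∩ high) → Goal
    many-high h = begin
      x * x ^ (2 + j) * L ^ c (2 + j)
        ≤⟨ *-monoˡ-≤ (L ^ c (2 + j)) (*-monoˡ-≤ (x ^ (2 + j)) h) ⟩
      2 * card (D ∩ high) * x ^ (2 + j) * L ^ c (2 + j)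
        ≡⟨ e₁ (card (D ∩ high)) (x ^ (2 + j)) (L ^ c (2 + j)) ⟩
      2 * (card (D ∩ high) * (x ^ (2 + j) * L ^ c (2 + j)))
        ≤⟨ *-monoʳ-≤ 2 (T-lower (2 + j) _ (κ ^ (2 + j) * n ^ (2 + j) * (B₂ * n ^ c (suc j) * L))
             (∩-⊆ˡ D high) per-vertex) ⟩
      2 * (κ ^ (2 + j) * n ^ (2 + j) * (B₂ * n ^ c (suc j) * L) * T (3 + j) D)
        ≡⟨ e₂ (κ ^ (2 + j)) (n ^ (2 + j)) B₂ (n ^ c (suc j)) L (T (3 + j) D) ⟩
      2 * κ ^ (2 + j) * B₂ * T (3 + j) D * (n ^ c (suc j) * n ^ (2 + j)) * L
        ≡⟨ cong (λ z → 2 * κ ^ (2 + j) * B₂ * T (3 + j) D * z * L) (sym (^-distribˡ-+-* n (c (suc j)) (2 + j))) ⟩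
      2 * κ ^ (2 + j) * B₂ * T (3 + j) D * n ^ c (2 + j) * L
        ≤⟨ *-monoˡ-≤ L (*-monoˡ-≤ (n ^ c (2 + j)) (*-monoˡ-≤ (T (3 + j) D)
             (m≤m+n (2 * κ ^ (2 + j) * B₂) (4 * (16 * κ) ^ (2 + j) * B₁)))) ⟩
      B₀ (2 + j) * T (3 + j) D * n ^ c (2 + j) * L ∎
      where
      e₁ : ∀ a b d → 2 * a * b * d ≡ 2 * (a * (b * d))
      e₁ = solve-∀
      e₂ : ∀ a m b k L T → 2 * (a * m * (b * k * L) * T) ≡ 2 * a * b * T * (k * m) * L
      e₂ = solve-∀
      per-vertex : ∀ v → (D ∩ high) v ≡ true →
        x ^ (2 + j) * L ^ c (2 + j) ≤ κ ^ (2 + j) * n ^ (2 + j) * (B₂ * n ^ c (suc j) * L) * T (2 + j) (D ∩ adj v)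
      per-vertex v hv = begin
        x ^ (2 + j) * L ^ c (2 + j)
          ≡⟨ cong (x ^ (2 + j) *_) (^-distribˡ-+-* L (c (suc j)) (2 + j)) ⟩
        x ^ (2 + j) * (L ^ c (suc j) * L ^ (2 + j))
          ≡⟨ e₃ (x ^ (2 + j)) (L ^ c (suc j)) (L ^ (2 + j)) ⟩
        x ^ (2 + j) * L ^ (2 + j) * L ^ c (suc j)
          ≡⟨ cong (_* L ^ c (suc j)) (sym (pow-*-distrib x L (2 + j))) ⟩
        (x * L) ^ (2 + j) * L ^ c (suc j)
          ≤⟨ *-monoˡ-≤ (L ^ c (suc j)) (^-monoˡ-≤ (2 + j) (high-deg v hv)) ⟩
        (κ * n * d) ^ (2 + j) * L ^ c (suc j)
          ≡⟨ cong (_* L ^ c (suc j)) (trans (pow-*-distrib (κ * n) d (2 + j))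
               (cong (_* d ^ (2 + j)) (pow-*-distrib κ n (2 + j)))) ⟩
        κ ^ (2 + j) * n ^ (2 + j) * d ^ (2 + j) * L ^ c (suc j)
          ≡⟨ *-assoc (κ ^ (2 + j) * n ^ (2 + j)) (d ^ (2 + j)) (L ^ c (suc j)) ⟩
        κ ^ (2 + j) * n ^ (2 + j) * (d ^ (2 + j) * L ^ c (suc j))
          ≤⟨ *-monoʳ-≤ (κ ^ (2 + j) * n ^ (2 + j)) (IH₁ (D ∩ adj v) hypᵥ) ⟩
        κ ^ (2 + j) * n ^ (2 + j) * (B₂ * T (2 + j) (D ∩ adj v) * n ^ c (suc j) * L)
          ≡⟨ e₄ (κ ^ (2 + j) * n ^ (2 + j)) B₂ (T (2 + j) (D ∩ adj v)) (n ^ c (suc j)) L ⟩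
        κ ^ (2 + j) * n ^ (2 + j) * (B₂ * n ^ c (suc j) * L) * T (2 + j) (D ∩ adj v) ∎
        where
        d = deg D v
        e₃ : ∀ a b d → a * (b * d) ≡ a * d * b
        e₃ = solve-∀
        e₄ : ∀ a b t k L → a * (b * t * k * L) ≡ a * (b * k * L) * t
        e₄ = solve-∀
        -- Up to constants, passing to the neighbourhood of a high vertex divides the number of
        -- vertices by at most `n / L`, which is also the ratio of consecutive thresholds.
        hypᵥ : A₂ * n ^ suc j * L ≤ d * L ^ suc j
        hypᵥ = *-cancelˡ-≤ (κ * n) (begin
          κ * n * (A₂ * n ^ suc j * L)  ≡⟨ e₅ κ n A₂ (n ^ j) L ⟩
          κ * A₂ * n ^ (2 + j) * L      ≤⟨ *-monoˡ-≤ L (*-monoˡ-≤ (n ^ (2 + j)) A≥κA₂) ⟩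
          A * n ^ (2 + j) * L           ≤⟨ hyp ⟩
          x * L ^ (2 + j)               ≡⟨ sym (*-assoc x L (L ^ suc j)) ⟩
          x * L * L ^ suc j             ≤⟨ *-monoˡ-≤ (L ^ suc j) (high-deg v hv) ⟩
          κ * n * d * L ^ suc j         ≡⟨ *-assoc (κ * n) d (L ^ suc j) ⟩
          κ * n * (d * L ^ suc j)       ∎)
          where
          e₅ : ∀ κ n a m L → κ * n * (a * (n * m) * L) ≡ κ * a * (n * (n * m)) * L
          e₅ = solve-∀

    -- For n large, r is a small power of n, and the other scales are Δ ≈ x L / (κ n), s ≈ Δ / (2 r) and g ≈ s / r.
    module Large (b r : ℕ) (1≤b : 1 ≤ b) (1≤r : 1 ≤ r) (L<2qb : L < 2 * q * b)
      (Lr⁴≤n : L * r ^ 4 ≤ n) (b2^8b≤r : b * 2 ^ (8 * b) ≤ r) where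

      instance
        b≢0 : NonZero b
        b≢0 = >-nonZero 1≤b
        r≢0 : NonZero r
        r≢0 = >-nonZero 1≤r
        2r≢0 : NonZero (2 * r)
        2r≢0 = m*n≢0 2 r

      s g : ℕ
      s = Δ / (2 * r)
      g = s / r

      Lr²≤n : L * (r * r) ≤ n
      Lr²≤n = ≤-trans (*-monoʳ-≤ L (≤-trans (m≤m*n (r * r) (r * r) {{m*n≢0 r r}}) (≤-reflexive (e r)))) Lr⁴≤n
        where
        e : ∀ r → r * r * (r * r) ≡ r * (r * (r * (r * 1)))
        e = solve-∀

      2n≤Δ : 2 * n ≤ Δ
      2n≤Δ = s≤s⁻¹ (*-cancelˡ-< (κ * n) (2 * n) (suc Δ) (begin-strict
        κ * n * (2 * n)    ≡⟨ e κ n ⟩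
        2 * κ * (n * n)    ≤⟨ *-monoˡ-≤ (n * n) A≥2κ ⟩
        A * (n * n)        ≤⟨ An²≤xL ⟩
        x * L              <⟨ <KnΔ ⟩
        κ * n * suc Δ      ∎))
        where
        e : ∀ κ n → κ * n * (2 * n) ≡ 2 * κ * (n * n)
        e = solve-∀

      r≤s : r ≤ s
      r≤s = m*n≤o⇒m≤o/n r (2 * r) Δ (begin
        r * (2 * r)       ≡⟨ e r ⟩
        2 * (r * r)       ≤⟨ *-monoʳ-≤ 2 (≤-trans (m≤n*m (r * r) L) Lr²≤n) ⟩
        2 * n             ≤⟨ 2n≤Δ ⟩
        Δ                 ∎)
        where
        e : ∀ r → r * (2 * r) ≡ 2 * (r * r)
        e = solve-∀

      1≤s : 1 ≤ s
      1≤s = ≤-trans 1≤r r≤s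

      1≤g : 1 ≤ g
      1≤g = m*n≤o⇒m≤o/n 1 r s (≤-trans (≤-reflexive (*-identityˡ r)) r≤s)

      instance
        s≢0 : NonZero s
        s≢0 = >-nonZero 1≤s

      2sr≤Δ : 2 * s * r ≤ Δ
      2sr≤Δ = ≤-trans (≤-reflexive (e s r)) (m/n*n≤m Δ (2 * r))
        where
        e : ∀ s r → 2 * s * r ≡ s * (2 * r)
        e = solve-∀

      Δ≤4rs : Δ ≤ 4 * r * s
      Δ≤4rs = begin
        Δ                     ≤⟨ <⇒≤ (m<1+m/n*n Δ (2 * r)) ⟩
        suc s * (2 * r)       ≤⟨ *-monoˡ-≤ (2 * r) (+-monoˡ-≤ s 1≤s) ⟩
        (s + s) * (2 * r)     ≡⟨ e s r ⟩
        4 * r * s             ∎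
        where
        e : ∀ s r → (s + s) * (2 * r) ≡ 4 * r * s
        e = solve-∀

      rg≤s : r * g ≤ s
      rg≤s = ≤-trans (≤-reflexive (*-comm r g)) (m/n*n≤m s r)

      s≤2rg : s ≤ 2 * r * g
      s≤2rg = begin
        s             ≤⟨ <⇒≤ (m<1+m/n*n s r) ⟩
        suc g * r     ≤⟨ *-monoˡ-≤ r (+-monoˡ-≤ g 1≤g) ⟩
        (g + g) * r   ≡⟨ e g r ⟩
        2 * r * g     ∎
        where
        e : ∀ g r → (g + g) * r ≡ 2 * r * g
        e = solve-∀

      xL≤g : x * L ≤ 16 * κ * (n * (r * r * g))
      xL≤g = begin
        x * L                          ≤⟨ <⇒≤ <KnΔ ⟩
        κ * n * suc Δ                  ≤⟨ *-monoʳ-≤ (κ * n) (+-monoˡ-≤ Δ (≤-trans 1≤n (≤-trans (m≤n*m n 2) 2n≤Δ))) ⟩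
        κ * n * (Δ + Δ)                ≤⟨ *-monoʳ-≤ (κ * n) (+-mono-≤ Δ≤ Δ≤) ⟩
        κ * n * (4 * r * (2 * r * g) + 4 * r * (2 * r * g)) ≡⟨ e κ n r g ⟩
        16 * κ * (n * (r * r * g))     ∎
        where
        Δ≤ : Δ ≤ 4 * r * (2 * r * g)
        Δ≤ = ≤-trans Δ≤4rs (*-monoʳ-≤ (4 * r) s≤2rg)
        e : ∀ κ n r g → κ * n * (4 * r * (2 * r * g) + 4 * r * (2 * r * g)) ≡ 16 * κ * (n * (r * r * g))
        e = solve-∀

      -- The threshold falls by `(n / L)²` over two steps, whereas `g` is smaller than `x` by about
      -- `n r² / L`; `Lr²≤n` compares the two.
      hyp-g : A₁ * n ^ j * L ≤ g * L ^ j
      hyp-g = *-cancelˡ-≤ (16 * κ * (n * (r * r)))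
        {{>-nonZero (*-mono-≤ 1≤16κ (*-mono-≤ 1≤n (*-mono-≤ 1≤r 1≤r)))}} (begin
        16 * κ * (n * (r * r)) * (A₁ * n ^ j * L)    ≡⟨ e₁ κ n r A₁ (n ^ j) L ⟩
        16 * κ * A₁ * (n * (L * (r * r) * n ^ j))    ≤⟨ *-mono-≤ A≥16κA₁ (*-monoʳ-≤ n (*-monoˡ-≤ (n ^ j) Lr²≤n)) ⟩
        A * n ^ (2 + j)                              ≤⟨ hyp′ ⟩
        x * L * L ^ j                                ≤⟨ *-monoˡ-≤ (L ^ j) xL≤g ⟩
        16 * κ * (n * (r * r * g)) * L ^ j           ≡⟨ e₂ κ n r g (L ^ j) ⟩
        16 * κ * (n * (r * r)) * (g * L ^ j)         ∎)
        where
        e₁ : ∀ κ n r a m L → 16 * κ * (n * (r * r)) * (a * m * L) ≡ 16 * κ * a * (n * (L * (r * r) * m))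
        e₁ = solve-∀
        e₂ : ∀ κ n r g l → 16 * κ * (n * (r * r * g)) * l ≡ 16 * κ * (n * (r * r)) * (g * l)
        e₂ = solve-∀

      -- With `suc t` equal to `2 * s`, this is the sparsity bound of `locally-sparse`.
      E : ℕ
      E = 2 * b * (2 * s * (2 * s))

      nbr-edges : Fin N → ℕ
      nbr-edges v = Σ∈ (D ∩ adj v) (deg (D ∩ adj v))

      low sparse : Mask N
      low = D ∩ complement high
      sparse v = does (nbr-edges v ≤? E)

      -- `locally-sparse` bounds `b * card U` by `2 Δ n`, that is by about `2 x L / κ`, and `b` is
      -- too large a fraction of `L` for a quarter of the vertices to satisfy this.
      few-sparse : ¬ (x ≤ 4 * card (low ∩ sparse))
      few-sparse h = <-irrefl refl (begin-strict
        κ * (b * x)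
          ≤⟨ *-monoʳ-≤ κ (*-monoʳ-≤ b h) ⟩
        κ * (b * (4 * card U))
          ≡⟨ e₁ κ b (card U) ⟩
        4 * κ * (b * card U)
          ≤⟨ *-monoʳ-≤ (4 * κ) independent ⟩
        4 * κ * ((Δ + Δ) * n)
          ≡⟨ e₂ κ Δ n ⟩
        8 * (κ * n * Δ)
          ≤⟨ *-monoʳ-≤ 8 KnΔ≤ ⟩
        8 * (x * L)
          <⟨ *-monoʳ-< 8 (*-monoʳ-< x {{>-nonZero (≤-trans 1≤n (≤-trans (m≤n*m n 16) 16n≤x))}} L<2qb) ⟩
        8 * (x * (2 * q * b))
          ≡⟨ e₃ q x b ⟩
        κ * (b * x) ∎)
        where
        U = low ∩ sparse
        e₁ : ∀ κ b u → κ * (b * (4 * u)) ≡ 4 * κ * (b * u)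
        e₁ = solve-∀
        e₂ : ∀ κ Δ n → 4 * κ * ((Δ + Δ) * n) ≡ 8 * (κ * n * Δ)
        e₂ = solve-∀
        e₃ : ∀ q x b → 8 * (x * (2 * q * b)) ≡ 16 * q * (b * x)
        e₃ = solve-∀
        -- This is `2 * s - 1`: of order `Δ / r`, small enough for `a ≤ Δ`, and odd so that `suc t`
        -- is twice an integer.
        t = suc (2 * pred s)
        1+t≡2s : suc t ≡ 2 * s
        1+t≡2s = trans (e₄ (pred s)) (cong (2 *_) (suc-pred s))
          where
          e₄ : ∀ p → suc (suc (2 * p)) ≡ 2 * suc p
          e₄ = solve-∀
        open LocallySparse t s b 1+t≡2s
        U⊆D : U ⊆ D
        U⊆D v p = proj₁ (∧-true (proj₁ (∧-true {low v} p)))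
        a≤Δ : a ≤ Δ
        a≤Δ = begin
          b * (t * 2 ^ (8 * b) + 1)             ≤⟨ *-monoʳ-≤ b (+-monoʳ-≤ (t * 2 ^ (8 * b)) (m^n>0 2 (8 * b))) ⟩
          b * (t * 2 ^ (8 * b) + 2 ^ (8 * b))   ≡⟨ e₅ b t (2 ^ (8 * b)) ⟩
          suc t * (b * 2 ^ (8 * b))             ≤⟨ *-mono-≤ (≤-reflexive 1+t≡2s) b2^8b≤r ⟩
          2 * s * r                             ≤⟨ 2sr≤Δ ⟩
          Δ                                     ∎
          where
          e₅ : ∀ b t p → b * (t * p + p) ≡ suc t * (b * p)
          e₅ = solve-∀
        independent : b * card U ≤ (Δ + Δ) * n
        independent =
          let W , _ , ind , le = locally-sparse U Δ
                (λ v p → ≤-trans (deg-⊆ v U⊆D) (low-deg v (proj₁ (∧-true {low v} p))))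
                (λ v p → begin
                  Σ∈ (U ∩ adj v) (deg (U ∩ adj v))
                    ≤⟨ Σ∈-mono (U ∩ adj v) (λ u _ → deg-⊆ u (nbr-⊆ v)) ⟩
                  Σ∈ (U ∩ adj v) (deg (D ∩ adj v))
                    ≤⟨ Σ∈-⊆ {D = U ∩ adj v} _ (nbr-⊆ v) ⟩
                  nbr-edges v
                    ≤⟨ does-true (nbr-edges v ≤? E) (proj₂ (∧-true {low v} p)) ⟩
                  2 * b * (2 * s * (2 * s))
                    ≡⟨ cong (λ z → 2 * b * (z * z)) (sym 1+t≡2s) ⟩
                  2 * b * (suc t * suc t) ∎)
          in ≤-trans le (*-mono-≤ (+-monoˡ-≤ Δ a≤Δ) (α≤n W ind))
          where
          nbr-⊆ : ∀ v → U ∩ adj v ⊆ D ∩ adj v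
          nbr-⊆ v u h = let p , r = ∧-true h in ∧-intro (U⊆D u p) r

      -- A degree sum above `E` among at most `Δ` neighbours forces `g` of them to have `g`
      -- neighbours inside the neighbourhood. This replaces an edge count by sets large enough for
      -- `IH₀`.
      dense-vertex : ∀ v → (low ∩ complement sparse) v ≡ true →
        g * (g ^ suc j * L ^ c j) ≤ B₁ * n ^ c j * L * T (2 + j) (D ∩ adj v)
      dense-vertex v hv = begin
        g * (g ^ suc j * L ^ c j)
          ≤⟨ *-monoˡ-≤ (g ^ suc j * L ^ c j) g≤G ⟩
        card (Y ∩ good) * (g ^ suc j * L ^ c j)
          ≤⟨ T-lower (suc j) _ (B₁ * n ^ c j * L) (∩-⊆ˡ Y good) per-edge ⟩
        B₁ * n ^ c j * L * T (2 + j) Y ∎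
        where
        Y = D ∩ adj v
        good : Mask N
        good u = does (g ≤? deg Y u)
        Y≤Δ : card Y ≤ Δ
        Y≤Δ = low-deg v (proj₁ (∧-true {low v} hv))
        per-edge : ∀ u → (Y ∩ good) u ≡ true →
          g ^ suc j * L ^ c j ≤ B₁ * n ^ c j * L * T (suc j) (Y ∩ adj u)
        per-edge u hu = begin
          g ^ suc j * L ^ c j
            ≤⟨ *-monoˡ-≤ (L ^ c j) (^-monoˡ-≤ (suc j) g≤) ⟩
          deg Y u ^ suc j * L ^ c j
            ≤⟨ IH₀ (Y ∩ adj u) (≤-trans hyp-g (*-monoˡ-≤ (L ^ j) g≤)) ⟩
          B₁ * T (suc j) (Y ∩ adj u) * n ^ c j * L
            ≡⟨ e B₁ (T (suc j) (Y ∩ adj u)) (n ^ c j) L ⟩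
          B₁ * n ^ c j * L * T (suc j) (Y ∩ adj u) ∎
          where
          g≤ : g ≤ deg Y u
          g≤ = does-true (g ≤? deg Y u) (proj₂ (∧-true {Y u} hu))
          e : ∀ b t m L → b * t * m * L ≡ b * m * L * t
          e = solve-∀
        codegrees : nbr-edges v ≤ Δ * card (Y ∩ good) + g * Δ
        codegrees = begin
          Σ∈ Y (deg Y)
            ≤⟨ sum-mono (λ u → pointwise u (Y u) (does-≤ u)) ⟩
          sum (λ u → ((Y ∩ good) u ▹ Δ) + (Y u ▹ g))
            ≡⟨ ∑-distrib-+ (λ u → (Y ∩ good) u ▹ Δ) _ ⟩
          Σ∈ (Y ∩ good) (λ _ → Δ) + Σ∈ Y (λ _ → g)
            ≡⟨ cong₂ _+_ (Σ∈-const (Y ∩ good) Δ) (Σ∈-const Y g) ⟩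
          Δ * card (Y ∩ good) + g * card Y
            ≤⟨ +-monoʳ-≤ (Δ * card (Y ∩ good)) (*-monoʳ-≤ g Y≤Δ) ⟩
          Δ * card (Y ∩ good) + g * Δ ∎
          where
          does-≤ : ∀ u → good u ≡ true ⊎ deg Y u ≤ g × good u ≡ false
          does-≤ u with good u in e
          ... | true  = inj₁ refl
          ... | false = inj₂ (<⇒≤ (≰⇒> (does-false (g ≤? deg Y u) e)) , refl)
          pointwise : ∀ u y → good u ≡ true ⊎ deg Y u ≤ g × good u ≡ false →
            (y ▹ deg Y u) ≤ ((y ∧ good u) ▹ Δ) + (y ▹ g)
          pointwise u false _ = z≤n
          pointwise u true (inj₁ e) rewrite e = ≤-trans (≤-trans (card-⊆ (∩-⊆ˡ Y (adj u))) Y≤Δ) (m≤m+n Δ g)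
          pointwise u true (inj₂ (h , e)) rewrite e = h
        -- The degree sum exceeds `8 s²`. A good vertex contributes at most `Δ ≤ 4 r s`, and the
        -- others together at most `g Δ ≤ 4 s²`. Thus `r * card (Y ∩ good)` exceeds `s`, which is at
        -- least `r * g`.
        g≤G : g ≤ card (Y ∩ good)
        g≤G = <⇒≤ (*-cancelˡ-< r g (card (Y ∩ good)) (≤-<-trans rg≤s (*-cancelˡ-< (4 * s) s (r * card (Y ∩ good))
          (+-cancelʳ-< (4 * s * s) (4 * s * s) (4 * s * (r * card (Y ∩ good))) (begin-strict
            4 * s * s + 4 * s * s
              ≡⟨ e₁ s ⟩
            2 * 1 * (2 * s * (2 * s))
              ≤⟨ *-monoˡ-≤ (2 * s * (2 * s)) (*-monoʳ-≤ 2 1≤b) ⟩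
            E
              <⟨ ≰⇒> (does-false (nbr-edges v ≤? E) (not-true (proj₂ (∧-true {low v} hv)))) ⟩
            nbr-edges v
              ≤⟨ codegrees ⟩
            Δ * card (Y ∩ good) + g * Δ
              ≤⟨ +-mono-≤ (*-monoˡ-≤ (card (Y ∩ good)) Δ≤4rs) (*-monoʳ-≤ g Δ≤4rs) ⟩
            4 * r * s * card (Y ∩ good) + g * (4 * r * s)
              ≡⟨ e₂ r s g (card (Y ∩ good)) ⟩
            4 * s * (r * card (Y ∩ good)) + 4 * s * (r * g)
              ≤⟨ +-monoʳ-≤ (4 * s * (r * card (Y ∩ good))) (*-monoʳ-≤ (4 * s) rg≤s) ⟩
            4 * s * (r * card (Y ∩ good)) + 4 * s * s    ∎)))))
          where
          instance
            4s≢0 : NonZero (4 * s)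
            4s≢0 = m*n≢0 4 s
          e₁ : ∀ s → 4 * s * s + 4 * s * s ≡ 2 * 1 * (2 * s * (2 * s))
          e₁ = solve-∀
          e₂ : ∀ r s g k → 4 * r * s * k + g * (4 * r * s) ≡ 4 * s * (r * k) + 4 * s * (r * g)
          e₂ = solve-∀

      g-large : x ^ (2 + j) * (L ^ suc j * L ^ (2 + j)) ≤ (16 * κ) ^ (2 + j) * g ^ (2 + j) * (n ^ suc j * n ^ (2 + j))
      g-large = begin
        x ^ (2 + j) * (L ^ suc j * L ^ (2 + j))
          ≡⟨ e₁ (x ^ (2 + j)) (L ^ suc j) (L ^ (2 + j)) ⟩
        x ^ (2 + j) * L ^ (2 + j) * L ^ suc j
          ≡⟨ cong (_* L ^ suc j) (sym (pow-*-distrib x L (2 + j))) ⟩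
        (x * L) ^ (2 + j) * L ^ suc j
          ≤⟨ *-monoˡ-≤ (L ^ suc j) (^-monoˡ-≤ (2 + j) xL≤g) ⟩
        (16 * κ * (n * (r * r * g))) ^ (2 + j) * L ^ suc j
          ≡⟨ cong (_* L ^ suc j) (trans (pow-*-distrib (16 * κ) _ (2 + j)) (cong ((16 * κ) ^ (2 + j) *_)
               (trans (pow-*-distrib n _ (2 + j)) (cong (n ^ (2 + j) *_) (pow-*-distrib (r * r) g (2 + j)))))) ⟩
        (16 * κ) ^ (2 + j) * (n ^ (2 + j) * ((r * r) ^ (2 + j) * g ^ (2 + j))) * L ^ suc j
          ≡⟨ e₂ ((16 * κ) ^ (2 + j)) (n ^ (2 + j)) ((r * r) ^ (2 + j)) (g ^ (2 + j)) (L ^ suc j) ⟩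
        (16 * κ) ^ (2 + j) * g ^ (2 + j) * (L ^ suc j * (r * r) ^ (2 + j) * n ^ (2 + j))
          ≤⟨ *-monoʳ-≤ ((16 * κ) ^ (2 + j) * g ^ (2 + j)) (*-monoˡ-≤ (n ^ (2 + j)) (begin
               L ^ suc j * (r * r) ^ (2 + j)   ≤⟨ *-monoʳ-≤ (L ^ suc j) r-power ⟩
               L ^ suc j * (r ^ 4) ^ suc j     ≡⟨ sym (pow-*-distrib L (r ^ 4) (suc j)) ⟩
               (L * r ^ 4) ^ suc j             ≤⟨ ^-monoˡ-≤ (suc j) Lr⁴≤n ⟩
               n ^ suc j                       ∎)) ⟩
        (16 * κ) ^ (2 + j) * g ^ (2 + j) * (n ^ suc j * n ^ (2 + j)) ∎
        where
        e₁ : ∀ a b d → a * (b * d) ≡ a * d * b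
        e₁ = solve-∀
        e₂ : ∀ k n r g l → k * (n * (r * g)) * l ≡ k * g * (l * r * n)
        e₂ = solve-∀
        r-power : (r * r) ^ (2 + j) ≤ (r ^ 4) ^ suc j
        r-power = begin
          (r * r) ^ (2 + j)
            ≤⟨ ^-monoʳ-≤ (r * r) {{m*n≢0 r r}} (≤-trans (m≤m+n (2 + j) j) (≤-reflexive (e₃ j))) ⟩
          (r * r) ^ (2 * suc j)
            ≡⟨ sym (^-*-assoc (r * r) 2 (suc j)) ⟩
          ((r * r) ^ 2) ^ suc j
            ≡⟨ cong (_^ suc j) (e₄ r) ⟩
          (r ^ 4) ^ suc j                   ∎
          where
          e₃ : ∀ j → 2 + j + j ≡ 2 * suc j
          e₃ = solve-∀
          e₄ : ∀ r → r * r * (r * r * 1) ≡ r * (r * (r * (r * 1)))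
          e₄ = solve-∀

      many-dense : x ≤ 4 * card (low ∩ complement sparse) → Goal
      many-dense h = begin
        x * x ^ (2 + j) * L ^ c (2 + j)
          ≡⟨ cong (x * x ^ (2 + j) *_) (split L) ⟩
        x * x ^ (2 + j) * (L ^ c j * (L ^ suc j * L ^ (2 + j)))
          ≡⟨ e₁ x (x ^ (2 + j)) (L ^ c j) (L ^ suc j * L ^ (2 + j)) ⟩
        x * (L ^ c j * (x ^ (2 + j) * (L ^ suc j * L ^ (2 + j))))
          ≤⟨ *-monoʳ-≤ x (*-monoʳ-≤ (L ^ c j) g-large) ⟩
        x * (L ^ c j * (K * g ^ (2 + j) * M))
          ≡⟨ e₂ x (L ^ c j) K g (g ^ suc j) M ⟩
        K * M * (x * (g * (g ^ suc j * L ^ c j)))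
          ≤⟨ *-monoʳ-≤ (K * M) (*-monoˡ-≤ (g * (g ^ suc j * L ^ c j)) h) ⟩
        K * M * (4 * card dense * (g * (g ^ suc j * L ^ c j)))
          ≡⟨ cong (K * M *_) (*-assoc 4 (card dense) _) ⟩
        K * M * (4 * (card dense * (g * (g ^ suc j * L ^ c j))))
          ≤⟨ *-monoʳ-≤ (K * M) (*-monoʳ-≤ 4 (T-lower (2 + j) _ (B₁ * n ^ c j * L)
               (λ v p → proj₁ (∧-true (proj₁ (∧-true {low v} p)))) dense-vertex)) ⟩
        K * M * (4 * (B₁ * n ^ c j * L * T (3 + j) D))
          ≡⟨ e₃ K M B₁ (n ^ c j) L (T (3 + j) D) ⟩
        4 * K * B₁ * T (3 + j) D * (n ^ c j * M) * L
          ≡⟨ cong (λ z → 4 * K * B₁ * T (3 + j) D * z * L) (sym (split n)) ⟩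
        4 * K * B₁ * T (3 + j) D * n ^ c (2 + j) * L
          ≤⟨ *-monoˡ-≤ L (*-monoˡ-≤ (n ^ c (2 + j)) (*-monoˡ-≤ (T (3 + j) D)
               (m≤n+m (4 * K * B₁) (2 * κ ^ (2 + j) * B₂)))) ⟩
        B₀ (2 + j) * T (3 + j) D * n ^ c (2 + j) * L ∎
        where
        K = (16 * κ) ^ (2 + j)
        M = n ^ suc j * n ^ (2 + j)
        dense = low ∩ complement sparse
        split : ∀ y → y ^ c (2 + j) ≡ y ^ c j * (y ^ suc j * y ^ (2 + j))
        split y = trans (^-distribˡ-+-* y (c (suc j)) (2 + j))
          (trans (cong (_* y ^ (2 + j)) (^-distribˡ-+-* y (c j) (suc j))) (*-assoc (y ^ c j) _ _))
        e₁ : ∀ x y l m → x * y * (l * m) ≡ x * (l * (y * m))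
        e₁ = solve-∀
        e₂ : ∀ x l k g h m → x * (l * (k * (g * h) * m)) ≡ k * m * (x * (g * (h * l)))
        e₂ = solve-∀
        e₃ : ∀ k m b a L t → k * m * (4 * (b * a * L * t)) ≡ 4 * k * b * t * (a * m) * L
        e₃ = solve-∀

      many-low : x ≤ 2 * card low → Goal
      many-low h = by-cases (halve low sparse)
        where
        quarter : ∀ P → card low ≤ 2 * card P → x ≤ 4 * card P
        quarter P p = ≤-trans h (≤-trans (*-monoʳ-≤ 2 p) (≤-reflexive (sym (*-assoc 2 2 (card P)))))
        by-cases : card low ≤ 2 * card (low ∩ sparse) ⊎ card low ≤ 2 * card (low ∩ complement sparse) → Goal
        by-cases (inj₁ p) = contradiction (quarter (low ∩ sparse) p) few-sparse
        by-cases (inj₂ p) = many-dense (quarter (low ∩ complement sparse) p)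

    goal : Goal
    goal with halve D high | q ≤? L
    ... | inj₁ h | _ = many-high h
    -- For `L < q` no logarithmic gain is needed: `8 * L ≤ κ`, and the Turán bound already excludes
    -- that half of the vertices are low.
    ... | inj₂ h | no q≰L = contradiction h
      (few-low (≤-trans (*-monoʳ-≤ 8 (<⇒≤ (≰⇒> q≰L))) (*-monoˡ-≤ q (m≤m+n 8 8))) 16n≤x)
    ... | inj₂ h | yes q≤L =
      let b , r , 1≤b , 1≤r , L<2qb , Lr⁴≤n , b2^8b≤r = scale L n 2^L≤n q≤L
      in Large.many-low b r 1≤b 1≤r L<2qb Lr⁴≤n b2^8b≤r h

  claim : ∀ j → Claim j
  claim zero          = claim₀
  claim (suc zero)    = claim₁
  claim (suc (suc j)) = InductionStep.goal j (claim j) (claim (suc j))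

-- Cliques as subsets

-- The recursion follows `allSubsets`, which turns the list count in `numCliques` into a sum.
Σₛ : ∀ {N} → (Subset N → ℕ) → ℕ
Σₛ {zero}  f = f []
Σₛ {suc N} f = Σₛ (λ S → f (inside ∷ S)) + Σₛ (λ S → f (outside ∷ S))

Σₛ-mono : ∀ {N} {f g : Subset N → ℕ} → (∀ S → f S ≤ g S) → Σₛ f ≤ Σₛ g
Σₛ-mono {zero}  h = h []
Σₛ-mono {suc N} h = +-mono-≤ (Σₛ-mono λ S → h (inside ∷ S)) (Σₛ-mono λ S → h (outside ∷ S))

Σₛ-* : ∀ {N} a (f : Subset N → ℕ) → Σₛ (λ S → a * f S) ≡ a * Σₛ f
Σₛ-* {zero}  a f = refl
Σₛ-* {suc N} a f = trans
  (cong₂ _+_ (Σₛ-* a (λ S → f (inside ∷ S))) (Σₛ-* a (λ S → f (outside ∷ S))))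
  (sym (*-distribˡ-+ a _ _))

Σₛ-sum : ∀ {N m} (f : Fin m → Subset N → ℕ) → sum (λ v → Σₛ (f v)) ≡ Σₛ (λ S → sum (λ v → f v S))
Σₛ-sum {zero}  f = refl
Σₛ-sum {suc N} f = trans (∑-distrib-+ (λ v → Σₛ (λ S → f v (inside ∷ S))) _)
  (cong₂ _+_ (Σₛ-sum (λ v S → f v (inside ∷ S))) (Σₛ-sum (λ v S → f v (outside ∷ S))))

Σₛ-zero : ∀ N → Σₛ {N} (λ _ → 0) ≡ 0
Σₛ-zero zero    = refl
Σₛ-zero (suc N) = cong₂ _+_ (Σₛ-zero N) (Σₛ-zero N)

≤-Σₛ : ∀ {N} (f : Subset N → ℕ) S → f S ≤ Σₛ f
≤-Σₛ f []            = ≤-refl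
≤-Σₛ f (inside ∷ S)  = ≤-trans (≤-Σₛ (λ S → f (inside ∷ S)) S) (m≤m+n _ _)
≤-Σₛ f (outside ∷ S) = ≤-trans (≤-Σₛ (λ S → f (outside ∷ S)) S) (m≤n+m _ _)

-- Insertion of `v` is a bijection from the subsets without `v` to those with `v`.
Σₛ-insert : ∀ {N} (v : Fin N) (f : Subset N → ℕ) →
  Σₛ (λ S → not (lookup S v) ▹ f (S [ v ]≔ inside)) ≡ Σₛ (λ S → lookup S v ▹ f S)
Σₛ-insert {suc N} zero f = trans (cong (_+ Σₛ (λ S → f (inside ∷ S))) (Σₛ-zero N))
  (sym (trans (cong (Σₛ (λ S → f (inside ∷ S)) +_) (Σₛ-zero N)) (+-identityʳ _)))
Σₛ-insert {suc N} (suc v) f = cong₂ _+_ (Σₛ-insert v (λ S → f (inside ∷ S))) (Σₛ-insert v (λ S → f (outside ∷ S)))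

sum-lookup : ∀ {N} (S : Subset N) x → sum (λ v → lookup S v ▹ x) ≡ ∣ S ∣ * x
sum-lookup []            x = refl
sum-lookup (inside ∷ S)  x = cong (x +_) (sum-lookup S x)
sum-lookup (outside ∷ S) x = sum-lookup S x

∣insert∣ : ∀ {N} (S : Subset N) v → lookup S v ≡ outside → ∣ S [ v ]≔ inside ∣ ≡ suc ∣ S ∣
∣insert∣ (outside ∷ S) zero    e = refl
∣insert∣ (inside  ∷ S) (suc v) e = cong suc (∣insert∣ S v e)
∣insert∣ (outside ∷ S) (suc v) e = ∣insert∣ S v e

length-filter-map : ∀ {A B : Set} {P : B → Set} (P? : Decidable P) (f : A → B) xs →
  length (filter P? (map f xs)) ≡ length (filter (P? ∘ f) xs)
length-filter-map P? f []       = refl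
length-filter-map P? f (x ∷ xs) with does (P? (f x))
... | true  = cong suc (length-filter-map P? f xs)
... | false = length-filter-map P? f xs

length-filter-allSubsets : ∀ N {P : Subset N → Set} (P? : Decidable P) →
  length (filter P? (allSubsets N)) ≡ Σₛ (λ S → does (P? S) ▹ 1)
length-filter-allSubsets zero P? with does (P? [])
... | true  = refl
... | false = refl
length-filter-allSubsets (suc N) P? = begin
  length (filter P? (map (inside ∷_) xs ++ map (outside ∷_) xs))
    ≡⟨ cong length (filter-++ P? (map (inside ∷_) xs) _) ⟩
  length (filter P? (map (inside ∷_) xs) ++ filter P? (map (outside ∷_) xs))
    ≡⟨ length-++ (filter P? (map (inside ∷_) xs)) ⟩
  length (filter P? (map (inside ∷_) xs)) + length (filter P? (map (outside ∷_) xs))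
    ≡⟨ cong₂ _+_ (length-filter-map P? (inside ∷_) xs) (length-filter-map P? (outside ∷_) xs) ⟩
  length (filter (P? ∘ (inside ∷_)) xs) + length (filter (P? ∘ (outside ∷_)) xs)
    ≡⟨ cong₂ _+_ (length-filter-allSubsets N (P? ∘ (inside ∷_))) (length-filter-allSubsets N (P? ∘ (outside ∷_))) ⟩
  Σₛ (λ S → does (P? S) ▹ 1) ∎
  where
  open ≡-Reasoning
  xs = allSubsets N

does-yes : ∀ {X : Set} (X? : Dec X) → X → does X? ≡ true
does-yes (yes _) _ = refl
does-yes (no ¬x) x = contradiction x ¬x

lookup⇒∈ : ∀ {N} {i : Fin N} {S} → lookup S i ≡ true → i ∈ₛ S
lookup⇒∈ {i = i} {S} = lookup⇒[]= i S

subset-of-size : ∀ {N} m (W : Mask N) → m ≤ card W → ∃ λ (S : Subset N) → ∣ S ∣ ≡ m × (∀ i → i ∈ₛ S → W i ≡ true)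
subset-of-size {N} zero W _ = Sub.⊥ , ∣⊥∣≡0 N , λ i i∈⊥ → contradiction i∈⊥ ∉⊥
subset-of-size {suc N} (suc m) W h with W zero in e
... | true with subset-of-size m (W ∘ suc) (s≤s⁻¹ h)
... | S , eq , sub = inside ∷ S , cong suc eq , λ { zero _ → e ; (suc i) p → sub i (lookup⇒∈ ([]=⇒lookup p)) }
subset-of-size {suc N} (suc m) W h | false with subset-of-size (suc m) (W ∘ suc) h
... | S , eq , sub = outside ∷ S , eq , λ { zero () ; (suc i) p → sub i (lookup⇒∈ ([]=⇒lookup p)) }

module FromGraph {N} (G : Graph N) where
  open Graph G

  adj : Adj N
  adj u v = does (u ~? v)

  adj⇒~ : ∀ {u v} → adj u v ≡ true → u ~ v
  adj⇒~ {u} {v} = does-true (u ~? v)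

  adj-sym : ∀ u v → adj u v ≡ adj v u
  adj-sym u v with u ~? v | v ~? u
  ... | yes _ | yes _ = refl
  ... | no _  | no _  = refl
  ... | yes p | no ¬p = contradiction (~-sym p) ¬p
  ... | no ¬p | yes p = contradiction (~-sym p) ¬p

  adj-irrefl : ∀ u → adj u u ≡ false
  adj-irrefl u with u ~? u
  ... | no _  = refl
  ... | yes p = contradiction p (~-irrefl refl)

  independent-card : ∀ n → ¬ HasIndependentSet G n → ∀ W → Indep adj W → card W ≤ n
  independent-card n none W ind with ≤-total n (card W)
  ... | inj₂ h = h
  ... | inj₁ h = let S , eq , sub = subset-of-size n W h in
    contradiction (S , (λ i j i∈S j∈S → does-false (i ~? j) (ind i j (sub i i∈S) (sub j j∈S))) , eq) none

  open Cliques adj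

  CliqueIn : ℕ → Mask N → Subset N → Set
  CliqueIn k D S = (IsClique G S × ∣ S ∣ ≡ k) × (∀ i → i ∈ₛ S → D i ≡ true)

  cliqueIn? : ∀ k D S → Dec (CliqueIn k D S)
  cliqueIn? k D S = (isClique? G S ×-dec (∣ S ∣ ≟ k)) ×-dec Fin.all? λ i → (i ∈? S) →-dec (D i Bool.≟ true)

  Q : ℕ → Mask N → ℕ
  Q k D = Σₛ (λ S → does (cliqueIn? k D S) ▹ 1)

  insert-clique : ∀ {k D v S} → D v ≡ true → CliqueIn k (D ∩ adj v) S →
    lookup S v ≡ false × CliqueIn (suc k) D (S [ v ]≔ inside)
  insert-clique {k} {D} {v} {S} Dv ((clique , size) , sub) = v∉S ,
    ((clique′ , trans (∣insert∣ S v v∉S) (cong suc size)) , sub′)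
    where
    v∉S : lookup S v ≡ false
    v∉S with lookup S v in e
    ... | false = refl
    ... | true  = trans (sym (proj₂ (∧-true (sub v (lookup⇒∈ e))))) (adj-irrefl v)
    old : ∀ {i} → i ≢ v → i ∈ₛ S [ v ]≔ inside → i ∈ₛ S
    old i≢v i∈ = lookup⇒∈ (trans (sym (lookup∘update′ i≢v S inside)) ([]=⇒lookup i∈))
    clique′ : IsClique G (S [ v ]≔ inside)
    clique′ i j i∈ j∈ i≢j with i Fin.≟ v | j Fin.≟ v
    ... | yes refl | yes refl = contradiction refl i≢j
    ... | yes refl | no j≢v   = adj⇒~ (proj₂ (∧-true {D j} (sub j (old j≢v j∈))))
    ... | no i≢v   | yes refl = ~-sym (adj⇒~ (proj₂ (∧-true {D i} (sub i (old i≢v i∈)))))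
    ... | no i≢v   | no j≢v   = clique i j (old i≢v i∈) (old j≢v j∈) i≢j
    sub′ : ∀ i → i ∈ₛ S [ v ]≔ inside → D i ≡ true
    sub′ i i∈ with i Fin.≟ v
    ... | yes refl = Dv
    ... | no i≢v   = proj₁ (∧-true (sub i (old i≢v i∈)))

  Q-extend : ∀ k D v → D v ≡ true → Q k (D ∩ adj v) ≤ Σₛ (λ S → lookup S v ▹ does (cliqueIn? (suc k) D S) ▹ 1)
  Q-extend k D v Dv = ≤-trans (Σₛ-mono pointwise) (≤-reflexive (Σₛ-insert v (λ S → does (cliqueIn? (suc k) D S) ▹ 1)))
    where
    pointwise : ∀ S → does (cliqueIn? k (D ∩ adj v) S) ▹ 1
      ≤ not (lookup S v) ▹ does (cliqueIn? (suc k) D (S [ v ]≔ inside)) ▹ 1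
    pointwise S = by-cases (cliqueIn? k (D ∩ adj v) S)
      where
      by-cases : (X? : Dec (CliqueIn k (D ∩ adj v) S)) → does X? ▹ 1
        ≤ not (lookup S v) ▹ does (cliqueIn? (suc k) D (S [ v ]≔ inside)) ▹ 1
      by-cases (no _)  = z≤n
      by-cases (yes p) = let e , p′ = insert-clique Dv p in
        ≤-reflexive (sym (cong₂ (λ a b → not a ▹ b ▹ 1) e (does-yes (cliqueIn? (suc k) D (S [ v ]≔ inside)) p′)))

  -- Both sides concern pairs of a `suc k`-clique and one of its vertices: a `k`-clique in the
  -- neighbourhood of `v` together with `v` is such a pair. Iteration gives the factor `k !` between
  -- ordered and unordered cliques.
  Q-double-count : ∀ k D → Σ∈ D (λ v → Q k (D ∩ adj v)) ≤ suc k * Q (suc k) D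
  Q-double-count k D = begin
    Σ∈ D (λ v → Q k (D ∩ adj v))
      ≤⟨ Σ∈-mono D (Q-extend k D) ⟩
    Σ∈ D (λ v → Σₛ (λ S → lookup S v ▹ f S))
      ≤⟨ sum-mono (λ v → ▹-≤ (D v) _) ⟩
    sum (λ v → Σₛ (λ S → lookup S v ▹ f S))
      ≡⟨ Σₛ-sum (λ v S → lookup S v ▹ f S) ⟩
    Σₛ (λ S → sum (λ v → lookup S v ▹ f S))
      ≤⟨ Σₛ-mono (λ S → ≤-trans (≤-reflexive (sum-lookup S (f S))) (size S (cliqueIn? (suc k) D S))) ⟩
    Σₛ (λ S → suc k * f S)
      ≡⟨ Σₛ-* (suc k) f ⟩
    suc k * Q (suc k) D ∎
    where
    open ≤-Reasoning
    f : Subset N → ℕ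
    f S = does (cliqueIn? (suc k) D S) ▹ 1
    size : ∀ S (X? : Dec (CliqueIn (suc k) D S)) → ∣ S ∣ * (does X? ▹ 1) ≤ suc k * (does X? ▹ 1)
    size S (no _)  = ≤-reflexive (trans (*-zeroʳ ∣ S ∣) (sym (*-zeroʳ k)))
    size S (yes ((_ , e) , _)) = ≤-reflexive (cong (_* 1) e)

  T≤k!Q : ∀ k D → T k D ≤ k ! * Q k D
  T≤k!Q zero D = ≤-trans (≤-reflexive (sym (cong (_▹ 1) (does-yes (cliqueIn? 0 D Sub.⊥) empty))))
    (≤-trans (≤-Σₛ (λ S → does (cliqueIn? 0 D S) ▹ 1) Sub.⊥) (≤-reflexive (sym (*-identityˡ _))))
    where
    empty : CliqueIn 0 D Sub.⊥
    empty = ((λ i j i∈⊥ → contradiction i∈⊥ ∉⊥) , ∣⊥∣≡0 N) , λ i i∈⊥ → contradiction i∈⊥ ∉⊥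
  T≤k!Q (suc k) D = begin
    Σ∈ D (λ v → T k (D ∩ adj v))              ≤⟨ Σ∈-mono D (λ v _ → T≤k!Q k (D ∩ adj v)) ⟩
    Σ∈ D (λ v → k ! * Q k (D ∩ adj v))        ≡⟨ sym (Σ∈-* (k !) D _) ⟩
    k ! * Σ∈ D (λ v → Q k (D ∩ adj v))        ≤⟨ *-monoʳ-≤ (k !) (Q-double-count k D) ⟩
    k ! * (suc k * Q (suc k) D)               ≡⟨ e (k !) (suc k) _ ⟩
    suc k * k ! * Q (suc k) D                 ∎
    where
    open ≤-Reasoning
    e : ∀ a b c → a * (b * c) ≡ b * a * c
    e = solve-∀

  T≤numCliques : ∀ k D → T k D ≤ k ! * numCliques G k
  T≤numCliques k D = ≤-trans (T≤k!Q k D) (*-monoʳ-≤ (k !) (≤-trans (Σₛ-mono pointwise)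
    (≤-reflexive (sym (length-filter-allSubsets N (λ S → isClique? G S ×-dec (∣ S ∣ ≟ k)))))))
    where
    pointwise : ∀ S → does (cliqueIn? k D S) ▹ 1 ≤ does (isClique? G S ×-dec (∣ S ∣ ≟ k)) ▹ 1
    pointwise S = ▹-⊆ 1 (λ h → does-yes (isClique? G S ×-dec (∣ S ∣ ≟ k)) (proj₁ (does-true (cliqueIn? k D S) h)))

-- The bound in integers

full : ∀ {N} → Mask N
full _ = true

card-full : ∀ N → card {N} full ≡ N
card-full zero    = refl
card-full (suc N) = cong suc (card-full N)

supersaturation : ∀ j {N} (G : Graph N) n L → 1 ≤ L → 2 ^ L ≤ n → ¬ HasIndependentSet G n →
  A₀ j * n ^ j * L ≤ N * L ^ j →
  N ^ suc j * L ^ c j ≤ B₀ j * (suc j ! * numCliques G (suc j)) * n ^ c j * L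
supersaturation j {N} G n L 1≤L 2^L≤n none hyp = ≤-trans
  (subst (λ x → x ^ suc j * L ^ c j ≤ B₀ j * T (suc j) full * n ^ c j * L) (card-full N)
    (claim j full (subst (λ x → A₀ j * n ^ j * L ≤ x * L ^ j) (sym (card-full N)) hyp)))
  (*-monoˡ-≤ L (*-monoˡ-≤ (n ^ c j) (*-monoʳ-≤ (B₀ j) (T≤numCliques (suc j) full))))
  where
  open FromGraph G
  open Cliques adj
  open Supersaturation adj adj-sym adj-irrefl n L 1≤L 2^L≤n (independent-card n none)

floor-log₂ : ∀ n → 2 ≤ n → ∃ λ L → 1 ≤ L × 2 ^ L ≤ n × n ≤ 2 ^ suc L
floor-log₂ (suc zero) (s≤s ())
floor-log₂ (suc (suc zero)) _ = 1 , s≤s z≤n , ≤-refl , m≤m+n 2 2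
floor-log₂ (suc (suc (suc n))) _ with floor-log₂ (suc (suc n)) (s≤s (s≤s z≤n))
... | L , 1≤L , lower , upper with suc (suc (suc n)) ≤? 2 ^ suc L
... | yes p = L , 1≤L , m≤n⇒m≤1+n lower , p
... | no ¬p = suc L , s≤s z≤n , <⇒≤ (≰⇒> ¬p) ,
  ≤-trans (s≤s upper) (+-mono-≤ (m^n>0 2 (suc L)) (≤-reflexive (sym (+-identityʳ _))))

nCk≤n^k : ∀ n k → n C k ≤ n ^ k
nCk≤n^k zero    zero    = ≤-refl
nCk≤n^k zero    (suc k) = z≤n
nCk≤n^k (suc n) zero    = ≤-refl
nCk≤n^k (suc n) (suc k) = begin
  suc n C suc k                  ≡⟨ sym (nCk+nC[k+1]≡[n+1]C[k+1] n k) ⟩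
  n C k + n C suc k              ≤⟨ +-mono-≤ (nCk≤n^k n k) (nCk≤n^k n (suc k)) ⟩
  n ^ k + n * n ^ k              ≤⟨ *-monoʳ-≤ (suc n) (^-monoˡ-≤ k (n≤1+n n)) ⟩
  suc n * suc n ^ k              ∎
  where open ≤-Reasoning

c≡C : ∀ j → c j ≡ suc j C 2
c≡C zero    = refl
c≡C (suc j) = begin
  c j + suc j               ≡⟨ +-comm (c j) (suc j) ⟩
  suc j + c j               ≡⟨ cong₂ _+_ (sym (nC1≡n (suc j))) (c≡C j) ⟩
  suc j C 1 + suc j C 2     ≡⟨ nCk+nC[k+1]≡[n+1]C[k+1] (suc j) 1 ⟩
  suc (suc j) C 2           ∎
  where open ≡-Reasoning

-- Rational bounds for the logarithm

ι : ℕ → ℚ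
ι n = ℤ.+ n ℚ./ 1

ι-+ : ∀ a b → ι (a + b) ≡ ι a ℚ.+ ι b
ι-+ zero    b = sym (ℚ.+-identityˡ (ι b))
ι-+ (suc a) b = begin
  ι (suc (a + b))            ≡⟨ /-suc (a + b) 0 ⟩
  1ℚ ℚ.+ ι (a + b)           ≡⟨ cong (1ℚ ℚ.+_) (ι-+ a b) ⟩
  1ℚ ℚ.+ (ι a ℚ.+ ι b)       ≡⟨ sym (ℚ.+-assoc 1ℚ (ι a) (ι b)) ⟩
  1ℚ ℚ.+ ι a ℚ.+ ι b         ≡⟨ cong (ℚ._+ ι b) (sym (/-suc a 0)) ⟩
  ι (suc a) ℚ.+ ι b          ∎
  where open ≡-Reasoning

ι-* : ∀ a b → ι (a * b) ≡ ι a ℚ.* ι b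
ι-* zero    b = sym (ℚ.*-zeroˡ (ι b))
ι-* (suc a) b = begin
  ι (b + a * b)                    ≡⟨ ι-+ b (a * b) ⟩
  ι b ℚ.+ ι (a * b)                ≡⟨ cong₂ ℚ._+_ (sym (ℚ.*-identityˡ (ι b))) (ι-* a b) ⟩
  1ℚ ℚ.* ι b ℚ.+ ι a ℚ.* ι b       ≡⟨ sym (ℚ.*-distribʳ-+ (ι b) 1ℚ (ι a)) ⟩
  (1ℚ ℚ.+ ι a) ℚ.* ι b             ≡⟨ cong (ℚ._* ι b) (sym (/-suc a 0)) ⟩
  ι (suc a) ℚ.* ι b                ∎
  where open ≡-Reasoning

ι-mono : ∀ {a b} → a ≤ b → ι a ℚ.≤ ι b
ι-mono {a} {b} a≤b = /-≤ a 0 b 0 (*-monoˡ-≤ 1 a≤b)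

0<1 : 0ℚ ℚ.< 1ℚ
0<1 = *<* (ℤ.+<+ (s≤s z≤n))

ι-cancel-≤ : ∀ {a b} → ι a ℚ.≤ ι b → a ≤ b
ι-cancel-≤ {a} {b} h = ≮⇒≥ λ b<a → ℚ.<-irrefl refl (begin-strict
  ι b               ≡⟨ sym (ℚ.+-identityˡ (ι b)) ⟩
  0ℚ ℚ.+ ι b        <⟨ ℚ.+-monoˡ-< (ι b) 0<1 ⟩
  1ℚ ℚ.+ ι b        ≡⟨ sym (/-suc b 0) ⟩
  ι (suc b)         ≤⟨ ι-mono b<a ⟩
  ι a               ≤⟨ h ⟩
  ι b               ∎)
  where open ℚ.≤-Reasoning

0≤ι : ∀ a → 0ℚ ℚ.≤ ι a
0≤ι a = ι-mono {0} {a} z≤n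

0<ι : ∀ {a} → 1 ≤ a → 0ℚ ℚ.< ι a
0<ι {a} 1≤a = ℚ.<-≤-trans 0<1 (ι-mono {1} {a} 1≤a)

*-mono-≤ℚ : ∀ {p q r s} → 0ℚ ℚ.≤ p → 0ℚ ℚ.≤ s → p ℚ.≤ q → r ℚ.≤ s → p ℚ.* r ℚ.≤ q ℚ.* s
*-mono-≤ℚ {p} {q} {r} {s} 0≤p 0≤s p≤q r≤s = ℚ.≤-trans
  (ℚ.*-monoˡ-≤-nonNeg p {{ℚ.nonNegative 0≤p}} r≤s)
  (ℚ.*-monoʳ-≤-nonNeg s {{ℚ.nonNegative 0≤s}} p≤q)

0<*ℚ : ∀ {p q} → 0ℚ ℚ.< p → 0ℚ ℚ.< q → 0ℚ ℚ.< p ℚ.* q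
0<*ℚ {p} {q} 0<p 0<q = ℚ.positive⁻¹ (p ℚ.* q) {{ℚ.pos*pos⇒pos p {{ℚ.positive 0<p}} q {{ℚ.positive 0<q}}}}

infixr 8 _^ℚ_
_^ℚ_ : ℚ → ℕ → ℚ
p ^ℚ zero  = 1ℚ
p ^ℚ suc k = p ℚ.* p ^ℚ k

seq-^ℝ : ∀ x k m → seq (x ^ℝ k) m ≡ seq x m ^ℚ k
seq-^ℝ x zero    m = refl
seq-^ℝ x (suc k) m = cong (seq x m ℚ.*_) (seq-^ℝ x k m)

ι-^ : ∀ a k → ι (a ^ k) ≡ ι a ^ℚ k
ι-^ a zero    = refl
ι-^ a (suc k) = trans (ι-* a (a ^ k)) (cong (ι a ℚ.*_) (ι-^ a k))

0<^ℚ : ∀ {p} k → 0ℚ ℚ.< p → 0ℚ ℚ.< p ^ℚ k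
0<^ℚ zero    0<p = 0<1
0<^ℚ (suc k) 0<p = 0<*ℚ 0<p (0<^ℚ k 0<p)

^ℚ-mono : ∀ {p q} k → 0ℚ ℚ.< p → p ℚ.≤ q → p ^ℚ k ℚ.≤ q ^ℚ k
^ℚ-mono zero    0<p p≤q = ℚ.≤-refl
^ℚ-mono (suc k) 0<p p≤q = *-mono-≤ℚ (ℚ.<⇒≤ 0<p) (ℚ.<⇒≤ (0<^ℚ k (ℚ.<-≤-trans 0<p p≤q))) p≤q (^ℚ-mono k 0<p p≤q)

*-^ℚ : ∀ p q k → (p ℚ.* q) ^ℚ k ≡ p ^ℚ k ℚ.* q ^ℚ k
*-^ℚ p q zero    = refl
*-^ℚ p q (suc k) = trans (cong (p ℚ.* q ℚ.*_) (*-^ℚ p q k)) (lemma p q (p ^ℚ k) (q ^ℚ k))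
  where
  open ℚ-Solver
  lemma : ∀ a b x y → a ℚ.* b ℚ.* (x ℚ.* y) ≡ a ℚ.* x ℚ.* (b ℚ.* y)
  lemma = solve 4 (λ a b x y → a :* b :* (x :* y) := a :* x :* (b :* y)) refl

-- The range (a, 2ᴸ a] has dyadicLength L a elements and splits into L dyadic blocks,
-- each of which contributes between 1/2 and 1 to the harmonic sum.
dyadicLength : ℕ → ℕ → ℕ
dyadicLength zero    a = 0
dyadicLength (suc L) a = a + dyadicLength L (a + a)

dyadicLength-+ : ∀ L a → dyadicLength L a + a ≡ 2 ^ L * a
dyadicLength-+ zero    a = sym (+-identityʳ a)
dyadicLength-+ (suc L) a = begin
  a + dyadicLength L (a + a) + a       ≡⟨ e₁ a (dyadicLength L (a + a)) ⟩
  dyadicLength L (a + a) + (a + a)     ≡⟨ dyadicLength-+ L (a + a) ⟩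
  2 ^ L * (a + a)                      ≡⟨ e₂ a (2 ^ L) ⟩
  2 * 2 ^ L * a                        ∎
  where
  open ≡-Reasoning
  e₁ : ∀ a d → a + d + a ≡ d + (a + a)
  e₁ = solve-∀
  e₂ : ∀ a p → p * (a + a) ≡ 2 * p * a
  e₂ = solve-∀

recipSum-dyadic-lower : ∀ L i → ι L ℚ.≤ ι 2 ℚ.* recipSum (suc i) (dyadicLength L (suc i))
recipSum-dyadic-lower zero    i = ℚ.≤-refl
recipSum-dyadic-lower (suc L) i = begin
  ι (suc L)
    ≡⟨ /-suc L 0 ⟩
  ι 2 ℚ.* (ℤ.+ 1 ℚ./ 2) ℚ.+ ι L
    ≤⟨ ℚ.+-mono-≤ (ℚ.*-monoˡ-≤-nonNeg (ι 2) block) (recipSum-dyadic-lower L (i + suc i)) ⟩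
  ι 2 ℚ.* recipSum a a ℚ.+ ι 2 ℚ.* recipSum (a + a) (dyadicLength L (a + a))
    ≡⟨ sym (ℚ.*-distribˡ-+ (ι 2) (recipSum a a) _) ⟩
  ι 2 ℚ.* (recipSum a a ℚ.+ recipSum (a + a) (dyadicLength L (a + a)))
    ≡⟨ cong (ι 2 ℚ.*_) (sym (recipSum-++ a a (dyadicLength L (a + a)))) ⟩
  ι 2 ℚ.* recipSum a (a + dyadicLength L (a + a)) ∎
  where
  open ℚ.≤-Reasoning
  a = suc i
  block : ℤ.+ 1 ℚ./ 2 ℚ.≤ recipSum a a
  block = ℚ.≤-trans (/-≤ 1 1 a (i + suc i) (≤-reflexive (e i))) (recipSum-lower a a (i + suc i) ≤-refl)
    where
    e : ∀ i → 1 * suc (i + suc i) ≡ suc i * 2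
    e = solve-∀

recipSum-dyadic-upper : ∀ L i → recipSum (suc i) (dyadicLength L (suc i)) ℚ.≤ ι L
recipSum-dyadic-upper zero    i = ℚ.≤-refl
recipSum-dyadic-upper (suc L) i = begin
  recipSum a (a + dyadicLength L (a + a))
    ≡⟨ recipSum-++ a a (dyadicLength L (a + a)) ⟩
  recipSum a a ℚ.+ recipSum (a + a) (dyadicLength L (a + a))
    ≤⟨ ℚ.+-mono-≤ (ℚ.≤-trans (recipSum-upper a a i (n≤1+n i)) (/-≤ a i 1 0 (≤-reflexive (*-comm a 1))))
                   (recipSum-dyadic-upper L (i + suc i)) ⟩
  1ℚ ℚ.+ ι L
    ≡⟨ sym (/-suc L 0) ⟩
  ι (suc L) ∎
  where
  open ℚ.≤-Reasoning
  a = suc i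

recipSum-monoʳ : ∀ a {k l} → k ≤ l → recipSum a k ℚ.≤ recipSum a l
recipSum-monoʳ a {k} {l} k≤l = begin
  recipSum a k                                      ≡⟨ sym (ℚ.+-identityʳ _) ⟩
  recipSum a k ℚ.+ 0ℚ                               ≤⟨ ℚ.+-monoʳ-≤ (recipSum a k) (recipSum-nonNeg (a + k) (l ∸ k)) ⟩
  recipSum a k ℚ.+ recipSum (a + k) (l ∸ k)         ≡⟨ sym (recipSum-++ a k (l ∸ k)) ⟩
  recipSum a (k + (l ∸ k))                          ≡⟨ cong (recipSum a) (m+[n∸m]≡n k≤l) ⟩
  recipSum a l                                      ∎
  where open ℚ.≤-Reasoning

-- The range of the Riemann sum contains the `L` dyadic blocks. The bound is uniform in the index
-- `m`, so real inequalities can be handled term by term.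
logSum-lower : ∀ n L m → 2 ^ L ≤ n → ι L ℚ.≤ ι 2 ℚ.* logSum n m
logSum-lower n L m h = ℚ.≤-trans (recipSum-dyadic-lower L m)
  (ℚ.*-monoˡ-≤-nonNeg (ι 2) (recipSum-monoʳ (suc m) (+-cancelʳ-≤ (suc m) _ _ (begin
    dyadicLength L (suc m) + suc m   ≡⟨ dyadicLength-+ L (suc m) ⟩
    2 ^ L * suc m                    ≤⟨ *-monoˡ-≤ (suc m) h ⟩
    n * suc m                        ≡⟨ cong (_* suc m) (sym (m∸n+n≡m (≤-trans (m^n>0 2 L) h))) ⟩
    (n ∸ 1 + 1) * suc m              ≡⟨ *-distribʳ-+ (suc m) (n ∸ 1) 1 ⟩
    (n ∸ 1) * suc m + 1 * suc m      ≡⟨ cong (λ z → (n ∸ 1) * suc m + z) (*-identityˡ (suc m)) ⟩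
    (n ∸ 1) * suc m + suc m          ∎))))
  where open ≤-Reasoning

logSum-upper : ∀ n L m → 1 ≤ n → n ≤ 2 ^ L → logSum n m ℚ.≤ ι L
logSum-upper n L m 1≤n h = ℚ.≤-trans
  (recipSum-monoʳ (suc m) (+-cancelʳ-≤ (suc m) _ _ (begin
    (n ∸ 1) * suc m + suc m          ≡⟨ cong (λ z → (n ∸ 1) * suc m + z) (sym (*-identityˡ (suc m))) ⟩
    (n ∸ 1) * suc m + 1 * suc m      ≡⟨ sym (*-distribʳ-+ (suc m) (n ∸ 1) 1) ⟩
    (n ∸ 1 + 1) * suc m              ≡⟨ cong (_* suc m) (m∸n+n≡m 1≤n) ⟩
    n * suc m                        ≤⟨ *-monoˡ-≤ (suc m) h ⟩
    2 ^ L * suc m                    ≡⟨ sym (dyadicLength-+ L (suc m)) ⟩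
    dyadicLength L (suc m) + suc m   ∎)))
  (recipSum-dyadic-upper L m)
  where open ≤-Reasoning

-- Transfer to the real statement

fromℚ-pos : ∀ {q} → 0ℚ ℚ.< q → 0ℝ <ℝ fromℚ q
fromℚ-pos {q} 0<q = q , 0<q , 0 , λ _ _ → ℚ.≤-reflexive (ℚ.+-identityˡ q)

module Transfer (i n N L : ℕ)
  (1≤N : 1 ≤ N) (1≤L : 1 ≤ L) (2^L≤n : 2 ^ L ≤ n) (n≤2^[1+L] : n ≤ 2 ^ suc L) where

  j : ℕ
  j = suc i

  1≤n : 1 ≤ n
  1≤n = ≤-trans (m^n>0 2 L) 2^L≤n

  module AtIndex (m : ℕ) where
    open ℚ.≤-Reasoning

    ℓ : ℚ
    ℓ = logSum n m

    L≤2ℓ : ι L ℚ.≤ ι 2 ℚ.* ℓ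
    L≤2ℓ = logSum-lower n L m 2^L≤n

    ℓ≤2L : ℓ ℚ.≤ ι (2 * L)
    ℓ≤2L = ℚ.≤-trans (logSum-upper n (suc L) m 1≤n n≤2^[1+L])
      (ι-mono (≤-trans (+-monoˡ-≤ L 1≤L) (≤-reflexive (cong (λ z → L + z) (sym (+-identityʳ L))))))

    0<ℓ : 0ℚ ℚ.< ℓ
    0<ℓ = ℚ.*-cancelˡ-<-nonNeg (ι 2) (ℚ.<-≤-trans (0<ι 1≤L) L≤2ℓ)

    -- Of the factor `2 ^ j`, one 2 absorbs the error term through `N + 1 ≤ 2 N`, and `2 ^ i` comes
    -- from `ℓ ≤ 2 L` in the power of the logarithm.
    hypothesis : ∀ A → ι (2 ^ j * A) ℚ.* (ι n ^ℚ j ℚ.* recip (ℓ ^ℚ i)) ℚ.≤ ι N ℚ.+ 1ℚ →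
      A * n ^ j * L ≤ N * L ^ j
    hypothesis A h = ≤-trans (*-monoˡ-≤ L (*-cancelˡ-≤ (2 ^ j) {{m^n≢0 2 j}} (ι-cancel-≤ (begin
      ι (2 ^ j * (A * n ^ j))
        ≡⟨ cong ι (sym (*-assoc (2 ^ j) A (n ^ j))) ⟩
      ι (2 ^ j * A * n ^ j)
        ≡⟨ trans (ι-* (2 ^ j * A) (n ^ j)) (cong (ι (2 ^ j * A) ℚ.*_) (ι-^ n j)) ⟩
      ι (2 ^ j * A) ℚ.* ι n ^ℚ j
        ≡⟨ sym (ℚ.*-identityʳ _) ⟩
      ι (2 ^ j * A) ℚ.* ι n ^ℚ j ℚ.* 1ℚ
        ≡⟨ cong (ι (2 ^ j * A) ℚ.* ι n ^ℚ j ℚ.*_) (sym (recip-inverse (0<^ℚ i 0<ℓ))) ⟩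
      ι (2 ^ j * A) ℚ.* ι n ^ℚ j ℚ.* (ℓ ^ℚ i ℚ.* recip (ℓ ^ℚ i))
        ≡⟨ lemma (ι (2 ^ j * A)) (ι n ^ℚ j) (ℓ ^ℚ i) (recip (ℓ ^ℚ i)) ⟩
      ι (2 ^ j * A) ℚ.* (ι n ^ℚ j ℚ.* recip (ℓ ^ℚ i)) ℚ.* ℓ ^ℚ i
        ≤⟨ ℚ.*-monoʳ-≤-nonNeg (ℓ ^ℚ i) {{ℚ.nonNegative (ℚ.<⇒≤ (0<^ℚ i 0<ℓ))}} h ⟩
      (ι N ℚ.+ 1ℚ) ℚ.* ℓ ^ℚ i
        ≤⟨ *-mono-≤ℚ (ℚ.+-mono-≤ (0≤ι N) (ℚ.<⇒≤ 0<1)) (ℚ.<⇒≤ (0<^ℚ i (ℚ.<-≤-trans 0<ℓ ℓ≤2L)))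
             (ℚ.+-monoʳ-≤ (ι N) (ι-mono 1≤N)) (^ℚ-mono i 0<ℓ ℓ≤2L) ⟩
      (ι N ℚ.+ ι N) ℚ.* ι (2 * L) ^ℚ i
        ≡⟨ sym (trans (ι-* (N + N) ((2 * L) ^ i)) (cong₂ ℚ._*_ (ι-+ N N) (ι-^ (2 * L) i))) ⟩
      ι ((N + N) * (2 * L) ^ i)
        ≡⟨ cong ι (trans (cong ((N + N) *_) (pow-*-distrib 2 L i)) (lemma′ N (2 ^ i) (L ^ i))) ⟩
      ι (2 ^ j * (N * L ^ i)) ∎))))
      (≤-reflexive (lemma″ N (L ^ i) L))
      where
      open ℚ-Solver
      lemma : ∀ a b x y → a ℚ.* b ℚ.* (x ℚ.* y) ≡ a ℚ.* (b ℚ.* y) ℚ.* x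
      lemma = solve 4 (λ a b x y → a :* b :* (x :* y) := a :* (b :* y) :* x) refl
      lemma′ : ∀ N p l → (N + N) * (p * l) ≡ 2 * p * (N * l)
      lemma′ = solve-∀
      lemma″ : ∀ N l L → N * l * L ≡ N * (L * l)
      lemma″ = solve-∀

    -- In the constant, `2 ^ e` comes from `ℓ ≤ 2 L` in the power and the last 2 from `L ≤ 2 ℓ` in
    -- the factor `1 / log n`. Both sides are multiplied by all denominators.
    conclusion : ∀ e B b K → N ^ suc j * L ^ e ≤ B * K * n ^ e * L → b ≤ N ^ suc j → 1 ≤ B →
      recip (ι (2 ^ suc e * B)) ℚ.* ι b ℚ.* (ℓ ℚ.* recip (ι n)) ^ℚ e ℚ.* (1ℚ ℚ.* recip ℓ) ℚ.≤ ι K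
    conclusion e B b K core b≤ 1≤B = ℚ.*-cancelʳ-≤-pos (ι D ℚ.* ι n ^ℚ e ℚ.* ℓ)
      {{ℚ.positive (0<*ℚ (0<*ℚ (0<ι 1≤D) (0<^ℚ e (0<ι 1≤n))) 0<ℓ)}} (begin
      recip (ι D) ℚ.* ι b ℚ.* (ℓ ℚ.* recip (ι n)) ^ℚ e ℚ.* (1ℚ ℚ.* recip ℓ) ℚ.* (ι D ℚ.* ι n ^ℚ e ℚ.* ℓ)
        ≡⟨ cong (λ z → recip (ι D) ℚ.* ι b ℚ.* z ℚ.* (1ℚ ℚ.* recip ℓ) ℚ.* (ι D ℚ.* ι n ^ℚ e ℚ.* ℓ))
             (*-^ℚ ℓ (recip (ι n)) e) ⟩
      recip (ι D) ℚ.* ι b ℚ.* (ℓ ^ℚ e ℚ.* recip (ι n) ^ℚ e) ℚ.* (1ℚ ℚ.* recip ℓ) ℚ.* (ι D ℚ.* ι n ^ℚ e ℚ.* ℓ)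
        ≡⟨ lemma₁ (recip (ι D)) (ι b) (ℓ ^ℚ e) (recip (ι n) ^ℚ e) (recip ℓ) (ι D) (ι n ^ℚ e) ℓ ⟩
      ι b ℚ.* ℓ ^ℚ e ℚ.* ((ι D ℚ.* recip (ι D)) ℚ.* (ι n ^ℚ e ℚ.* recip (ι n) ^ℚ e) ℚ.* (ℓ ℚ.* recip ℓ))
        ≡⟨ cong (ι b ℚ.* ℓ ^ℚ e ℚ.*_)
             (cong₂ ℚ._*_ (cong₂ ℚ._*_ (recip-inverse (0<ι 1≤D)) n-cancel) (recip-inverse 0<ℓ)) ⟩
      ι b ℚ.* ℓ ^ℚ e ℚ.* 1ℚ
        ≡⟨ ℚ.*-identityʳ _ ⟩
      ι b ℚ.* ℓ ^ℚ e
        ≤⟨ *-mono-≤ℚ (0≤ι b) (ℚ.<⇒≤ (0<^ℚ e (ℚ.<-≤-trans 0<ℓ ℓ≤2L))) (ι-mono b≤) (^ℚ-mono e 0<ℓ ℓ≤2L) ⟩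
      ι (N ^ suc j) ℚ.* ι (2 * L) ^ℚ e
        ≡⟨ trans (cong (ι (N ^ suc j) ℚ.*_) (sym (ι-^ (2 * L) e))) (sym (ι-* (N ^ suc j) ((2 * L) ^ e))) ⟩
      ι (N ^ suc j * (2 * L) ^ e)
        ≤⟨ ι-mono naturals ⟩
      ι (2 ^ e * B * (K * n ^ e) * L)
        ≡⟨ ι-* (2 ^ e * B * (K * n ^ e)) L ⟩
      ι (2 ^ e * B * (K * n ^ e)) ℚ.* ι L
        ≤⟨ ℚ.*-monoˡ-≤-nonNeg (ι (2 ^ e * B * (K * n ^ e)))
             {{ℚ.nonNegative (0≤ι (2 ^ e * B * (K * n ^ e)))}} L≤2ℓ ⟩
      ι (2 ^ e * B * (K * n ^ e)) ℚ.* (ι 2 ℚ.* ℓ)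
        ≡⟨ sym (ℚ.*-assoc (ι (2 ^ e * B * (K * n ^ e))) (ι 2) ℓ) ⟩
      ι (2 ^ e * B * (K * n ^ e)) ℚ.* ι 2 ℚ.* ℓ
        ≡⟨ cong (ℚ._* ℓ) (trans (sym (ι-* (2 ^ e * B * (K * n ^ e)) 2)) (cong ι (lemma₂ (2 ^ e) B K (n ^ e)))) ⟩
      ι (K * (D * n ^ e)) ℚ.* ℓ
        ≡⟨ cong (ℚ._* ℓ) (trans (ι-* K (D * n ^ e))
             (cong (ι K ℚ.*_) (trans (ι-* D (n ^ e)) (cong (ι D ℚ.*_) (ι-^ n e))))) ⟩
      ι K ℚ.* (ι D ℚ.* ι n ^ℚ e) ℚ.* ℓ
        ≡⟨ ℚ.*-assoc (ι K) (ι D ℚ.* ι n ^ℚ e) ℓ ⟩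
      ι K ℚ.* (ι D ℚ.* ι n ^ℚ e ℚ.* ℓ) ∎)
      where
      D = 2 ^ suc e * B
      1≤D : 1 ≤ D
      1≤D = *-mono-≤ (m^n>0 2 (suc e)) 1≤B
      1^ : ∀ e → 1ℚ ^ℚ e ≡ 1ℚ
      1^ zero    = refl
      1^ (suc e) = trans (ℚ.*-identityˡ _) (1^ e)
      n-cancel : ι n ^ℚ e ℚ.* recip (ι n) ^ℚ e ≡ 1ℚ
      n-cancel = trans (sym (*-^ℚ (ι n) (recip (ι n)) e)) (trans (cong (_^ℚ e) (recip-inverse (0<ι 1≤n))) (1^ e))
      naturals : N ^ suc j * (2 * L) ^ e ≤ 2 ^ e * B * (K * n ^ e) * L
      naturals = ≤-trans
        (≤-reflexive (trans (cong (N ^ suc j *_) (pow-*-distrib 2 L e)) (lemma₃ (N ^ suc j) (2 ^ e) (L ^ e))))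
        (≤-trans (*-monoʳ-≤ (2 ^ e) core) (≤-reflexive (lemma₄ (2 ^ e) B K (n ^ e) L)))
        where
        lemma₃ : ∀ a p l → a * (p * l) ≡ p * (a * l)
        lemma₃ = solve-∀
        lemma₄ : ∀ p B K m L → p * (B * K * m * L) ≡ p * B * (K * m) * L
        lemma₄ = solve-∀
      lemma₁ : ∀ rD b l rn rl D n ℓ → rD ℚ.* b ℚ.* (l ℚ.* rn) ℚ.* (1ℚ ℚ.* rl) ℚ.* (D ℚ.* n ℚ.* ℓ)
        ≡ b ℚ.* l ℚ.* ((D ℚ.* rD) ℚ.* (n ℚ.* rn) ℚ.* (ℓ ℚ.* rl))
      lemma₁ rD b l rn rl D n ℓ = trans
        (cong (λ z → rD ℚ.* b ℚ.* (l ℚ.* rn) ℚ.* z ℚ.* (D ℚ.* n ℚ.* ℓ)) (ℚ.*-identityˡ rl))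
        (solve 8 (λ rD b l rn rl D n ℓ → rD :* b :* (l :* rn) :* rl :* (D :* n :* ℓ)
          := b :* l :* ((D :* rD) :* (n :* rn) :* (ℓ :* rl))) refl rD b l rn rl D n ℓ)
        where open ℚ-Solver
      lemma₂ : ∀ p B K m → p * B * (K * m) * 2 ≡ K * (2 * p * B * m)
      lemma₂ = solve-∀

theorem1p3 : ∀ (k : ℕ) → k ≥ 2 →
    ∃₂ λ (c₁ c₂ : ℝ) → 0ℝ <ℝ c₁ × 0ℝ <ℝ c₂ ×
    (∀ (n N : ℕ) (n≥2 : n ≥ 2) → N ≥ 1 →
      (G : Graph N) →
      ¬ HasIndependentSet G n →
      let log>0 = log-pos n≥2
          n>0   = fromℕ-pos (<⇒≤ n≥2)
      in
      c₁ *ℝ (fromℕ n ^ℝ (k ∸ 1) ÷ℝ log n ^ℝ (k ∸ 2) [ ^ℝ-pos (log n) (k ∸ 2) log>0 ])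
        ≤ℝ fromℕ N →
      c₂ *ℝ fromℕ (N C k) *ℝ (log n ÷ℝ fromℕ n [ n>0 ]) ^ℝ (k C 2) *ℝ (1ℝ ÷ℝ log n [ log>0 ])
        ≤ℝ fromℕ (numCliques G k))
theorem1p3 (suc zero) (s≤s ())
theorem1p3 (suc (suc i)) _ =
  -- The successors here and in `B` make positivity of the constants immediate.
  fromℕ (2 ^ j * suc (A₀ j)) , fromℚ (recip (ι (2 ^ suc (k C 2) * B))) ,
  fromℕ-pos (*-mono-≤ (m^n>0 2 j) (s≤s (z≤n {A₀ j}))) ,
  fromℚ-pos (recip-pos (0<ι (*-mono-≤ (m^n>0 2 (suc (k C 2))) 1≤B))) ,
  λ n N n≥2 N≥1 G none hyp ε 0<ε →
    let L , 1≤L , 2^L≤n , n≤2^[1+L] = floor-log₂ n n≥2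
        open Transfer i n N L N≥1 1≤L 2^L≤n n≤2^[1+L] using (module AtIndex)
        -- A single index with error 1 yields the integer hypothesis. The conclusion then holds at
        -- every index `m` without error, so `ε` is only added at the end.
        M , h = hyp 1ℚ 0<1
        large = AtIndex.hypothesis M (suc (A₀ j)) (subst₂
          (λ x y → ι (2 ^ j * suc (A₀ j)) ℚ.* (x ℚ.* recip y) ℚ.≤ ι N ℚ.+ 1ℚ)
          (seq-^ℝ (fromℕ n) j M) (seq-^ℝ (log n) i M) (h M ≤-refl))
        many = supersaturation j G n L 1≤L 2^L≤n none
          (≤-trans (*-monoˡ-≤ L (*-monoˡ-≤ (n ^ j) (n≤1+n (A₀ j)))) large)
        count = numCliques G k
    in 0 , λ m _ → ℚ.≤-trans
      (subst (λ x → recip (ι (2 ^ suc (k C 2) * B)) ℚ.* ι (N C k) ℚ.* x ℚ.* (1ℚ ℚ.* recip (logSum n m)) ℚ.≤ ι count)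
        (sym (seq-^ℝ (log n ÷ℝ fromℕ n [ fromℕ-pos (<⇒≤ n≥2) ]) (k C 2) m))
        (AtIndex.conclusion m (k C 2) B (N C k) count
          (subst (λ e → N ^ k * L ^ e ≤ B * count * n ^ e * L) (c≡C j)
            (≤-trans many (*-monoˡ-≤ L (*-monoˡ-≤ (n ^ c j) (≤-trans (≤-reflexive (sym (*-assoc (B₀ j) (k !) count)))
              (*-monoˡ-≤ count (*-monoˡ-≤ (k !) (n≤1+n (B₀ j)))))))))
          (nCk≤n^k N k) 1≤B))
      (ℚ.≤-trans (ℚ.≤-reflexive (sym (ℚ.+-identityʳ (ι count)))) (ℚ.+-monoʳ-≤ (ι count) (ℚ.<⇒≤ 0<ε)))
  where
  j = suc i
  k = suc j
  B = suc (B₀ j) * k !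
  1≤B : 1 ≤ B
  1≤B = *-mono-≤ (s≤s (z≤n {B₀ j})) (n!>0 k)
    where
    n!>0 : ∀ n → 1 ≤ n !
    n!>0 zero    = ≤-refl
    n!>0 (suc n) = *-mono-≤ (s≤s (z≤n {n})) (n!>0 n)
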